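{- Let $R=GR(4,n)$, let $f:T\to T$ be a pseudo-planar function with $f(0)=0$, and let $\mathcal{S}_0,\dots,\mathcal{S}_5\subseteq R$ and $\mathcal{E}_0,\dots,\mathcal{E}_5\subseteq\widehat{R}$ be the sets associated with $f$ as defined in the context. Then $(R,\{\mathcal{S}_i\}_{i=0}^5)$ is a Schur ring, whose dual is $(\widehat{R},\{\mathcal{E}_i\}_{i=0}^5)$. If $n\ge 3$, then $(R,\{\mathcal{R}_i\}_{i=0}^5)$, where $\mathcal{R}_i=\{(x,y)\in R\times R\mid x-y\in\mathcal{S}_i\}$, is a $5$-class association scheme, whose first eigenmatrix $P$ (rows indexed by $\mathcal{E}_0,\dots,\mathcal{E}_5$, columns by $\mathcal{S}_0,\dots,\mathcal{S}_5$) and second eigenmatrix $Q$ are as follows, with $\mathbf{i}=\sqrt{ -1}$. When $n$ is odd, with $b=2^{(n-1)/2}$, $$P=\begin{bmatrix} 1&2b^2-1&2b^2-1&2b^2-1&2b^4-3b^2+1&2b^4-3b^2+1\\ 1&-1&-1&2b^2-1&-b^2+1&-b^2+1\\ 1&-1+b+b\mathbf{i}&-1+b-b\mathbf{i}&-1&(1-b)(1-b\mathbf{i})&(1-b)(1+b\mathbf{i})\\ 1&-1+b-b\mathbf{i}&-1+b+b\mathbf{i}&-1&(1-b)(1+b\mathbf{i})&(1-b)(1-b\mathbf{i})\\ 1&-1-b+b\mathbf{i}&-1-b-b\mathbf{i}&-1&(1+b)(1-b\mathbf{i})&(1+b)(1+b\mathbf{i})\\ 1&-1-b-b\mathbf{i}&-1-b+b\mathbf{i}&-1&(1+b)(1+b\mathbf{i})&(1+b)(1-b\mathbf{i})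 \end{bmatrix}$$ and $$Q=\begin{bmatrix} 1&2b^2-1&\frac b2(2b^3+2b^2-b-1)&\frac b2(2b^3+2b^2-b-1)&\frac b2(2b^3-2b^2-b+1)&\frac b2(2b^3-2b^2-b+1)\\ 1&-1&\frac b2(b^2-1-(b^2+b)\mathbf{i})&\frac b2(b^2-1+(b^2+b)\mathbf{i})&\frac b2(1-b^2-(b^2-b)\mathbf{i})&\frac b2(1-b^2+(b^2-b)\mathbf{i})\\ 1&-1&\frac b2(b^2-1+(b^2+b)\mathbf{i})&\frac b2(b^2-1-(b^2+b)\mathbf{i})&\frac b2(1-b^2+(b^2-b)\mathbf{i})&\frac b2(1-b^2-(b^2-b)\mathbf{i})\\ 1&2b^2-1&-\frac b2(1+b)&-\frac b2(1+b)&\frac b2(1-b)&\frac b2(1-b)\\ 1&-1&-\frac b2(1+b\mathbf{i})&\frac b2(-1+b\mathbf{i})&\frac b2(1+b\mathbf{i})&\frac b2(1-b\mathbf{i})\\ 1&-1&\frac b2(-1+b\mathbf{i})&-\frac b2(1+b\mathbf{i})&\frac b2(1-b\mathbf{i})&\frac{b(b^2+1)}{2(1-b\mathbf{i})} \end{bmatrix}.$$ When $n$ is even, with $b=2^{(n-2)/2}$, $$P=\begin{bmatrix} 1&4b^2-1&4b^2-1&4b^2-1&8b^4-10b^2+2&8b^4-2b^2\\ 1&-1&-1&4b^2-1&-2b^2+2&-2b^2\\ 1&2b-1&2b-1&-1&2b^2-4b+2&-2b^2\\ 1&-2b-1&-2b-1&-1&2b^2+4b+2&-2b^2\\ 1&-1+2b\mathbf{i}&-1-2b\mathbf{i}&-1&-2b^2+2&2b^2\\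 1&-1-2b\mathbf{i}&-1+2b\mathbf{i}&-1&-2b^2+2&2b^2 \end{bmatrix}$$ and $$Q=\begin{bmatrix} 1&4b^2-1&b(4b^3+4b^2-b-1)&b(4b^3-4b^2-b+1)&b^2(4b^2-1)&b^2(4b^2-1)\\ 1&-1&b(2b^2+b-1)&-(2b^2-b-1)b&-b^2(1+2b\mathbf{i})&b^2(-1+2b\mathbf{i})\\ 1&-1&b(2b^2+b-1)&-(2b^2-b-1)b&b^2(-1+2b\mathbf{i})&-b^2(1+2b\mathbf{i})\\ 1&4b^2-1&-b(1+b)&-b(-1+b)&-b^2&-b^2\\ 1&-1&b(-1+b)&b(1+b)&-b^2&-b^2\\ 1&-1&-b(1+b)&-b(-1+b)&b^2&b^2 \end{bmatrix}.$$
   Context: $R=GR(4,n)$ is the Galois ring of characteristic $4$ with $4^n$ elements, and $Z=\{2x\mid x\in R\}$. The unit group $R\setminus Z$ contains a cyclic subgroup of order $2^n-1$ generated by some $\xi$; $T=\{\xi^i\mid 0\le i\le 2^n-2\}\cup\{0\}$ is the Teichmüller system. Each $x\in R$ is uniquely $x=a+2b$ with $a,b\in T$. Write $\sqrt{x}=x^{2^{n-1}}$ for $x\in R$. With $x\oplus y=x+y+2\sqrt{xy}$, $(T,\oplus,\cdot)$ is a field with $2^n$ elements, identified with $\mathbb{F}_{2^n}$. A function $f:T\to T$ is pseudo-planar if for each $\epsilon\in T\setminus\{0\}$ the map $x\mapsto f(x\oplus\epsilon)\oplus f(x)\oplus \epsilon x$ is a permutation of $T$. Trace: $\mathrm{Tr}:R\to\mathbb{Z}_4$,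 $\mathrm{Tr}(x)=\sum_{i=0}^{n-1}\sigma^i(x)$, where $\sigma(a+2b)=a^2+2b^2$ for $a,b\in T$. The characters of $(R,+)$ are $\chi_a(x)=\mathbf{i}^{\mathrm{Tr}(ax)}$, $a\in R$, and $\widehat{R}=\{\chi_a\mid a\in R\}$. For a subset (or multiset) $A$ of $R$, $\chi(A)=\sum_{g\in A}\chi(g)$ (with multiplicity). Sets attached to $f$: $D_f=\{x+2\sqrt{f(x)}\mid x\in T\}$; $\mathcal{S}_0=\{0\}$; $\mathcal{S}_1=D_f\setminus\{0\}$; $\mathcal{S}_2=\{ -x\mid x\in\mathcal{S}_1\}$; $\mathcal{S}_3=Z\setminus\{0\}$; $\mathcal{S}_4$ is the set of elements of $R\setminus(\mathcal{S}_0\cup\mathcal{S}_1\cup\mathcal{S}_2\cup\mathcal{S}_3)$ of the form $d+d'$ with $d,d'\in D_f$; $\mathcal{S}_5$ is the set of all remaining elements of $R$. Partition of $\widehat{R}$: $\mathcal{E}_0=\{\chi_0\}$, $\mathcal{E}_1=\{\chi\mid\chi(\mathcal{S}_1)=-1\}=\{\chi_a\mid a\in Z\setminus\{0\}\}$, and $\mathcal{E}_j=\{\chi\in\widehat{R}\mid\chi(\mathcal{S}_1)=-1+v_j\}$ for $j=2,3,4,5$, where: if $n$ is odd, with $c=2^{(n-1)/2}$, $v_2=c+c\mathbf{i}$, $v_3=c-c\mathbf{i}$, $v_4=-c+c\mathbf{i}$, $v_5=-c-c\mathbf{i}$; if $n$ is even, $v_2=2^{n/2}$, $v_3=-2^{n/2}$,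 $v_4=2^{n/2}\mathbf{i}$, $v_5=-2^{n/2}\mathbf{i}$. Association schemes: Let $X$ be a finite nonempty set and $R_0,\dots,R_d$ a partition of $X\times X$ with $R_0$ the diagonal and such that the transpose of each $R_i$ is some $R_{i'}$. With $A_i$ the adjacency matrix of $R_i$, it is a $d$-class association scheme if $A_iA_j=\sum_k p_{i,j}^kA_k$ for some nonnegative integers $p_{i,j}^k$ (the schemes here are commutative). The span of the $A_i$ has a basis of pairwise orthogonal idempotents $E_0,\dots,E_d$; the first and second eigenmatrices $P=(P_{ji})$, $Q=(Q_{ji})$ (row $j$, column $i$) are defined by $A_i=\sum_jP_{ji}E_j$ and $E_i=\frac1{|X|}\sum_jQ_{ji}A_j$, so $PQ=|X|I$. Here the idempotents are ordered so that $P_{ji}=\chi(\mathcal{S}_i)$ for $\chi\in\mathcal{E}_j$. For a finite abelian group $X$ with partition $\{S_i\}_{i=0}^d$, $(X,\{S_i\})$ is a Schur ring if the relations $\{(x,y)\mid x-y\in S_i\}$ form an association scheme on $X$. Its dual is $(\widehat{X},\{T_i\})$, where the $T_i$ are the classes of the equivalence relation on $\widehat{X}$: $\chi\sim\chi'$ iff $\chi(S_i)=\chi'(S_i)$ for all $i$, with $T_0$ consisting of the principal character. For $n=1,2$ some of the sets $\mathcal{S}_i,\mathcal{E}_i$ are empty; empty classes are discarded. -}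

module Defs where

open import Algebra.Bundles using (AbelianGroup; CommutativeRing; RawRing)
import Algebra.Definitions.RawSemiring as RawSemiringDefinitions
import Algebra.Properties.CommutativeMonoid.Sum as Sum
import Algebra.Properties.Semiring.Exp as Exp
import Algebra.Properties.Semiring.Mult as Mult
open import Data.Bool.Base using (if_then_else_)
open import Data.Fin.Base as Fin using (Fin; zero; suc; toℕ)
open import Data.Fin.Patterns using (0F; 1F; 2F; 3F; 4F; 5F)
import Data.Fin.Properties as Fin
open import Data.Integer.Base using (+_)
open import Data.Nat.Base as ℕ using (ℕ; zero; suc)
open import Data.Nat.DivMod using (_/_; _%_)
open import Data.Nat.Divisibility using (_∣_)
open import Data.Nat.GeneralisedArithmetic using (fold)
open import Data.Product.Base using (∃; ∃₂; _×_; _,_)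
open import Data.Rational.Base as ℚ using (ℚ; 0ℚ; 1ℚ)
import Data.Rational.Properties as ℚ
import Data.Sum.Base as ⊎
open import Data.Sum.Base using (_⊎_)
open import Data.Unit.Base using (⊤; tt)
open import Data.Vec.Base using (Vec; []; _∷_; lookup)
open import Function.Base using (_∘_)
open import Function.Bundles using (Func; Inverse; _⇔_)
open import Level using (0ℓ)
open import Relation.Binary.Bundles using (Setoid)
open import Relation.Binary.Core using (Rel)
import Relation.Binary.Definitions as B
open import Relation.Binary.PropositionalEquality as ≡ using (_≡_; _≢_; _≗_)
open import Relation.Nullary using (¬_; Dec; yes; no; does)
open import Relation.Nullary.Decidable using (map′; ¬?; _×-dec_; _⊎-dec_)
open import Relation.Unary using (Pred; Decidable; Satisfiable)

------------------------------------------------------------------------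
-- The field ℚ(𝐢), standing in for ℂ: it contains all values of the
-- characters of a group of exponent 4.

record ℚ[i] : Set where
  constructor _+i_
  field
    re im : ℚ

open ℚ[i]

fromℚ : ℚ → ℚ[i]
fromℚ q = q +i 0ℚ

fromℕ : ℕ → ℚ[i]
fromℕ m = fromℚ (+ m ℚ./ 1)

𝐢 : ℚ[i]
𝐢 = 0ℚ +i 1ℚ

ℚ[i]-rawRing : RawRing 0ℓ 0ℓ
ℚ[i]-rawRing = record
  { Carrier = ℚ[i]
  ; _≈_     = _≡_
  ; _+_     = λ z w → (re z ℚ.+ re w) +i (im z ℚ.+ im w)
  ; _*_     = λ z w → (re z ℚ.* re w ℚ.- im z ℚ.* im w)
                   +i (re z ℚ.* im w ℚ.+ im z ℚ.* re w)
  ; -_      = λ z → (ℚ.- re z) +i (ℚ.- im z)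
  ; 0#      = 0ℚ +i 0ℚ
  ; 1#      = 1ℚ +i 0ℚ
  }

module ℂ where
  open RawRing ℚ[i]-rawRing public using (_+_; _*_; -_; 0#; 1#)
  open RawSemiringDefinitions (RawRing.rawSemiring ℚ[i]-rawRing) public
    using (sum) renaming (_^_ to infixr 9 _^_)

  infixl 6 _-_
  _-_ : ℚ[i] → ℚ[i] → ℚ[i]
  z - w = z + (- w)

  ∥_∥² : ℚ[i] → ℚ
  ∥ z ∥² = re z ℚ.* re z ℚ.+ im z ℚ.* im z

  -- Total division, with z ÷ 0 = 0; only used with nonzero divisors.
  infixl 7 _÷_
  _÷_ : ℚ[i] → ℚ[i] → ℚ[i]
  z ÷ w with ∥ w ∥² ℚ.≟ 0ℚ
  ... | yes _  = 0#
  ... | no ≢0 = z * (re w +i (ℚ.- im w)) * fromℚ ((ℚ.1/ ∥ w ∥²) {{ℚ.≢-nonZero ≢0}})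

------------------------------------------------------------------------
-- Finite setoids

Enumeration : Setoid 0ℓ 0ℓ → ℕ → Set
Enumeration X N = Inverse X (≡.setoid (Fin N))

module Finite {X : Setoid 0ℓ 0ℓ} {N : ℕ} (enum : Enumeration X N) where
  open Setoid X
  open Inverse enum

  infix 4 _≟_
  _≟_ : B.Decidable _≈_
  x ≟ y = map′
    (λ eq → trans (sym (strictlyInverseʳ x)) (trans (from-cong eq) (strictlyInverseʳ y)))
    to-cong
    (to x Fin.≟ to y)

  search : {P : Pred Carrier 0ℓ} → P B.Respects _≈_ → Decidable P → Dec (∃ P)
  search resp P? = map′
    (λ (k , p) → from k , p)
    (λ (x , p) → to x , resp (sym (strictlyInverseʳ x)) p)
    (Fin.any? (P? ∘ from))

  sumOver : {P : Pred Carrier 0ℓ} → Decidable P → (Carrier → ℚ[i]) → ℚ[i]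
  sumOver P? φ = ℂ.sum λ k → if does (P? (from k)) then φ (from k) else ℂ.0#

  sumAll : (Carrier → ℚ[i]) → ℚ[i]
  sumAll φ = ℂ.sum (φ ∘ from)

------------------------------------------------------------------------
-- Commutative association schemes, their idempotents and eigenmatrices

module _ {X : Setoid 0ℓ 0ℓ} {N : ℕ} (enum : Enumeration X N) where
  open Setoid X
  open Finite enum

  Matrix : Set
  Matrix = Carrier → Carrier → ℚ[i]

  infix 4 _≋_
  _≋_ : Matrix → Matrix → Set
  M ≋ M′ = ∀ x y → M x y ≡ M′ x y

  infixl 7 _⊗_
  _⊗_ : Matrix → Matrix → Matrix
  (M ⊗ M′) x y = sumAll λ z → M x z ℂ.* M′ z y

  𝟎 : Matrix
  𝟎 _ _ = ℂ.0#

  combination : ∀ {m} → (Fin m → ℚ[i]) → (Fin m → Matrix) → Matrix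
  combination c M x y = ℂ.sum λ k → c k ℂ.* M k x y

  module _ {d : ℕ} {Rᵢ : Fin (suc d) → Rel Carrier 0ℓ} (Rᵢ? : ∀ i → B.Decidable (Rᵢ i)) where

    adjacency : Fin (suc d) → Matrix
    adjacency i x y = if does (Rᵢ? i x y) then ℂ.1# else ℂ.0#

    record IsAssociationScheme : Set where
      field
        nonempty    : ∀ i → ∃₂ (Rᵢ i)
        covering    : ∀ x y → ∃ λ i → Rᵢ i x y
        disjoint    : ∀ {i j x y} → Rᵢ i x y → Rᵢ j x y → i ≡ j
        diagonal    : ∀ {x y} → Rᵢ zero x y ⇔ x ≈ y
        transpose   : ∀ i → ∃ λ i′ → ∀ {x y} → Rᵢ i′ x y ⇔ Rᵢ i y x
        p           : (i j k : Fin (suc d)) → ℕ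
        product     : ∀ i j → adjacency i ⊗ adjacency j ≋ combination (fromℕ ∘ p i j) adjacency
        commutative : ∀ i j → adjacency i ⊗ adjacency j ≋ adjacency j ⊗ adjacency i

    -- E is a basis of the span of the adjacency matrices consisting of
    -- pairwise orthogonal idempotents.
    record IsIdempotentBasis (E : Fin (suc d) → Matrix) : Set where
      field
        idempotent  : ∀ i → E i ⊗ E i ≋ E i
        orthogonal  : ∀ i j → i ≢ j → E i ⊗ E j ≋ 𝟎
        inSpan      : ∀ i → ∃ λ c → E i ≋ combination c adjacency
        spanning    : ∀ i → ∃ λ c → adjacency i ≋ combination c E
        independent : ∀ c → combination c E ≋ 𝟎 → ∀ i → c i ≡ ℂ.0#

    IsFirstEigenmatrix : (E : Fin (suc d) → Matrix) (P : Fin (suc d) → Fin (suc d) → ℚ[i]) → Set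
    IsFirstEigenmatrix E P = ∀ i → adjacency i ≋ combination (λ j → P j i) E

    IsSecondEigenmatrix : (E : Fin (suc d) → Matrix) (Q : Fin (suc d) → Fin (suc d) → ℚ[i]) → Set
    IsSecondEigenmatrix E Q =
      ∀ i → E i ≋ λ x y → (ℂ.1# ℂ.÷ fromℕ N) ℂ.* combination (λ j → Q j i) adjacency x y

------------------------------------------------------------------------
-- Schur rings and their duals

module _ (G : AbelianGroup 0ℓ 0ℓ) {N : ℕ} (enum : Enumeration (AbelianGroup.setoid G) N) where
  open AbelianGroup G
  open Finite enum

  difference : ∀ {m} → (Fin m → Pred Carrier 0ℓ) → Fin m → Rel Carrier 0ℓ
  difference S i x y = S i (x - y)

  difference? : ∀ {m} {S : Fin m → Pred Carrier 0ℓ} →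
                (∀ i → Decidable (S i)) → ∀ i → B.Decidable (difference S i)
  difference? S? i x y = S? i (x - y)

  module _ {d : ℕ} {S : Fin (suc d) → Pred Carrier 0ℓ} (S? : ∀ i → Decidable (S i)) where

    IsSchurRing : Set
    IsSchurRing = IsAssociationScheme enum (difference? S?)

    infix 4 _∼_
    _∼_ : Rel (Carrier → ℚ[i]) 0ℓ
    χ ∼ χ′ = ∀ i → sumOver (S? i) χ ≡ sumOver (S? i) χ′

    -- The Tⱼ are exactly the classes of ∼ on the character group Ĝ, which
    -- is given as a set of functions on G.
    record IsDual (Ĝ : Pred (Carrier → ℚ[i]) 0ℓ) {d′ : ℕ}
                  (T : Fin (suc d′) → Pred (Carrier → ℚ[i]) 0ℓ) : Set where
      field
        subset    : ∀ {j χ} → T j χ → Ĝ χ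
        nonempty  : ∀ j → Satisfiable (T j)
        covering  : ∀ {χ} → Ĝ χ → ∃ λ j → T j χ
        classes   : ∀ {j k χ χ′} → T j χ → T k χ′ → (j ≡ k) ⇔ (χ ∼ χ′)
        principal : ∀ {χ} → T zero χ ⇔ (∀ x → χ x ≡ ℂ.1#)

-- ι lists, in increasing order, the indices of the nonempty members of S,
-- so that S ∘ ι is S with its empty members discarded.
record DiscardsEmpty {A : Set} {m d : ℕ}
                     (S : Fin m → Pred A 0ℓ) (ι : Fin (suc d) → Fin m) : Set where
  field
    increasing : ∀ {i j} → i Fin.< j → ι i Fin.< ι j
    image      : ∀ i → (∃ λ j → ι j ≡ i) ⇔ Satisfiable (S i)

------------------------------------------------------------------------
-- Galois rings of characteristic 4

-- A Galois ring is a finite commutative ring whose zero divisors (zero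
-- included) form the ideal generated by a prime, here 2.  Together with the
-- characteristic and the order this determines the ring up to isomorphism.
-- The case n = 0 is excluded because the trivial ring has characteristic 1.
record GR4 (n : ℕ) : Set₁ where
  field
    commutativeRing : CommutativeRing 0ℓ 0ℓ

  open CommutativeRing commutativeRing public
  open Exp semiring public using (_^_; ^-congˡ)
  open Mult semiring public using (×-congʳ) renaming (_×_ to infixr 8 _·_)

  -- the ideal 2R
  Z : Pred Carrier 0ℓ
  Z x = ∃ λ y → x ≈ 2 · y

  field
    enum           : Enumeration setoid (4 ℕ.^ n)
    characteristic : ∀ k → (k · 1# ≈ 0#) ⇔ (4 ∣ k)
    zeroDivisors   : ∀ x → (∃ λ y → ¬ y ≈ 0# × x * y ≈ 0#) ⇔ Z x

  open Finite enum public

------------------------------------------------------------------------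
-- The numbers vⱼ and the eigenmatrices.  In this section natural-number
-- literals denote elements of ℚ(𝐢), except in exponents.

module Values where
  open import Agda.Builtin.FromNat using (Number; fromNat)
  import Data.Nat.Literals
  open ℂ

  instance
    number-ℕ : Number ℕ
    number-ℕ = Data.Nat.Literals.number

    number-ℚ[i] : Number ℚ[i]
    number-ℚ[i] = record { Constraint = λ _ → ⊤ ; fromNat = λ m → fromℕ m }

  SquareMatrix : Set
  SquareMatrix = Vec (Vec ℚ[i] 6) 6

  entry : SquareMatrix → Fin 6 → Fin 6 → ℚ[i]
  entry M j i = lookup (lookup M j) i

  -- v n k is the number written v_{k+2} for the given n.
  v : ℕ → Fin 4 → ℚ[i]
  v n with n % 2
  ... | zero  = lookup (c ∷ - c ∷ c * 𝐢 ∷ - (c * 𝐢) ∷ [])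
    where c = 2 ^ (n / 2)
  ... | suc _ = lookup (c + c * 𝐢 ∷ c - c * 𝐢 ∷ - c + c * 𝐢 ∷ - c - c * 𝐢 ∷ [])
    where c = 2 ^ ((n ℕ.∸ 1) / 2)

  module Odd (b : ℚ[i]) where

    P : SquareMatrix
    P =
      (1 ∷ 2 * b ^ 2 - 1 ∷ 2 * b ^ 2 - 1 ∷ 2 * b ^ 2 - 1
         ∷ 2 * b ^ 4 - 3 * b ^ 2 + 1 ∷ 2 * b ^ 4 - 3 * b ^ 2 + 1 ∷ []) ∷
      (1 ∷ - 1 ∷ - 1 ∷ 2 * b ^ 2 - 1 ∷ - b ^ 2 + 1 ∷ - b ^ 2 + 1 ∷ []) ∷
      (1 ∷ - 1 + b + b * 𝐢 ∷ - 1 + b - b * 𝐢 ∷ - 1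
         ∷ (1 - b) * (1 - b * 𝐢) ∷ (1 - b) * (1 + b * 𝐢) ∷ []) ∷
      (1 ∷ - 1 + b - b * 𝐢 ∷ - 1 + b + b * 𝐢 ∷ - 1
         ∷ (1 - b) * (1 + b * 𝐢) ∷ (1 - b) * (1 - b * 𝐢) ∷ []) ∷
      (1 ∷ - 1 - b + b * 𝐢 ∷ - 1 - b - b * 𝐢 ∷ - 1
         ∷ (1 + b) * (1 - b * 𝐢) ∷ (1 + b) * (1 + b * 𝐢) ∷ []) ∷
      (1 ∷ - 1 - b - b * 𝐢 ∷ - 1 - b + b * 𝐢 ∷ - 1
         ∷ (1 + b) * (1 + b * 𝐢) ∷ (1 + b) * (1 - b * 𝐢) ∷ []) ∷
      []

    h : ℚ[i]
    h = b ÷ 2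

    Q : SquareMatrix
    Q =
      (1 ∷ 2 * b ^ 2 - 1
         ∷ h * (2 * b ^ 3 + 2 * b ^ 2 - b - 1) ∷ h * (2 * b ^ 3 + 2 * b ^ 2 - b - 1)
         ∷ h * (2 * b ^ 3 - 2 * b ^ 2 - b + 1) ∷ h * (2 * b ^ 3 - 2 * b ^ 2 - b + 1) ∷ []) ∷
      (1 ∷ - 1
         ∷ h * (b ^ 2 - 1 - (b ^ 2 + b) * 𝐢) ∷ h * (b ^ 2 - 1 + (b ^ 2 + b) * 𝐢)
         ∷ h * (1 - b ^ 2 - (b ^ 2 - b) * 𝐢) ∷ h * (1 - b ^ 2 + (b ^ 2 - b) * 𝐢) ∷ []) ∷
      (1 ∷ - 1
         ∷ h * (b ^ 2 - 1 + (b ^ 2 + b) * 𝐢) ∷ h * (b ^ 2 - 1 - (b ^ 2 + b) * 𝐢)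
         ∷ h * (1 - b ^ 2 + (b ^ 2 - b) * 𝐢) ∷ h * (1 - b ^ 2 - (b ^ 2 - b) * 𝐢) ∷ []) ∷
      (1 ∷ 2 * b ^ 2 - 1
         ∷ - h * (1 + b) ∷ - h * (1 + b) ∷ h * (1 - b) ∷ h * (1 - b) ∷ []) ∷
      (1 ∷ - 1
         ∷ - h * (1 + b * 𝐢) ∷ h * (- 1 + b * 𝐢) ∷ h * (1 + b * 𝐢) ∷ h * (1 - b * 𝐢) ∷ []) ∷
      (1 ∷ - 1
         ∷ h * (- 1 + b * 𝐢) ∷ - h * (1 + b * 𝐢) ∷ h * (1 - b * 𝐢)
         ∷ (b * (b ^ 2 + 1)) ÷ (2 * (1 - b * 𝐢)) ∷ []) ∷
      []

  module Even (b : ℚ[i]) where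

    P : SquareMatrix
    P =
      (1 ∷ 4 * b ^ 2 - 1 ∷ 4 * b ^ 2 - 1 ∷ 4 * b ^ 2 - 1
         ∷ 8 * b ^ 4 - 10 * b ^ 2 + 2 ∷ 8 * b ^ 4 - 2 * b ^ 2 ∷ []) ∷
      (1 ∷ - 1 ∷ - 1 ∷ 4 * b ^ 2 - 1 ∷ - 2 * b ^ 2 + 2 ∷ - 2 * b ^ 2 ∷ []) ∷
      (1 ∷ 2 * b - 1 ∷ 2 * b - 1 ∷ - 1 ∷ 2 * b ^ 2 - 4 * b + 2 ∷ - 2 * b ^ 2 ∷ []) ∷
      (1 ∷ - 2 * b - 1 ∷ - 2 * b - 1 ∷ - 1 ∷ 2 * b ^ 2 + 4 * b + 2 ∷ - 2 * b ^ 2 ∷ []) ∷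
      (1 ∷ - 1 + 2 * b * 𝐢 ∷ - 1 - 2 * b * 𝐢 ∷ - 1 ∷ - 2 * b ^ 2 + 2 ∷ 2 * b ^ 2 ∷ []) ∷
      (1 ∷ - 1 - 2 * b * 𝐢 ∷ - 1 + 2 * b * 𝐢 ∷ - 1 ∷ - 2 * b ^ 2 + 2 ∷ 2 * b ^ 2 ∷ []) ∷
      []

    Q : SquareMatrix
    Q =
      (1 ∷ 4 * b ^ 2 - 1
         ∷ b * (4 * b ^ 3 + 4 * b ^ 2 - b - 1) ∷ b * (4 * b ^ 3 - 4 * b ^ 2 - b + 1)
         ∷ b ^ 2 * (4 * b ^ 2 - 1) ∷ b ^ 2 * (4 * b ^ 2 - 1) ∷ []) ∷
      (1 ∷ - 1
         ∷ b * (2 * b ^ 2 + b - 1) ∷ - (2 * b ^ 2 - b - 1) * b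
         ∷ - b ^ 2 * (1 + 2 * b * 𝐢) ∷ b ^ 2 * (- 1 + 2 * b * 𝐢) ∷ []) ∷
      (1 ∷ - 1
         ∷ b * (2 * b ^ 2 + b - 1) ∷ - (2 * b ^ 2 - b - 1) * b
         ∷ b ^ 2 * (- 1 + 2 * b * 𝐢) ∷ - b ^ 2 * (1 + 2 * b * 𝐢) ∷ []) ∷
      (1 ∷ 4 * b ^ 2 - 1
         ∷ - b * (1 + b) ∷ - b * (- 1 + b) ∷ - b ^ 2 ∷ - b ^ 2 ∷ []) ∷
      (1 ∷ - 1
         ∷ b * (- 1 + b) ∷ b * (1 + b) ∷ - b ^ 2 ∷ - b ^ 2 ∷ []) ∷
      (1 ∷ - 1
         ∷ - b * (1 + b) ∷ - b * (- 1 + b) ∷ b ^ 2 ∷ b ^ 2 ∷ []) ∷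
      []

------------------------------------------------------------------------
-- The Teichmüller system, pseudo-planar functions and characters

module Teichmüller {n : ℕ} (G : GR4 n) (ξ : GR4.Carrier G) where
  open GR4 G

  HasTeichmüllerOrder : Set
  HasTeichmüllerOrder = ∀ k → (ξ ^ k ≈ 1#) ⇔ ((2 ℕ.^ n ℕ.∸ 1) ∣ k)

  T : Pred Carrier 0ℓ
  T x = (x ≈ 0#) ⊎ ∃ λ (i : Fin (2 ℕ.^ n ℕ.∸ 1)) → x ≈ ξ ^ toℕ i

  T? : Decidable T
  T? x = (x ≟ 0#) ⊎-dec Fin.any? λ i → x ≟ ξ ^ toℕ i

  T-resp : T B.Respects _≈_
  T-resp x≈y = ⊎.map (trans (sym x≈y)) λ (i , eq) → i , trans (sym x≈y) eq

  √ : Carrier → Carrier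
  √ x = x ^ (2 ℕ.^ (n ℕ.∸ 1))

  infixl 6 _⊕_
  _⊕_ : Carrier → Carrier → Carrier
  x ⊕ y = x + y + 2 · √ (x * y)

  record PermutesT (g : Carrier → Carrier) : Set where
    field
      closed     : ∀ {x} → T x → T (g x)
      injective  : ∀ {x y} → T x → T y → g x ≈ g y → x ≈ y
      surjective : ∀ {y} → T y → ∃ λ x → T x × g x ≈ y

  -- A function T → T is given by any extension to R.
  record IsPseudoPlanar (f : Func setoid setoid) : Set where
    open Func f using (to)
    field
      closed   : ∀ {x} → T x → T (to x)
      permutes : ∀ {ε} → T ε → ¬ ε ≈ 0# → PermutesT λ x → to (x ⊕ ε) ⊕ to x ⊕ ε * x

  IsExpansion : Carrier → Carrier → Carrier → Set
  IsExpansion x a b = T a × T b × x ≈ a + 2 · b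

  expand? : ∀ x → Dec (∃₂ (IsExpansion x))
  expand? x =
    search (λ a≈a′ (b , a∈T , b∈T , eq) →
              b , T-resp a≈a′ a∈T , b∈T , trans eq (+-congʳ a≈a′)) λ a →
    search (λ b≈b′ (a∈T , b∈T , eq) →
              a∈T , T-resp b≈b′ b∈T , trans eq (+-congˡ (×-congʳ 2 b≈b′))) λ b →
    T? a ×-dec T? b ×-dec x ≟ a + 2 · b

  -- The expansion always exists, so the second clause is never reached.
  σ : Carrier → Carrier
  σ x with expand? x
  ... | yes (a , b , _) = a ^ 2 + 2 · b ^ 2
  ... | no _            = 0#

  trace : Carrier → Carrier
  trace x = sum λ (i : Fin n) → fold x σ (toℕ i)
    where open Sum +-commutativeMonoid using (sum)

  -- The trace as an element of ℤ/4, identified with the subring generated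
  -- by 1; it always lies there, so the second clause is never reached.
  Tr : Carrier → Fin 4
  Tr x with Fin.any? (λ (k : Fin 4) → trace x ≟ toℕ k · 1#)
  ... | yes (k , _) = k
  ... | no _        = 0F

  χ[_] : Carrier → Carrier → ℚ[i]
  χ[ a ] x = 𝐢 ℂ.^ toℕ (Tr (a * x))

  R̂ : Pred (Carrier → ℚ[i]) 0ℓ
  R̂ χ = ∃ λ a → χ ≗ χ[ a ]

------------------------------------------------------------------------
-- The sets attached to f

module Classes {n : ℕ} (G : GR4 n) (ξ : GR4.Carrier G)
               (f : Func (GR4.setoid G) (GR4.setoid G)) where
  open GR4 G
  open Teichmüller G ξ
  open Func f using () renaming (to to f′; cong to f-cong)

  D S₀ S₁ S₂ S₃ S₀₋₃ S₄ S₅ : Pred Carrier 0ℓ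
  D y    = ∃ λ x → T x × y ≈ x + 2 · √ (f′ x)
  S₀ y   = y ≈ 0#
  S₁ y   = D y × ¬ y ≈ 0#
  S₂ y   = ∃ λ x → S₁ x × y ≈ - x
  S₃ y   = Z y × ¬ y ≈ 0#
  S₀₋₃ y = S₀ y ⊎ S₁ y ⊎ S₂ y ⊎ S₃ y
  S₄ y   = ¬ S₀₋₃ y × ∃₂ λ d d′ → D d × D d′ × y ≈ d + d′
  S₅ y   = ¬ S₀₋₃ y × ¬ S₄ y

  S : Fin 6 → Pred Carrier 0ℓ
  S 0F = S₀
  S 1F = S₁
  S 2F = S₂
  S 3F = S₃
  S 4F = S₄
  S 5F = S₅

  D-resp : D B.Respects _≈_
  D-resp y≈y′ (x , x∈T , eq) = x , x∈T , trans (sym y≈y′) eq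

  D? : Decidable D
  D? y = search
    (λ x≈x′ (x∈T , eq) → T-resp x≈x′ x∈T ,
       trans eq (+-cong x≈x′ (×-congʳ 2 (^-congˡ (2 ℕ.^ (n ℕ.∸ 1)) (f-cong x≈x′)))))
    λ x → T? x ×-dec y ≟ x + 2 · √ (f′ x)

  S₀? : Decidable S₀
  S₀? y = y ≟ 0#

  S₁? : Decidable S₁
  S₁? y = D? y ×-dec ¬? (y ≟ 0#)

  S₂? : Decidable S₂
  S₂? y = search
    (λ x≈x′ ((x∈D , x≉0) , eq) →
       (D-resp x≈x′ x∈D , x≉0 ∘ trans x≈x′) , trans eq (-‿cong x≈x′))
    λ x → S₁? x ×-dec y ≟ - x

  Z? : Decidable Z
  Z? x = search (λ y≈y′ eq → trans eq (×-congʳ 2 y≈y′)) λ y → x ≟ 2 · y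

  S₃? : Decidable S₃
  S₃? y = Z? y ×-dec ¬? (y ≟ 0#)

  S₀₋₃? : Decidable S₀₋₃
  S₀₋₃? y = S₀? y ⊎-dec S₁? y ⊎-dec S₂? y ⊎-dec S₃? y

  S₄? : Decidable S₄
  S₄? y = ¬? (S₀₋₃? y) ×-dec
    (search (λ d≈ (d′ , d∈D , d′∈D , eq) →
               d′ , D-resp d≈ d∈D , d′∈D , trans eq (+-congʳ d≈)) λ d →
     search (λ d′≈ (d∈D , d′∈D , eq) →
               d∈D , D-resp d′≈ d′∈D , trans eq (+-congˡ d′≈)) λ d′ →
     D? d ×-dec D? d′ ×-dec y ≟ d + d′)

  S₅? : Decidable S₅
  S₅? y = ¬? (S₀₋₃? y) ×-dec ¬? (S₄? y)

  S? : ∀ i → Decidable (S i)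
  S? 0F = S₀?
  S? 1F = S₁?
  S? 2F = S₂?
  S? 3F = S₃?
  S? 4F = S₄?
  S? 5F = S₅?

  𝓔 : Fin 6 → Pred (Carrier → ℚ[i]) 0ℓ
  𝓔 0F            χ = χ ≗ χ[ 0# ]
  𝓔 1F            χ = R̂ χ × sumOver S₁? χ ≡ ℂ.- ℂ.1#
  𝓔 (suc (suc k)) χ = R̂ χ × sumOver S₁? χ ≡ ℂ.- ℂ.1# ℂ.+ Values.v n k

  𝓡? : ∀ i → B.Decidable (difference +-abelianGroup enum S i)
  𝓡? = difference? +-abelianGroup enum S?

  -- P and Q are the eigenmatrices of the scheme, for the ordering of the
  -- idempotents in which P j i = χ(Sᵢ) for χ ∈ 𝓔ⱼ.
  HasEigenmatrices : Values.SquareMatrix → Values.SquareMatrix → Set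
  HasEigenmatrices P Q =
    ∃ λ E → IsIdempotentBasis enum 𝓡? E
          × IsFirstEigenmatrix enum 𝓡? E (Values.entry P)
          × IsSecondEigenmatrix enum 𝓡? E (Values.entry Q)
          × (∀ j χ → 𝓔 j χ → ∀ i → Values.entry P j i ≡ sumOver (S? i) χ)

{-# OPTIONS --safe #-}
module Submission where

open import Defs
open import Algebra.Bundles using (AbelianGroup; CommutativeRing; RawRing)
import Algebra.Properties.AbelianGroup as AbelianGroupProperties
import Algebra.Properties.CommutativeMonoid.Sum as CommutativeMonoidSum
import Algebra.Properties.CommutativeSemigroup as CommutativeSemigroupProperties
import Algebra.Properties.CommutativeSemiring.Exp as Exp
import Algebra.Properties.Ring as RingProperties
import Algebra.Properties.Semiring.Mult as Mult
import Algebra.Properties.Semiring.Sum as SemiringSum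
import Algebra.Solver.Ring
import Algebra.Solver.Ring.AlmostCommutativeRing as ACR
import Algebra.Solver.Ring.Simple as RingSolver
open import Algebra.Structures using (IsCommutativeRing)
open import Data.Bool.Base using (if_then_else_)
open import Data.Fin.Base as Fin using (Fin; zero; suc; toℕ)
open import Data.Fin.Patterns using (0F; 1F; 2F; 3F; 4F; 5F)
open import Data.Fin.Permutation using (permutation)
import Data.Fin.Properties as Fin
open import Data.Integer.Base as ℤ using (ℤ; +_; -[1+_])
import Data.Integer.Properties as ℤ
open import Data.List.Base using (List; []; _∷_)
open import Data.Maybe.Base as Maybe using (Maybe)
open import Data.Nat.Base as ℕ using (ℕ; zero; suc; _∸_)
open import Data.Nat.Divisibility as ∣ using (_∣_; divides)
open import Data.Nat.DivMod using (_/_; _%_; m≡m%n+[m/n]*n; m%n<n; m*n/n≡m; [m+kn]%n≡m%n; m*n%n≡0)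
open import Data.Nat.GeneralisedArithmetic using (fold)
import Data.Nat.Literals
import Data.Nat.Properties as ℕ
import Data.Nat.Solver as ℕSolver
open import Data.Product.Base using (∃; ∃₂; _×_; _,_; proj₁; proj₂)
open import Data.Rational.Base as ℚ using (ℚ; 0ℚ; 1ℚ; mkℚ)
import Data.Rational.Properties as ℚ
import Data.Rational.Solver as ℚSolver
import Data.Rational.Unnormalised.Base as ℚᵘ
import Data.Rational.Unnormalised.Properties as ℚᵘ
open import Data.Sum.Base using (_⊎_; inj₁; inj₂)
open import Data.Unit.Base using (⊤)
open import Data.Vec.Base as Vec using (Vec; []; _∷_; lookup; tabulate)
import Data.Vec.Functional as Vector
import Data.Vec.Properties as Vec
open import Function.Base using (_∘_; id)
open import Function.Bundles using (Inverse; Equivalence; _⇔_; mk⇔; Func)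
open import Level using (0ℓ)
open import Relation.Binary.Bundles using (Setoid)
open import Relation.Binary.Consequences using (dec⇒weaklyDec)
open import Relation.Binary.Definitions using (DecidableEquality; tri<; tri≈; tri>)
open import Relation.Binary.PropositionalEquality as ≡ using (_≡_; _≢_; _≗_; cong; cong₂; subst; subst₂; module ≡-Reasoning)
import Relation.Binary.Reasoning.Setoid as SetoidReasoning
open import Relation.Nullary using (¬_; Dec; yes; no; contradiction; does)
open import Relation.Nullary.Decidable using (map′; _×-dec_; _→-dec_; ¬?; decidable-stable; dec-true; dec-false; from-yes)
open import Relation.Unary using (Pred; Decidable; Satisfiable)

open ℚ[i]

-- The set D meets every coset of Z in one element, and pseudo-planarity of f
-- says that every x ∉ Z is in exactly one way a difference of elements of D.
-- Hence |χ(D)|² = 2ⁿ for the characters χ that are nontrivial on Z, and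
-- χ(D) = 0 for the other nonprincipal ones.  In the first case χ(D) is a
-- Gaussian integer of norm 2ⁿ and therefore one of v₂, …, v₅; it satisfies
-- χ(D)³ = s 2ⁿ conj χ(D) with s = 1 for even and s = - 1 for odd n.  So
-- D³ = s 2ⁿ (- D) + (2ⁿ - s) R in the group ring, and the coefficients of 0
-- show that S₂ is contained in D + D if s = 1 and disjoint from it if s = - 1.
-- A sum of two elements of D lying outside Z determines them up to order, so
-- D² = Z + 2 S₁ + (1 + s) S₂ + 2 S₄.  Thus all χ(Sᵢ) can be expressed by χ(D),
-- χ(Z) and χ(R), which gives the matrix P.  As P Q = 4ⁿ I, the Fourier transform
-- of eⱼ = 4⁻ⁿ Σₖ Qₖⱼ Sₖ is the indicator function of 𝓔ⱼ.  Hence the eⱼ are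
-- orthogonal idempotents for the convolution, and they span the same space of
-- functions as the Sᵢ.

-- Gaussian rationals

module ℚ[i]-Properties where
  open ≡ using (refl; sym; trans)
  open ℂ
  open ℚSolver.+-*-Solver using (solve; con; _:=_; _:+_; _:*_; _:-_; :-_)

  ext : ∀ {z w} → re z ≡ re w → im z ≡ im w → z ≡ w
  ext = cong₂ _+i_

  +-assoc : ∀ x y z → (x + y) + z ≡ x + (y + z)
  +-assoc x y z = ext (ℚ.+-assoc (re x) (re y) (re z)) (ℚ.+-assoc (im x) (im y) (im z))

  +-comm : ∀ x y → x + y ≡ y + x
  +-comm x y = ext (ℚ.+-comm (re x) (re y)) (ℚ.+-comm (im x) (im y))

  +-identityˡ : ∀ x → 0# + x ≡ x
  +-identityˡ x = ext (ℚ.+-identityˡ (re x)) (ℚ.+-identityˡ (im x))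

  +-identityʳ : ∀ x → x + 0# ≡ x
  +-identityʳ x = ext (ℚ.+-identityʳ (re x)) (ℚ.+-identityʳ (im x))

  +-inverseˡ : ∀ x → - x + x ≡ 0#
  +-inverseˡ x = ext (ℚ.+-inverseˡ (re x)) (ℚ.+-inverseˡ (im x))

  +-inverseʳ : ∀ x → x + - x ≡ 0#
  +-inverseʳ x = ext (ℚ.+-inverseʳ (re x)) (ℚ.+-inverseʳ (im x))

  *-assoc : ∀ x y z → (x * y) * z ≡ x * (y * z)
  *-assoc (a +i b) (c +i d) (e +i f) = ext
    (solve 6 (λ a b c d e f → (a :* c :- b :* d) :* e :- (a :* d :+ b :* c) :* f
                           := a :* (c :* e :- d :* f) :- b :* (c :* f :+ d :* e)) refl a b c d e f)
    (solve 6 (λ a b c d e f → (a :* c :- b :* d) :* f :+ (a :* d :+ b :* c) :* e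
                           := a :* (c :* f :+ d :* e) :+ b :* (c :* e :- d :* f)) refl a b c d e f)

  *-comm : ∀ x y → x * y ≡ y * x
  *-comm (a +i b) (c +i d) = ext
    (solve 4 (λ a b c d → a :* c :- b :* d := c :* a :- d :* b) refl a b c d)
    (solve 4 (λ a b c d → a :* d :+ b :* c := c :* b :+ d :* a) refl a b c d)

  *-identityˡ : ∀ x → 1# * x ≡ x
  *-identityˡ (a +i b) = ext
    (solve 2 (λ a b → con 1ℚ :* a :- con 0ℚ :* b := a) refl a b)
    (solve 2 (λ a b → con 1ℚ :* b :+ con 0ℚ :* a := b) refl a b)

  *-distribʳ-+ : ∀ x y z → (y + z) * x ≡ y * x + z * x
  *-distribʳ-+ (a +i b) (c +i d) (e +i f) = ext
    (solve 6 (λ a b c d e f → (c :+ e) :* a :- (d :+ f) :* b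
                           := (c :* a :- d :* b) :+ (e :* a :- f :* b)) refl a b c d e f)
    (solve 6 (λ a b c d e f → (c :+ e) :* b :+ (d :+ f) :* a
                           := (c :* b :+ d :* a) :+ (e :* b :+ f :* a)) refl a b c d e f)

  isCommutativeRing : IsCommutativeRing _≡_ _+_ _*_ (λ z → - z) 0# 1#
  isCommutativeRing = record
    { isRing = record
      { +-isAbelianGroup = record
        { isGroup = record
          { isMonoid = record
            { isSemigroup = record
              { isMagma = record { isEquivalence = ≡.isEquivalence ; ∙-cong = cong₂ _+_ }
              ; assoc = +-assoc
              }
            ; identity = +-identityˡ , +-identityʳ
            }
          ; inverse = +-inverseˡ , +-inverseʳ
          ; ⁻¹-cong = cong (λ z → - z)
          }
        ; comm = +-comm
        }
      ; *-cong = cong₂ _*_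
      ; *-assoc = *-assoc
      ; *-identity = *-identityˡ , λ x → trans (*-comm x 1#) (*-identityˡ x)
      ; distrib = (λ x y z → trans (*-comm x (y + z)) (trans (*-distribʳ-+ x y z)
                    (cong₂ _+_ (*-comm y x) (*-comm z x)))) , *-distribʳ-+
      }
    ; *-comm = *-comm
    }

  commutativeRing : CommutativeRing 0ℓ 0ℓ
  commutativeRing = record { isCommutativeRing = isCommutativeRing }

  infix 4 _≟_
  _≟_ : DecidableEquality ℚ[i]
  (a +i b) ≟ (c +i d) = map′ (λ (p , q) → ext p q) (λ eq → cong re eq , cong im eq)
    (a ℚ.≟ c ×-dec b ℚ.≟ d)

  module Solver = RingSolver (ACR.fromCommutativeRing commutativeRing) _≟_

  fromℤ : ℤ → ℚ
  fromℤ z = z ℚ./ 1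

  fromℤ-injective : ∀ {a b} → fromℤ a ≡ fromℤ b → a ≡ b
  fromℤ-injective {a} {b} eq with ℚᵘ.*≡* eq′ ← ℚ.fromℚᵘ-injective {ℚᵘ.mkℚᵘ a 0} {ℚᵘ.mkℚᵘ b 0} eq =
    trans (sym (ℤ.*-identityʳ a)) (trans eq′ (ℤ.*-identityʳ b))

  private
    toℚᵘ-fromℤ : ∀ a → ℚ.toℚᵘ (fromℤ a) ℚᵘ.≃ ℚᵘ.mkℚᵘ a 0
    toℚᵘ-fromℤ a = ℚ.toℚᵘ-fromℚᵘ (ℚᵘ.mkℚᵘ a 0)

  fromℤ-+ : ∀ a b → fromℤ (a ℤ.+ b) ≡ fromℤ a ℚ.+ fromℤ b
  fromℤ-+ a b = ℚ.toℚᵘ-injective (ℚᵘ.≃-trans (toℚᵘ-fromℤ (a ℤ.+ b)) (ℚᵘ.≃-sym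
    (ℚᵘ.≃-trans (ℚ.toℚᵘ-homo-+ (fromℤ a) (fromℤ b))
    (ℚᵘ.≃-trans (ℚᵘ.+-cong (toℚᵘ-fromℤ a) (toℚᵘ-fromℤ b))
    (ℚᵘ.*≡* (cong (ℤ._* (+ 1)) (cong₂ ℤ._+_ (ℤ.*-identityʳ a) (ℤ.*-identityʳ b))))))))

  fromℤ-* : ∀ a b → fromℤ (a ℤ.* b) ≡ fromℤ a ℚ.* fromℤ b
  fromℤ-* a b = ℚ.toℚᵘ-injective (ℚᵘ.≃-trans (toℚᵘ-fromℤ (a ℤ.* b)) (ℚᵘ.≃-sym
    (ℚᵘ.≃-trans (ℚ.toℚᵘ-homo-* (fromℤ a) (fromℤ b))
    (ℚᵘ.*-cong (toℚᵘ-fromℤ a) (toℚᵘ-fromℤ b)))))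

  fromℤ-neg : ∀ a → fromℤ (ℤ.- a) ≡ ℚ.- fromℤ a
  fromℤ-neg a = ℚ.toℚᵘ-injective (ℚᵘ.≃-trans (toℚᵘ-fromℤ (ℤ.- a)) (ℚᵘ.≃-sym
    (ℚᵘ.≃-trans (ℚ.toℚᵘ-homo‿- (fromℤ a)) (ℚᵘ.-‿cong (toℚᵘ-fromℤ a)))))

  fromℕ-injective : ∀ {a b} → fromℕ a ≡ fromℕ b → a ≡ b
  fromℕ-injective = ℤ.+-injective ∘ fromℤ-injective ∘ cong re

  fromℕ-+ : ∀ a b → fromℕ (a ℕ.+ b) ≡ fromℕ a + fromℕ b
  fromℕ-+ a b = ext (fromℤ-+ (+ a) (+ b)) refl

  fromℕ-* : ∀ a b → fromℕ (a ℕ.* b) ≡ fromℕ a * fromℕ b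
  fromℕ-* a b = ext
    (trans (cong fromℤ (ℤ.pos-* a b)) (trans (fromℤ-* (+ a) (+ b))
      (solve 2 (λ x y → x :* y := x :* y :- con 0ℚ :* con 0ℚ) refl (fromℤ (+ a)) (fromℤ (+ b)))))
    (solve 2 (λ x y → con 0ℚ := x :* con 0ℚ :+ con 0ℚ :* y) refl (fromℤ (+ a)) (fromℤ (+ b)))

  conj : ℚ[i] → ℚ[i]
  conj z = re z +i (ℚ.- im z)

  conj-+ : ∀ z w → conj (z + w) ≡ conj z + conj w
  conj-+ z w = ext refl (ℚ.neg-distrib-+ (im z) (im w))

  conj-* : ∀ z w → conj (z * w) ≡ conj z * conj w
  conj-* (a +i b) (c +i d) = ext
    (solve 4 (λ a b c d → a :* c :- b :* d := a :* c :- (:- b) :* (:- d)) refl a b c d)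
    (solve 4 (λ a b c d → :- (a :* d :+ b :* c) := a :* (:- d) :+ (:- b) :* c) refl a b c d)

  conj-involutive : ∀ z → conj (conj z) ≡ z
  conj-involutive (a +i b) = ext refl (solve 1 (λ b → :- (:- b) := b) refl b)

  z*conj-z : ∀ z → z * conj z ≡ fromℚ ∥ z ∥²
  z*conj-z (a +i b) = ext
    (solve 2 (λ a b → a :* a :- b :* (:- b) := a :* a :+ b :* b) refl a b)
    (solve 2 (λ a b → a :* (:- b) :+ b :* a := con 0ℚ) refl a b)

  z*conj-z*∥z∥⁻² : ∀ z (z≢0 : ∥ z ∥² ≢ 0ℚ) → z * conj z * fromℚ ((ℚ.1/ ∥ z ∥²) {{ℚ.≢-nonZero z≢0}}) ≡ 1#
  z*conj-z*∥z∥⁻² z z≢0 = trans (cong (_* s) (z*conj-z z)) (ext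
    (trans (solve 2 (λ x y → x :* y :- con 0ℚ :* con 0ℚ := x :* y) refl ∥ z ∥² ∥z∥⁻²) (ℚ.*-inverseʳ ∥ z ∥²))
    (solve 2 (λ x y → x :* con 0ℚ :+ con 0ℚ :* y := con 0ℚ) refl ∥ z ∥² ∥z∥⁻²))
    where
    instance
      _ = ℚ.≢-nonZero z≢0
    ∥z∥⁻² : ℚ
    ∥z∥⁻² = ℚ.1/ ∥ z ∥²
    s : ℚ[i]
    s = fromℚ ∥z∥⁻²

  *-≢0 : ∀ {z w} → ∥ z ∥² ≢ 0ℚ → z * w ≡ 0# → w ≡ 0#
  *-≢0 {z} {w} z≢0 eq = begin
    w                           ≡⟨ *-identityˡ w ⟨
    1# * w                      ≡⟨ cong (_* w) (z*conj-z*∥z∥⁻² z z≢0) ⟨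
    (z * conj z * s) * w        ≡⟨ S.solve 4 (λ z c s w → (z S.:* c S.:* s) S.:* w S.:= c S.:* s S.:* (z S.:* w)) refl z (conj z) s w ⟩
    conj z * s * (z * w)        ≡⟨ cong ((conj z * s) *_) eq ⟩
    conj z * s * 0#             ≡⟨ S.solve 1 (λ c → c S.:* S.con 0# S.:= S.con 0#) refl (conj z * s) ⟩
    0#                          ∎
    where
    open ≡-Reasoning
    module S = Solver
    s : ℚ[i]
    s = fromℚ ((ℚ.1/ ∥ z ∥²) {{ℚ.≢-nonZero z≢0}})

-- Sums over finite setoids

module Summation where
  open ℚ[i]-Properties
  open CommutativeMonoidSum (CommutativeRing.+-commutativeMonoid commutativeRing) public
    using (sum-cong-≗; ∑-distrib-+; ∑-comm; sum-permute; sum-replicate-zero)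
  open SemiringSum (CommutativeRing.semiring commutativeRing) public
    using (*-distribˡ-sum; *-distribʳ-sum)

  sum-zero : ∀ {n} (f : Fin n → ℚ[i]) → (∀ k → f k ≡ ℂ.0#) → ℂ.sum f ≡ ℂ.0#
  sum-zero {n} f f≡0 = ≡.trans (sum-cong-≗ f≡0) (sum-replicate-zero n)

  sum-single : ∀ {n} (f : Fin n → ℚ[i]) k → (∀ l → l ≢ k → f l ≡ ℂ.0#) → ℂ.sum f ≡ f k
  sum-single f zero    f≡0 = ≡.trans
    (cong (f zero ℂ.+_) (sum-zero (f ∘ suc) λ l → f≡0 (suc l) λ ()))
    (+-identityʳ (f zero))
  sum-single f (suc k) f≡0 = ≡.trans
    (cong₂ ℂ._+_ (f≡0 zero λ ()) (sum-single (f ∘ suc) k λ l l≢k → f≡0 (suc l) (l≢k ∘ Fin.suc-injective)))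
    (+-identityˡ (f (suc k)))

  sum-one : ∀ n → ℂ.sum {n} (λ _ → ℂ.1#) ≡ fromℕ n
  sum-one zero    = ≡.refl
  sum-one (suc n) = ≡.trans (cong (ℂ.1# ℂ.+_) (sum-one n)) (≡.sym (fromℕ-+ 1 n))

  𝟙 : {P : Set} → Dec P → ℚ[i]
  𝟙 d = if does d then ℂ.1# else ℂ.0#

  𝟙-true : {P : Set} (d : Dec P) → P → 𝟙 d ≡ ℂ.1#
  𝟙-true d p = cong (if_then ℂ.1# else ℂ.0#) (dec-true d p)

  𝟙-false : {P : Set} (d : Dec P) → ¬ P → 𝟙 d ≡ ℂ.0#
  𝟙-false d ¬p = cong (if_then ℂ.1# else ℂ.0#) (dec-false d ¬p)

  𝟙-cong : {P Q : Set} (d : Dec P) (e : Dec Q) → (P → Q) → (Q → P) → 𝟙 d ≡ 𝟙 e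
  𝟙-cong (yes p) e P⇒Q _   = ≡.sym (𝟙-true e (P⇒Q p))
  𝟙-cong (no ¬p) e _   Q⇒P = ≡.sym (𝟙-false e (¬p ∘ Q⇒P))

  𝟙-× : {P Q : Set} (d : Dec P) (e : Dec Q) → 𝟙 (d ×-dec e) ≡ 𝟙 d ℂ.* 𝟙 e
  𝟙-× (yes _) (yes _) = ≡.refl
  𝟙-× (yes _) (no _)  = ≡.refl
  𝟙-× (no _)  (yes _) = ≡.refl
  𝟙-× (no _)  (no _)  = ≡.refl

  0*z : ∀ z → ℂ.0# ℂ.* z ≡ ℂ.0#
  0*z = CommutativeRing.zeroˡ commutativeRing

  1*z : ∀ z → ℂ.1# ℂ.* z ≡ z
  1*z = *-identityˡ

  z*0 : ∀ z → z ℂ.* ℂ.0# ≡ ℂ.0#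
  z*0 = CommutativeRing.zeroʳ commutativeRing

  z*1 : ∀ z → z ℂ.* ℂ.1# ≡ z
  z*1 = CommutativeRing.*-identityʳ commutativeRing

  sum-𝟙-natural : ∀ {n} {P : Pred (Fin n) 0ℓ} (P? : Decidable P) →
                  ∃ λ m → ℂ.sum (λ k → 𝟙 (P? k)) ≡ fromℕ m
  sum-𝟙-natural {zero}      P? = 0 , ≡.refl
  sum-𝟙-natural {suc n} {P} P? = cases (P? zero)
    where
    rest : ∃ λ m → ℂ.sum (λ k → 𝟙 (P? (suc k))) ≡ fromℕ m
    rest = sum-𝟙-natural (P? ∘ suc)

    cases : (d : Dec (P zero)) → ∃ λ m → 𝟙 d ℂ.+ ℂ.sum (λ k → 𝟙 (P? (suc k))) ≡ fromℕ m
    cases (yes _) = suc (proj₁ rest) , ≡.trans (cong (ℂ.1# ℂ.+_) (proj₂ rest)) (≡.sym (fromℕ-+ 1 (proj₁ rest)))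
    cases (no _)  = proj₁ rest , ≡.trans (+-identityˡ _) (proj₂ rest)

  sum-𝟙≡0 : ∀ {n} {P : Pred (Fin n) 0ℓ} (P? : Decidable P) →
            ℂ.sum (λ k → 𝟙 (P? k)) ≡ ℂ.0# → ∀ k → ¬ P k
  sum-𝟙≡0 {suc n} {P} P? = cases (P? zero)
    where
    rest : ∃ λ m → ℂ.sum (λ k → 𝟙 (P? (suc k))) ≡ fromℕ m
    rest = sum-𝟙-natural (P? ∘ suc)

    1+m≢0 : ∀ {m : ℕ} → fromℕ (suc m) ≢ ℂ.0#
    1+m≢0 {m} eq = contradiction (fromℕ-injective {suc m} {0} eq) λ ()

    cases : (d : Dec (P zero)) → 𝟙 d ℂ.+ ℂ.sum (λ k → 𝟙 (P? (suc k))) ≡ ℂ.0# → ∀ k → ¬ P k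
    cases (yes _) eq k = contradiction
      (≡.trans (fromℕ-+ 1 (proj₁ rest)) (≡.trans (cong (ℂ.1# ℂ.+_) (≡.sym (proj₂ rest))) eq)) (1+m≢0 {proj₁ rest})
    cases (no ¬p) eq zero    = ¬p
    cases (no ¬p) eq (suc k) = sum-𝟙≡0 (P? ∘ suc) (≡.trans (≡.sym (+-identityˡ _)) eq) k

module FiniteSums {X : Setoid 0ℓ 0ℓ} {N : ℕ} (enum : Enumeration X N) where
  open Setoid X
  open Inverse enum using (to; from; to-cong; strictlyInverseʳ; strictlyInverseˡ)
  open Finite enum
  open ℚ[i]-Properties hiding (_≟_)
  open Summation

  Respecting : Pred (Carrier → ℚ[i]) 0ℓ
  Respecting φ = ∀ {x y} → x ≈ y → φ x ≡ φ y

  sumAll-cong : ∀ {φ ψ} → (∀ x → φ x ≡ ψ x) → sumAll φ ≡ sumAll ψ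
  sumAll-cong eq = sum-cong-≗ (eq ∘ from)

  sumAll-+ : ∀ φ ψ → sumAll (λ x → φ x ℂ.+ ψ x) ≡ sumAll φ ℂ.+ sumAll ψ
  sumAll-+ φ ψ = ∑-distrib-+ (φ ∘ from) (ψ ∘ from)

  sumAll-*ˡ : ∀ c φ → sumAll (λ x → c ℂ.* φ x) ≡ c ℂ.* sumAll φ
  sumAll-*ˡ c φ = ≡.sym (*-distribˡ-sum c (φ ∘ from))

  sumAll-*ʳ : ∀ c φ → sumAll (λ x → φ x ℂ.* c) ≡ sumAll φ ℂ.* c
  sumAll-*ʳ c φ = ≡.sym (*-distribʳ-sum c (φ ∘ from))

  sumAll-comm : ∀ (φ : Carrier → Carrier → ℚ[i]) →
                sumAll (λ x → sumAll (λ y → φ x y)) ≡ sumAll (λ y → sumAll (λ x → φ x y))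
  sumAll-comm φ = ∑-comm (λ k l → φ (from k) (from l))

  sumAll-combination : ∀ {m} (c : Fin m → ℚ[i]) (φ : Fin m → Carrier → ℚ[i]) →
    sumAll (λ x → ℂ.sum λ k → c k ℂ.* φ k x) ≡ ℂ.sum λ k → c k ℂ.* sumAll (φ k)
  sumAll-combination c φ = ≡.trans (∑-comm (λ k l → c l ℂ.* φ l (from k)))
    (sum-cong-≗ λ l → sumAll-*ˡ (c l) (φ l))

  sumAll-permute : ∀ {g h : Carrier → Carrier} →
    (∀ {x y} → x ≈ y → g x ≈ g y) → (∀ {x y} → x ≈ y → h x ≈ h y) →
    (∀ x → g (h x) ≈ x) → (∀ x → h (g x) ≈ x) →
    ∀ {φ} → Respecting φ → sumAll (φ ∘ g) ≡ sumAll φ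
  sumAll-permute {g} {h} g-cong h-cong gh hg {φ} φ-resp = ≡.sym (≡.trans
    (sum-permute (φ ∘ from) (permutation (to ∘ g ∘ from) (to ∘ h ∘ from)
      (λ k → ≡.trans (to-cong (trans (g-cong (strictlyInverseʳ _)) (gh _))) (strictlyInverseˡ k))
      (λ k → ≡.trans (to-cong (trans (h-cong (strictlyInverseʳ _)) (hg _))) (strictlyInverseˡ k))))
    (sum-cong-≗ λ k → φ-resp (strictlyInverseʳ (g (from k)))))

  sumAll-zero : ∀ φ → (∀ x → φ x ≡ ℂ.0#) → sumAll φ ≡ ℂ.0#
  sumAll-zero φ eq = sum-zero (φ ∘ from) (eq ∘ from)

  sumAll-single : ∀ φ c → Respecting φ → (∀ x → ¬ x ≈ c → φ x ≡ ℂ.0#) → sumAll φ ≡ φ c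
  sumAll-single φ c φ-resp φ≡0 = ≡.trans
    (sum-single (φ ∘ from) (to c) λ l l≢ → φ≡0 (from l) λ l≈c →
      l≢ (≡.trans (≡.sym (strictlyInverseˡ l)) (to-cong l≈c)))
    (φ-resp (strictlyInverseʳ c))

  𝟙-resp : ∀ {P : Pred Carrier 0ℓ} (P? : Decidable P) → (∀ {x y} → x ≈ y → P x → P y) →
           Respecting λ x → 𝟙 (P? x)
  𝟙-resp P? P-resp x≈y = 𝟙-cong (P? _) (P? _) (P-resp x≈y) (P-resp (sym x≈y))

  𝟙≟-resp : ∀ c → Respecting λ x → 𝟙 (x ≟ c)
  𝟙≟-resp c = 𝟙-resp (_≟ c) λ x≈y x≈c → trans (sym x≈y) x≈c

  sumAll-delta : ∀ φ c → Respecting φ → sumAll (λ x → 𝟙 (x ≟ c) ℂ.* φ x) ≡ φ c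
  sumAll-delta φ c φ-resp = ≡.trans
    (sumAll-single _ c (λ x≈y → cong₂ ℂ._*_ (𝟙≟-resp c x≈y) (φ-resp x≈y))
      λ x x≉c → ≡.trans (cong (ℂ._* φ x) (𝟙-false (x ≟ c) x≉c)) (0*z (φ x)))
    (≡.trans (cong (ℂ._* φ c) (𝟙-true (c ≟ c) refl)) (1*z (φ c)))

  sumAll-𝟙≟ : ∀ c → sumAll (λ x → 𝟙 (x ≟ c)) ≡ ℂ.1#
  sumAll-𝟙≟ c = ≡.trans
    (sumAll-single _ c (𝟙≟-resp c) λ x x≉c → 𝟙-false (x ≟ c) x≉c)
    (𝟙-true (c ≟ c) refl)

  sumOver-sumAll : ∀ {P : Pred Carrier 0ℓ} (P? : Decidable P) φ →
                   sumOver P? φ ≡ sumAll λ x → 𝟙 (P? x) ℂ.* φ x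
  sumOver-sumAll P? φ = sum-cong-≗ λ k → lemma (P? (from k)) (φ (from k))
    where
    lemma : {Q : Set} (d : Dec Q) (z : ℚ[i]) → (if does d then z else ℂ.0#) ≡ 𝟙 d ℂ.* z
    lemma (yes _) z = ≡.sym (1*z z)
    lemma (no _)  z = ≡.sym (0*z z)

  module _ {P : Pred Carrier 0ℓ} (P? : Decidable P) where

    count : ℚ[i]
    count = sumAll λ x → 𝟙 (P? x)

    count≡0 : (∀ x → ¬ P x) → count ≡ ℂ.0#
    count≡0 ¬P = sumAll-zero _ λ x → 𝟙-false (P? x) (¬P x)

    module _ (P-resp : ∀ {x y} → x ≈ y → P x → P y) where

      count≡0⇒¬ : count ≡ ℂ.0# → ∀ x → ¬ P x
      count≡0⇒¬ eq x px = sum-𝟙≡0 (P? ∘ from) eq (to x) (P-resp (sym (strictlyInverseʳ x)) px)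

      count≡1 : ∀ c → P c → (∀ x → P x → x ≈ c) → count ≡ ℂ.1#
      count≡1 c pc unique = ≡.trans
        (sumAll-cong λ x → 𝟙-cong (P? x) (x ≟ c) (unique x) λ x≈c → P-resp (sym x≈c) pc)
        (sumAll-𝟙≟ c)

      count≡2 : ∀ c d → ¬ c ≈ d → P c → P d → (∀ x → P x → x ≈ c ⊎ x ≈ d) →
                count ≡ fromℕ 2
      count≡2 c d c≉d pc pd cases = ≡.trans
        (sumAll-cong λ x → split x)
        (≡.trans (sumAll-+ (λ x → 𝟙 (x ≟ c)) (λ x → 𝟙 (x ≟ d))) (cong₂ ℂ._+_ (sumAll-𝟙≟ c) (sumAll-𝟙≟ d)))
        where
        split : ∀ x → 𝟙 (P? x) ≡ 𝟙 (x ≟ c) ℂ.+ 𝟙 (x ≟ d)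
        split x with P? x
        ... | no ¬p = ≡.sym (cong₂ ℂ._+_ (𝟙-false (x ≟ c) (λ x≈c → ¬p (P-resp (sym x≈c) pc)))
                                         (𝟙-false (x ≟ d) (λ x≈d → ¬p (P-resp (sym x≈d) pd))))
        ... | yes p with cases x p
        ...   | inj₁ x≈c = ≡.sym (cong₂ ℂ._+_ (𝟙-true (x ≟ c) x≈c)
                                   (𝟙-false (x ≟ d) λ x≈d → c≉d (trans (sym x≈c) x≈d)))
        ...   | inj₂ x≈d = ≡.sym (cong₂ ℂ._+_ (𝟙-false (x ≟ c) λ x≈c → c≉d (trans (sym x≈c) x≈d))
                                   (𝟙-true (x ≟ d) x≈d))

      count-enumerated : ∀ {m} (g : Fin m → Carrier) → (∀ {i j} → g i ≈ g j → i ≡ j) →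
                         (∀ i → P (g i)) → (∀ x → P x → ∃ λ i → x ≈ g i) → count ≡ fromℕ m
      count-enumerated {m} g g-injective P-g g-onto = begin
        sumAll (λ x → 𝟙 (P? x))                       ≡⟨ sumAll-cong pointwise ⟩
        sumAll (λ x → ℂ.sum λ i → 𝟙 (x ≟ g i))         ≡⟨ ∑-comm (λ k i → 𝟙 (from k ≟ g i)) ⟩
        (ℂ.sum λ i → sumAll λ x → 𝟙 (x ≟ g i))         ≡⟨ sum-cong-≗ (λ i → sumAll-𝟙≟ (g i)) ⟩
        ℂ.sum {m} (λ _ → ℂ.1#)                         ≡⟨ sum-one m ⟩
        fromℕ m                                        ∎
        where
        open ≡-Reasoning
        pointwise : ∀ x → 𝟙 (P? x) ≡ ℂ.sum λ i → 𝟙 (x ≟ g i)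
        pointwise x with P? x
        ... | no ¬p = ≡.sym (sum-zero _ λ i → 𝟙-false (x ≟ g i) λ x≈g → ¬p (P-resp (sym x≈g) (P-g i)))
        ... | yes p with i , x≈gi ← g-onto x p = ≡.sym (≡.trans
          (sum-single _ i λ j j≢i → 𝟙-false (x ≟ g j) λ x≈gj → j≢i (g-injective (trans (sym x≈gj) x≈gi)))
          (𝟙-true (x ≟ g i) x≈gi))

-- Galois rings of characteristic 4

injective⇒surjective : ∀ {n} {f : Fin n → Fin n} →
                       (∀ {i j} → f i ≡ f j → i ≡ j) → ∀ y → ∃ λ x → f x ≡ y
injective⇒surjective {suc n} {f} f-injective y with Fin.any? (λ x → f x Fin.≟ y)
... | yes found = found
... | no ¬found = contradiction
  (Fin.injective⇒≤ {f = λ x → Fin.punchOut {i = y} {f x} λ eq → ¬found (x , ≡.sym eq)}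
    λ {i} {j} eq → f-injective (Fin.punchOut-injective {i = y} {f i} {f j} _ _ eq))
  ℕ.1+n≰n

2^k*2^k≡4^k : ∀ k → 2 ℕ.^ k ℕ.* 2 ℕ.^ k ≡ 4 ℕ.^ k
2^k*2^k≡4^k k = ≡.trans (≡.sym (ℕ.^-distribˡ-+-* 2 k k))
  (≡.trans (≡.cong (λ l → 2 ℕ.^ (k ℕ.+ l)) (≡.sym (ℕ.+-identityʳ k))) (≡.sym (ℕ.^-*-assoc 2 2 k)))

module RingOfCharacteristic4 {n : ℕ} (G : GR4 n) where
  open GR4 G
  open SetoidReasoning setoid
  open Mult semiring using (×1-homo-*; ×-homo-+)

  private
    4·1≈0 : 4 · 1# ≈ 0#
    4·1≈0 = Equivalence.from (characteristic 4) ∣.∣-refl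

    %4-· : ∀ k → (k % 4) · 1# ≈ k · 1#
    %4-· k = sym (begin
      k · 1#                                        ≡⟨ ≡.cong (_· 1#) (m≡m%n+[m/n]*n k 4) ⟩
      (k % 4 ℕ.+ (k / 4) ℕ.* 4) · 1#                ≈⟨ ×-homo-+ 1# (k % 4) ((k / 4) ℕ.* 4) ⟩
      (k % 4) · 1# + ((k / 4) ℕ.* 4) · 1#           ≈⟨ +-congˡ (×1-homo-* (k / 4) 4) ⟩
      (k % 4) · 1# + (k / 4) · 1# * 4 · 1#          ≈⟨ +-congˡ (trans (*-congˡ 4·1≈0) (zeroʳ _)) ⟩
      (k % 4) · 1# + 0#                             ≈⟨ +-identityʳ _ ⟩
      (k % 4) · 1#                                  ∎)

    -- The ring solver computes with coefficients in ℤ/4, so that it knows 4 = 0.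
    coefficients : RawRing 0ℓ 0ℓ
    coefficients = record
      { Carrier = ℕ ; _≈_ = _≡_
      ; _+_ = λ a b → (a ℕ.+ b) % 4 ; _*_ = λ a b → (a ℕ.* b) % 4
      ; -_ = λ a → (3 ℕ.* a) % 4 ; 0# = 0 ; 1# = 1
      }

    3·1≈-1 : ∀ a → (3 ℕ.* a) · 1# ≈ - (a · 1#)
    3·1≈-1 a = begin
      (3 ℕ.* a) · 1#                                 ≈⟨ ×1-homo-* 3 a ⟩
      3 · 1# * a · 1#                                ≈⟨ +-identityʳ _ ⟨
      3 · 1# * a · 1# + 0#                           ≈⟨ +-congˡ (-‿inverseʳ (a · 1#)) ⟨
      3 · 1# * a · 1# + (a · 1# - a · 1#)            ≈⟨ +-assoc _ _ _ ⟨
      (3 · 1# * a · 1# + a · 1#) - a · 1#            ≈⟨ +-congʳ (+-congˡ (*-identityˡ (a · 1#))) ⟨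
      (3 · 1# * a · 1# + 1# * a · 1#) - a · 1#       ≈⟨ +-congʳ (distribʳ _ _ _) ⟨
      (3 · 1# + 1#) * a · 1# - a · 1#                ≈⟨ +-congʳ (*-congʳ (trans (+-comm _ _) 4·1≈0)) ⟩
      0# * a · 1# - a · 1#                           ≈⟨ +-congʳ (zeroˡ _) ⟩
      0# - a · 1#                                    ≈⟨ +-identityˡ _ ⟩
      - (a · 1#)                                     ∎

    morphism : coefficients ACR.-Raw-AlmostCommutative⟶ ACR.fromCommutativeRing commutativeRing
    morphism = record
      { ⟦_⟧    = _· 1#
      ; +-homo = λ a b → trans (%4-· (a ℕ.+ b)) (×-homo-+ 1# a b)
      ; *-homo = λ a b → trans (%4-· (a ℕ.* b)) (×1-homo-* a b)
      ; -‿homo = λ a → trans (%4-· (3 ℕ.* a)) (3·1≈-1 a)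
      ; 0-homo = refl
      ; 1-homo = +-identityʳ 1#
      }

  module Solver = Algebra.Solver.Ring coefficients (ACR.fromCommutativeRing commutativeRing) morphism
    (λ a b → Maybe.map (λ eq → reflexive (≡.cong (_· 1#) eq)) (dec⇒weaklyDec ℕ._≟_ a b))
  open Solver hiding (⟦_⟧)

  1≉0 : ¬ 1# ≈ 0#
  1≉0 eq with () ← ∣.∣1⇒≡1 (Equivalence.to (characteristic 1) (trans (+-identityʳ 1#) eq))

  2·1≉0 : ¬ 2 · 1# ≈ 0#
  2·1≉0 eq = contradiction (∣.∣⇒≤ (Equivalence.to (characteristic 2) eq)) λ { (ℕ.s≤s (ℕ.s≤s ())) }

  -- Since Z is the annihilator of 2, this is congruence modulo Z.
  infix 4 _∼₂_
  _∼₂_ : Carrier → Carrier → Set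
  x ∼₂ y = 2 · x ≈ 2 · y

  ≈⇒∼ : ∀ {x y} → x ≈ y → x ∼₂ y
  ≈⇒∼ = ×-congʳ 2

  +-∼ : ∀ {x y u v} → x ∼₂ y → u ∼₂ v → x + u ∼₂ y + v
  +-∼ {x} {y} {u} {v} p q = begin
    2 · (x + u)       ≈⟨ solve 2 (λ x u → 2 :× (x :+ u) := 2 :× x :+ 2 :× u) refl x u ⟩
    2 · x + 2 · u     ≈⟨ +-cong p q ⟩
    2 · y + 2 · v     ≈⟨ solve 2 (λ x u → 2 :× x :+ 2 :× u := 2 :× (x :+ u)) refl y v ⟩
    2 · (y + v)       ∎

  Z⇒∼0 : ∀ {x} → Z x → x ∼₂ 0#
  Z⇒∼0 (y , eq) = trans (≈⇒∼ eq) (solve 1 (λ y → 2 :× (2 :× y) := 2 :× con 0) refl y)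

  2·0≈0 : 2 · 0# ≈ 0#
  2·0≈0 = solve 0 (2 :× con 0 := con 0) refl

  ∼0⇒Z : ∀ {x} → x ∼₂ 0# → Z x
  ∼0⇒Z {x} eq = Equivalence.to (zeroDivisors x) (2 · 1# , 2·1≉0 , (begin
    x * 2 · 1#    ≈⟨ *-congˡ (×-congʳ 2 (+-identityʳ 1#)) ⟨
    x * 2 · (1# + 0#)    ≈⟨ solve 1 (λ x → x :* (2 :× con 1) := 2 :× x) refl x ⟩
    2 · x         ≈⟨ trans eq 2·0≈0 ⟩
    0#            ∎))

  ∼⇒≈+2· : ∀ {x y} → x ∼₂ y → ∃ λ w → x ≈ y + 2 · w
  ∼⇒≈+2· {x} {y} eq = proj₁ x-y∈Z , (begin
    x                         ≈⟨ solve 2 (λ x y → x := y :+ (x :- y)) refl x y ⟩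
    y + (x - y)               ≈⟨ +-congˡ (proj₂ x-y∈Z) ⟩
    y + 2 · proj₁ x-y∈Z       ∎)
    where
    x-y∈Z : Z (x - y)
    x-y∈Z = ∼0⇒Z (begin
      2 · (x - y)           ≈⟨ solve 2 (λ x y → 2 :× (x :- y) := 2 :× x :- 2 :× y) refl x y ⟩
      2 · x - 2 · y         ≈⟨ +-congʳ eq ⟩
      2 · y - 2 · y         ≈⟨ solve 1 (λ y → 2 :× y :- 2 :× y := 2 :× con 0) refl y ⟩
      2 · 0#                ∎)

  +2·-∼ : ∀ {x y w} → x ≈ y + 2 · w → x ∼₂ y
  +2·-∼ {x} {y} {w} eq = trans (≈⇒∼ eq) (solve 2 (λ y w → 2 :× (y :+ 2 :× w) := 2 :× y) refl y w)

  +2·-² : ∀ {x y w} → x ≈ y + 2 · w → x * x ≈ y * y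
  +2·-² {x} {y} {w} eq = trans (*-cong eq eq)
    (solve 2 (λ y w → (y :+ 2 :× w) :* (y :+ 2 :× w) := y :* y) refl y w)

  ∼⇒²≈ : ∀ {x y} → x ∼₂ y → x * x ≈ y * y
  ∼⇒²≈ eq = +2·-² (proj₂ (∼⇒≈+2· eq))

  ²∼0⇒∼0 : ∀ {w} → w * w ∼₂ 0# → w ∼₂ 0#
  ²∼0⇒∼0 {w} eq with 2 · w ≟ 0#
  ... | yes 2w≈0 = trans 2w≈0 (sym 2·0≈0)
  ... | no  2w≉0 = Z⇒∼0 (Equivalence.to (zeroDivisors w) (2 · w , 2w≉0 , (begin
    w * 2 · w     ≈⟨ solve 1 (λ w → w :* (2 :× w) := 2 :× (w :* w)) refl w ⟩
    2 · (w * w)   ≈⟨ trans eq 2·0≈0 ⟩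
    0#            ∎)))

  ²-∼-injective : ∀ {x y} → x * x ∼₂ y * y → x ∼₂ y
  ²-∼-injective {x} {y} eq = begin
    2 · x                 ≈⟨ solve 2 (λ x y → 2 :× x := 2 :× (x :+ y) :+ 2 :× y) refl x y ⟩
    2 · (x + y) + 2 · y   ≈⟨ +-congʳ (trans (²∼0⇒∼0 lemma) 2·0≈0) ⟩
    0# + 2 · y            ≈⟨ +-identityˡ _ ⟩
    2 · y                 ∎
    where
    lemma : (x + y) * (x + y) ∼₂ 0#
    lemma = begin
      2 · ((x + y) * (x + y))        ≈⟨ solve 2 (λ x y → 2 :× ((x :+ y) :* (x :+ y)) := 2 :× (x :* x) :+ 2 :× (y :* y)) refl x y ⟩
      2 · (x * x) + 2 · (y * y)      ≈⟨ +-congʳ eq ⟩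
      2 · (y * y) + 2 · (y * y)      ≈⟨ solve 1 (λ y → 2 :× (y :* y) :+ 2 :× (y :* y) := 2 :× con 0) refl y ⟩
      2 · 0#                         ∎

module TraceElimination {n : ℕ} (G : GR4 n) (ξ : GR4.Carrier G) where
  open GR4 G
  open Teichmüller G ξ

  Tr-elim : ∀ x (P : Fin 4 → Set) → (∀ k → trace x ≈ toℕ k · 1# → P k) →
            (∃ λ (k : Fin 4) → trace x ≈ toℕ k · 1#) → P (Tr x)
  Tr-elim x P f ex with Fin.any? (λ (k : Fin 4) → trace x ≟ toℕ k · 1#)
  ... | yes (k , eq) = f k eq
  ... | no ¬p = contradiction ex ¬p

  χ-elim : ∀ a x → (∃ λ (k : Fin 4) → trace (a * x) ≈ toℕ k · 1#) →
           ∃ λ (k : Fin 4) → trace (a * x) ≈ toℕ k · 1# × χ[ a ] x ≡ 𝐢 ℂ.^ toℕ k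
  χ-elim a x ex = Tr (a * x) , Tr-elim (a * x) (λ k → trace (a * x) ≈ toℕ k · 1#) (λ _ eq → eq) ex , ≡.refl

module TeichmüllerProperties {m : ℕ} (G : GR4 (suc m)) (ξ : GR4.Carrier G)
                             (order : Teichmüller.HasTeichmüllerOrder G ξ) where
  open GR4 G hiding (zero)
  open Teichmüller G ξ
  open TraceElimination G ξ
  open RingOfCharacteristic4 G
  open Solver using (solve; _:=_; _:+_; _:*_; _:×_; con)
  open SetoidReasoning setoid
  open Mult semiring using (×1-homo-*)
  open Exp commutativeSemiring using (^-homo-*; ^-assocʳ; ^-distrib-*; ^-congʳ)
  open CommutativeMonoidSum +-commutativeMonoid using (sum; sum-cong-≋; ∑-distrib-+; sum-init-last; ∑-comm; sum-replicate-zero; sum-replicate)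
  open SemiringSum semiring using (*-distribˡ-sum)
  open RingProperties ring using (+-cancelˡ; -‿distribˡ-*)

  M : ℕ
  M = 2 ℕ.^ suc m ℕ.∸ 1

  1+M≡2^n : suc M ≡ 2 ℕ.^ suc m
  1+M≡2^n = ℕ.m+[n∸m]≡n (ℕ.m^n>0 2 (suc m))

  instance
    M-nonZero : ℕ.NonZero M
    M-nonZero = ℕ.>-nonZero (ℕ.m<n⇒0<n∸m {1} {2 ℕ.^ suc m} (ℕ.≤-trans (ℕ.*-monoʳ-≤ 2 (ℕ.m^n>0 2 m)) ℕ.≤-refl))

  1^k≈1 : ∀ k → 1# ^ k ≈ 1#
  1^k≈1 zero    = refl
  1^k≈1 (suc k) = trans (*-identityˡ _) (1^k≈1 k)

  ξ^M≈1 : ξ ^ M ≈ 1#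
  ξ^M≈1 = Equivalence.from (order M) ∣.∣-refl

  ξ^[k*M]≈1 : ∀ k → ξ ^ (k ℕ.* M) ≈ 1#
  ξ^[k*M]≈1 k = Equivalence.from (order (k ℕ.* M)) (divides k ≡.refl)

  ξ⁻¹ : Carrier
  ξ⁻¹ = ξ ^ ℕ.pred M

  ξ⁻¹*ξ≈1 : ξ⁻¹ * ξ ≈ 1#
  ξ⁻¹*ξ≈1 = begin
    ξ⁻¹ * ξ               ≈⟨ *-comm ξ⁻¹ ξ ⟩
    ξ ^ suc (ℕ.pred M)    ≡⟨ ≡.cong (ξ ^_) (ℕ.suc-pred M) ⟩
    ξ ^ M                 ≈⟨ ξ^M≈1 ⟩
    1#                    ∎

  ξ⁻ⁱ*ξⁱ≈1 : ∀ i → ξ⁻¹ ^ i * ξ ^ i ≈ 1#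
  ξ⁻ⁱ*ξⁱ≈1 i = trans (sym (^-distrib-* ξ⁻¹ ξ i)) (trans (^-congˡ i ξ⁻¹*ξ≈1) (1^k≈1 i))

  ξ-cancelˡ : ∀ i {x y} → ξ ^ i * x ≈ ξ ^ i * y → x ≈ y
  ξ-cancelˡ i {x} {y} eq = begin
    x                            ≈⟨ lemma x ⟨
    ξ⁻¹ ^ i * (ξ ^ i * x)        ≈⟨ *-congˡ eq ⟩
    ξ⁻¹ ^ i * (ξ ^ i * y)        ≈⟨ lemma y ⟩
    y                            ∎
    where
    lemma : ∀ z → ξ⁻¹ ^ i * (ξ ^ i * z) ≈ z
    lemma z = trans (sym (*-assoc _ _ _)) (trans (*-congʳ (ξ⁻ⁱ*ξⁱ≈1 i)) (*-identityˡ z))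

  ξ^i≉0 : ∀ i → ¬ ξ ^ i ≈ 0#
  ξ^i≉0 i eq = 1≉0 (trans (sym (ξ⁻ⁱ*ξⁱ≈1 i)) (trans (*-congˡ eq) (zeroʳ _)))

  T-ξ^ : ∀ k → T (ξ ^ k)
  T-ξ^ k = inj₂ (Fin.fromℕ< (m%n<n k M) , (begin
    ξ ^ k                                  ≡⟨ ≡.cong (ξ ^_) (m≡m%n+[m/n]*n k M) ⟩
    ξ ^ (k % M ℕ.+ (k / M) ℕ.* M)          ≈⟨ ^-homo-* ξ (k % M) _ ⟩
    ξ ^ (k % M) * ξ ^ ((k / M) ℕ.* M)      ≈⟨ *-congˡ (ξ^[k*M]≈1 (k / M)) ⟩
    ξ ^ (k % M) * 1#                       ≈⟨ *-identityʳ _ ⟩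
    ξ ^ (k % M)                            ≡⟨ ≡.cong (ξ ^_) (Fin.toℕ-fromℕ< (m%n<n k M)) ⟨
    ξ ^ toℕ (Fin.fromℕ< (m%n<n k M))       ∎))

  T-0 : T 0#
  T-0 = inj₁ refl

  T-* : ∀ {x y} → T x → T y → T (x * y)
  T-* (inj₁ x≈0) _ = inj₁ (trans (*-congʳ x≈0) (zeroˡ _))
  T-* (inj₂ _) (inj₁ y≈0) = inj₁ (trans (*-congˡ y≈0) (zeroʳ _))
  T-* (inj₂ (i , x≈)) (inj₂ (j , y≈)) = T-resp
    (sym (trans (*-cong x≈ y≈) (sym (^-homo-* ξ (toℕ i) (toℕ j))))) (T-ξ^ (toℕ i ℕ.+ toℕ j))

  T-^ : ∀ k {x} → T x → T (x ^ k)
  T-^ zero    _ = T-ξ^ 0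
  T-^ (suc k) t = T-* t (T-^ k t)

  ^2^-double : ∀ x i → x ^ (2 ℕ.^ suc i) ≈ x ^ (2 ℕ.^ i) * x ^ (2 ℕ.^ i)
  ^2^-double x i = trans (^-congʳ x (≡.cong (2 ℕ.^ i ℕ.+_) (ℕ.+-identityʳ (2 ℕ.^ i))))
    (^-homo-* x (2 ℕ.^ i) (2 ℕ.^ i))

  τ : Carrier → Carrier
  τ x = x ^ (2 ℕ.^ suc m)

  τ-T : ∀ {x} → T x → τ x ≈ x
  τ-T {x} (inj₁ x≈0) = trans (^-congʳ x (≡.sym 1+M≡2^n)) (trans (*-congʳ x≈0) (trans (zeroˡ _) (sym x≈0)))
  τ-T {x} (inj₂ (i , x≈)) = begin
    x ^ (2 ℕ.^ suc m)         ≈⟨ ^-congʳ x (≡.sym 1+M≡2^n) ⟩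
    x * x ^ M                 ≈⟨ *-congˡ (^-congˡ M x≈) ⟩
    x * (ξ ^ toℕ i) ^ M       ≈⟨ *-congˡ (^-assocʳ ξ (toℕ i) M) ⟩
    x * ξ ^ (toℕ i ℕ.* M)     ≈⟨ *-congˡ (ξ^[k*M]≈1 (toℕ i)) ⟩
    x * 1#                    ≈⟨ *-identityʳ x ⟩
    x                         ∎

  τ-∼ : ∀ {x y} → x ∼₂ y → τ x ≈ τ y
  τ-∼ {x} {y} eq = begin
    x ^ (2 ℕ.* 2 ℕ.^ m)     ≈⟨ ^-assocʳ x 2 (2 ℕ.^ m) ⟨
    (x ^ 2) ^ (2 ℕ.^ m)     ≈⟨ ^-congˡ (2 ℕ.^ m) (trans (*-congˡ (*-identityʳ x)) (trans (∼⇒²≈ eq) (*-congˡ (sym (*-identityʳ y))))) ⟩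
    (y ^ 2) ^ (2 ℕ.^ m)     ≈⟨ ^-assocʳ y 2 (2 ℕ.^ m) ⟩
    y ^ (2 ℕ.* 2 ℕ.^ m)     ∎

  T-∼⇒≈ : ∀ {x y} → T x → T y → x ∼₂ y → x ≈ y
  T-∼⇒≈ tx ty eq = trans (sym (τ-T tx)) (trans (τ-∼ eq) (τ-T ty))

  t : Fin (suc M) → Carrier
  t zero    = 0#
  t (suc i) = ξ ^ toℕ i

  T-t : ∀ i → T (t i)
  T-t zero    = T-0
  T-t (suc i) = inj₂ (i , refl)

  T⇒t : ∀ {x} → T x → ∃ λ i → x ≈ t i
  T⇒t (inj₁ x≈0)      = zero , x≈0
  T⇒t (inj₂ (i , x≈)) = suc i , x≈

  ξ-injective : ∀ {i j} → i ℕ.≤ j → j ℕ.< M → ξ ^ i ≈ ξ ^ j → i ≡ j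
  ξ-injective {i} {j} i≤j j<M eq = ℕ.≤-antisym i≤j (ℕ.m∸n≡0⇒m≤n j∸i≡0)
    where
    ξ^[j∸i]≈1 : ξ ^ (j ℕ.∸ i) ≈ 1#
    ξ^[j∸i]≈1 = ξ-cancelˡ i (begin
      ξ ^ i * ξ ^ (j ℕ.∸ i)   ≈⟨ ^-homo-* ξ i (j ℕ.∸ i) ⟨
      ξ ^ (i ℕ.+ (j ℕ.∸ i))   ≡⟨ ≡.cong (ξ ^_) (ℕ.m+[n∸m]≡n i≤j) ⟩
      ξ ^ j                   ≈⟨ eq ⟨
      ξ ^ i                   ≈⟨ *-identityʳ _ ⟨
      ξ ^ i * 1#              ∎)

    j∸i≡0 : j ℕ.∸ i ≡ 0
    j∸i≡0 with j ℕ.∸ i in eq′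
    ... | zero  = ≡.refl
    ... | suc k = contradiction
      (∣.∣⇒≤ (≡.subst (M ∣_) eq′ (Equivalence.to (order (j ℕ.∸ i)) ξ^[j∸i]≈1)))
      (ℕ.<⇒≱ (ℕ.≤-<-trans (≡.subst (ℕ._≤ j) eq′ (ℕ.m∸n≤m j i)) j<M))

  t-injective : ∀ {i j} → t i ≈ t j → i ≡ j
  t-injective {zero}  {zero}  _  = ≡.refl
  t-injective {zero}  {suc j} eq = contradiction (sym eq) (ξ^i≉0 (toℕ j))
  t-injective {suc i} {zero}  eq = contradiction eq (ξ^i≉0 (toℕ i))
  t-injective {suc i} {suc j} eq with ℕ.≤-total (toℕ i) (toℕ j)
  ... | inj₁ i≤j = ≡.cong suc (Fin.toℕ-injective (ξ-injective i≤j (Fin.toℕ<n j) eq))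
  ... | inj₂ j≤i = ≡.cong suc (Fin.toℕ-injective (≡.sym (ξ-injective j≤i (Fin.toℕ<n i) (sym eq))))

  private
    N≡ : suc M ℕ.* suc M ≡ 4 ℕ.^ suc m
    N≡ = ≡.trans (≡.cong₂ ℕ._*_ 1+M≡2^n 1+M≡2^n) (2^k*2^k≡4^k (suc m))

    pair : Fin (suc M ℕ.* suc M) → Carrier
    pair k = t (proj₁ (Fin.remQuot {suc M} (suc M) k)) + 2 · t (proj₂ (Fin.remQuot {suc M} (suc M) k))

    t+2t-injectiveˡ : ∀ i j i′ j′ → t i + 2 · t j ≈ t i′ + 2 · t j′ → i ≡ i′
    t+2t-injectiveˡ i j i′ j′ eq = t-injective {i} {i′} (T-∼⇒≈ (T-t i) (T-t i′)
      (trans (sym (+2·-∼ {t i + 2 · t j} {t i} {t j} refl)) (+2·-∼ {t i + 2 · t j} {t i′} {t j′} eq)))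

    t+2t-injectiveʳ : ∀ i j j′ → t i + 2 · t j ≈ t i + 2 · t j′ → j ≡ j′
    t+2t-injectiveʳ i j j′ eq = t-injective {j} {j′}
      (T-∼⇒≈ (T-t j) (T-t j′) (+-cancelˡ (t i) (2 · t j) (2 · t j′) eq))

    t+2t-injective : ∀ {i j i′ j′} → t i + 2 · t j ≈ t i′ + 2 · t j′ → i ≡ i′ × j ≡ j′
    t+2t-injective {i} {j} {i′} {j′} eq = i≡i′ , t+2t-injectiveʳ i j j′
      (trans eq (+-congʳ (reflexive (≡.cong t (≡.sym i≡i′)))))
      where
      i≡i′ : i ≡ i′
      i≡i′ = t+2t-injectiveˡ i j i′ j′ eq

    pair-injective : ∀ k l → pair k ≈ pair l → k ≡ l
    pair-injective k l eq = ≡.trans (≡.sym (Fin.combine-remQuot {suc M} (suc M) k))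
      (≡.trans (≡.cong₂ Fin.combine (proj₁ eqs) (proj₂ eqs)) (Fin.combine-remQuot {suc M} (suc M) l))
      where
      eqs : proj₁ (Fin.remQuot {suc M} (suc M) k) ≡ proj₁ (Fin.remQuot {suc M} (suc M) l) ×
            proj₂ (Fin.remQuot {suc M} (suc M) k) ≡ proj₂ (Fin.remQuot {suc M} (suc M) l)
      eqs = t+2t-injective eq

    to-injective : ∀ {x y} → Inverse.to enum x ≡ Inverse.to enum y → x ≈ y
    to-injective {x} {y} eq = trans (sym (Inverse.strictlyInverseʳ enum x))
      (trans (Inverse.from-cong enum eq) (Inverse.strictlyInverseʳ enum y))

    pair-surjective : ∀ x → ∃ λ k → pair k ≈ x
    pair-surjective x = Fin.cast (≡.sym N≡) (proj₁ preimage) , to-injective (proj₂ preimage)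
      where
      preimage : ∃ λ k → Inverse.to enum (pair (Fin.cast (≡.sym N≡) k)) ≡ Inverse.to enum x
      preimage = injective⇒surjective {f = λ k → Inverse.to enum (pair (Fin.cast (≡.sym N≡) k))}
        (λ {i} {j} eq → Fin.toℕ-injective (≡.trans (≡.sym (Fin.toℕ-cast (≡.sym N≡) i))
          (≡.trans (≡.cong toℕ (pair-injective (Fin.cast (≡.sym N≡) i) (Fin.cast (≡.sym N≡) j) (to-injective eq)))
          (Fin.toℕ-cast (≡.sym N≡) j))))
        (Inverse.to enum x)

  opaque
    expansion : ∀ x → ∃₂ (IsExpansion x)
    expansion x = t (proj₁ (Fin.remQuot {suc M} (suc M) k)) , t (proj₂ (Fin.remQuot {suc M} (suc M) k)) ,
      T-t (proj₁ (Fin.remQuot {suc M} (suc M) k)) , T-t (proj₂ (Fin.remQuot {suc M} (suc M) k)) ,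
      sym (proj₂ (pair-surjective x))
      where
      k : Fin (suc M ℕ.* suc M)
      k = proj₁ (pair-surjective x)

  opaque
    T-τ : ∀ x → T (τ x)
    T-τ x with a , b , Ta , Tb , eq ← expansion x = T-resp (sym (trans (τ-∼ (+2·-∼ eq)) (τ-T Ta))) Ta

    τ∼ : ∀ x → τ x ∼₂ x
    τ∼ x with a , b , Ta , Tb , eq ← expansion x =
      trans (≈⇒∼ (trans (τ-∼ (+2·-∼ eq)) (τ-T Ta))) (sym (+2·-∼ eq))

  T-² : ∀ x → T (x * x)
  T-² x = T-resp (∼⇒²≈ (τ∼ x)) (T-* (T-τ x) (T-τ x))

  unit : ∀ {x} → ¬ Z x → ∃ λ y → x * y ≈ 1#
  unit {x} x∉Z with T-τ x
  ... | inj₁ τ≈0 = contradiction (∼0⇒Z (trans (sym (τ∼ x)) (≈⇒∼ τ≈0))) x∉Z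
  ... | inj₂ (i , τ≈) = x * (a⁻¹ * a⁻¹) , (begin
    x * (x * (a⁻¹ * a⁻¹))    ≈⟨ *-assoc x x _ ⟨
    (x * x) * (a⁻¹ * a⁻¹)    ≈⟨ *-congʳ (∼⇒²≈ (trans (sym (τ∼ x)) (≈⇒∼ τ≈))) ⟩
    (a * a) * (a⁻¹ * a⁻¹)    ≈⟨ solve 2 (λ a b → (a :* a) :* (b :* b) := (b :* a) :* (b :* a)) refl a a⁻¹ ⟩
    (a⁻¹ * a) * (a⁻¹ * a)    ≈⟨ *-cong (ξ⁻ⁱ*ξⁱ≈1 (toℕ i)) (ξ⁻ⁱ*ξⁱ≈1 (toℕ i)) ⟩
    1# * 1#                  ≈⟨ *-identityˡ 1# ⟩
    1#                       ∎)
    where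
    a a⁻¹ : Carrier
    a = ξ ^ toℕ i
    a⁻¹ = ξ⁻¹ ^ toℕ i

  √-² : ∀ x → √ x * √ x ≈ τ x
  √-² x = sym (^2^-double x m)

  √-T : ∀ {x} → T x → √ x * √ x ≈ x
  √-T {x} tx = trans (√-² x) (τ-T tx)

  T-√ : ∀ {x} → T x → T (√ x)
  T-√ = T-^ (2 ℕ.^ m)

  √-* : ∀ x y → √ (x * y) ≈ √ x * √ y
  √-* x y = ^-distrib-* x y (2 ℕ.^ m)

  √-cong : ∀ {x y} → x ≈ y → √ x ≈ √ y
  √-cong = ^-congˡ (2 ℕ.^ m)

  ⊕∼+ : ∀ x y → x ⊕ y ∼₂ x + y
  ⊕∼+ x y = +2·-∼ refl

  T-⊕ : ∀ {x y} → T x → T y → T (x ⊕ y)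
  T-⊕ {x} {y} tx ty = T-resp (begin
    (√ x + √ y) * (√ x + √ y)                  ≈⟨ solve 2 (λ p q → (p :+ q) :* (p :+ q) := p :* p :+ q :* q :+ 2 :× (p :* q)) refl (√ x) (√ y) ⟩
    √ x * √ x + √ y * √ y + 2 · (√ x * √ y)    ≈⟨ +-cong (+-cong (√-T tx) (√-T ty)) (×-congʳ 2 (sym (√-* x y))) ⟩
    x ⊕ y                                      ∎) (T-² (√ x + √ y))

  ^2≈² : ∀ x → x ^ 2 ≈ x * x
  ^2≈² x = *-congˡ (*-identityʳ x)

  σ-expand : ∀ {x a w} → T a → x ≈ a + 2 · w → σ x ≈ a * a + 2 · (w * w)
  σ-expand {x} {a} {w} ta eq with expand? x
  ... | no ¬e = contradiction (expansion x) ¬e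
  ... | yes (a′ , b′ , ta′ , _ , eq′) = +-cong
    (trans (^2≈² a′) (*-cong a′≈a a′≈a))
    (×-congʳ 2 (trans (^2≈² b′) (∼⇒²≈ (+-cancelˡ a _ _ (begin
      a + 2 · b′     ≈⟨ +-congʳ a′≈a ⟨
      a′ + 2 · b′    ≈⟨ eq′ ⟨
      x              ≈⟨ eq ⟩
      a + 2 · w      ∎)))))
    where
    a′≈a : a′ ≈ a
    a′≈a = T-∼⇒≈ ta′ ta (trans (sym (+2·-∼ eq′)) (+2·-∼ eq))

  σ-cong : ∀ {x y} → x ≈ y → σ x ≈ σ y
  σ-cong {x} {y} x≈y = cong′ (expansion y)
    where
    cong′ : ∃₂ (IsExpansion y) → σ x ≈ σ y
    cong′ (a , b , ta , _ , eq) = trans (σ-expand ta (trans x≈y eq)) (sym (σ-expand ta eq))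

  -- If x = a + 2b and y = c + 2d, then x + y = (a ⊕ c) + 2(b + d + √ac).
  σ-+ : ∀ x y → σ (x + y) ≈ σ x + σ y
  σ-+ x y = add (expansion x) (expansion y)
    where
    add : ∃₂ (IsExpansion x) → ∃₂ (IsExpansion y) → σ (x + y) ≈ σ x + σ y
    add (a , b , ta , _ , x≈) (c , d , tc , _ , y≈) =
      trans (σ-expand (T-⊕ ta tc) x+y≈) (trans squares (sym (+-cong (σ-expand ta x≈) (σ-expand tc y≈))))
      where
      s : Carrier
      s = √ (a * c)
      x+y≈ : x + y ≈ (a ⊕ c) + 2 · (b + d + s)
      x+y≈ = trans (+-cong x≈ y≈)
        (solve 5 (λ a b c d s → (a :+ 2 :× b) :+ (c :+ 2 :× d) := (a :+ c :+ 2 :× s) :+ 2 :× (b :+ d :+ s)) refl a b c d s)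
      squares : (a ⊕ c) * (a ⊕ c) + 2 · ((b + d + s) * (b + d + s)) ≈ (a * a + 2 · (b * b)) + (c * c + 2 · (d * d))
      squares = begin
        (a ⊕ c) * (a ⊕ c) + 2 · ((b + d + s) * (b + d + s))
          ≈⟨ solve 5 (λ a b c d s → (a :+ c :+ 2 :× s) :* (a :+ c :+ 2 :× s) :+ 2 :× ((b :+ d :+ s) :* (b :+ d :+ s))
               := (a :* a :+ 2 :× (b :* b)) :+ (c :* c :+ 2 :× (d :* d)) :+ 2 :× (a :* c) :+ 2 :× (s :* s)) refl a b c d s ⟩
        (a * a + 2 · (b * b)) + (c * c + 2 · (d * d)) + 2 · (a * c) + 2 · (s * s)
          ≈⟨ +-congˡ (×-congʳ 2 (√-T (T-* ta tc))) ⟩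
        (a * a + 2 · (b * b)) + (c * c + 2 · (d * d)) + 2 · (a * c) + 2 · (a * c)
          ≈⟨ solve 3 (λ u v w → u :+ v :+ 2 :× w :+ 2 :× w := u :+ v) refl (a * a + 2 · (b * b)) (c * c + 2 · (d * d)) (a * c) ⟩
        (a * a + 2 · (b * b)) + (c * c + 2 · (d * d)) ∎

  0^2^≈0 : ∀ i → 0# ^ (2 ℕ.^ i) ≈ 0#
  0^2^≈0 zero    = zeroˡ _
  0^2^≈0 (suc i) = trans (^2^-double 0# i) (trans (*-congʳ (0^2^≈0 i)) (zeroˡ _))

  σ-0 : σ 0# ≈ 0#
  σ-0 = trans (σ-expand {w = 0#} T-0 (solve 0 (con 0 := con 0 :+ 2 :× con 0) refl))
    (solve 0 (con 0 :* con 0 :+ 2 :× (con 0 :* con 0) := con 0) refl)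

  fold-σ : ∀ i {x a w} → T a → x ≈ a + 2 · w → fold x σ i ≈ a ^ (2 ℕ.^ i) + 2 · w ^ (2 ℕ.^ i)
  fold-σ zero    ta eq = trans eq (sym (+-cong (*-identityʳ _) (×-congʳ 2 (*-identityʳ _))))
  fold-σ (suc i) {a = a} {w} ta eq = trans (σ-expand (T-^ (2 ℕ.^ i) ta) (fold-σ i ta eq))
    (sym (+-cong (^2^-double a i) (×-congʳ 2 (^2^-double w i))))

  fold-σ-period : ∀ x → fold x σ (suc m) ≈ x
  fold-σ-period x = period (expansion x)
    where
    period : ∃₂ (IsExpansion x) → fold x σ (suc m) ≈ x
    period (a , b , ta , tb , eq) = begin
      fold x σ (suc m)                                   ≈⟨ fold-σ (suc m) {x} {a} {b} ta eq ⟩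
      a ^ (2 ℕ.^ suc m) + 2 · b ^ (2 ℕ.^ suc m)          ≈⟨ +-cong (τ-T {a} ta) (×-congʳ 2 (τ-T {b} tb)) ⟩
      a + 2 · b                                          ≈⟨ eq ⟨
      x                                                  ∎

  sum-shift : ∀ k (g : ℕ → Carrier) →
              g 0 + sum {k} (λ i → g (suc (toℕ i))) ≈ sum {k} (λ i → g (toℕ i)) + g k
  sum-shift k g = trans (sum-init-last {k} (λ i → g (toℕ i)))
    (+-cong (sum-cong-≋ {k} λ i → reflexive (≡.cong g (Fin.toℕ-inject₁ i)))
            (reflexive (≡.cong g (Fin.toℕ-fromℕ k))))

  module PeriodicEndomorphism
    (s : Carrier → Carrier) (s-cong : ∀ {x y} → x ≈ y → s x ≈ s y)
    (s-+ : ∀ x y → s (x + y) ≈ s x + s y) (s-0 : s 0# ≈ 0#)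
    (k : ℕ) (s-period : ∀ x → fold x s k ≈ x) where

    orbitSum : Carrier → Carrier
    orbitSum x = sum {k} λ i → fold x s (toℕ i)

    fold-cong : ∀ i {x y} → x ≈ y → fold x s i ≈ fold y s i
    fold-cong zero    eq = eq
    fold-cong (suc i) eq = s-cong (fold-cong i eq)

    fold-+ : ∀ i x y → fold (x + y) s i ≈ fold x s i + fold y s i
    fold-+ zero    x y = refl
    fold-+ (suc i) x y = trans (s-cong (fold-+ i x y)) (s-+ _ _)

    orbitSum-cong : ∀ {x y} → x ≈ y → orbitSum x ≈ orbitSum y
    orbitSum-cong eq = sum-cong-≋ {k} λ i → fold-cong (toℕ i) eq

    orbitSum-+ : ∀ x y → orbitSum (x + y) ≈ orbitSum x + orbitSum y
    orbitSum-+ x y = trans (sum-cong-≋ {k} λ i → fold-+ (toℕ i) x y)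
      (∑-distrib-+ {k} (λ i → fold x s (toℕ i)) (λ i → fold y s (toℕ i)))

    s-sum : ∀ {k} (g : Fin k → Carrier) → s (sum g) ≈ sum (s ∘ g)
    s-sum {zero}  g = s-0
    s-sum {suc k} g = trans (s-+ _ _) (+-congˡ (s-sum (g ∘ suc)))

    s-orbitSum : ∀ x → s (orbitSum x) ≈ orbitSum x
    s-orbitSum x = +-cancelˡ x _ _ (begin
      x + s (orbitSum x)                                ≈⟨ +-congˡ (s-sum {k} λ i → fold x s (toℕ i)) ⟩
      x + sum {k} (λ i → fold x s (suc (toℕ i)))        ≈⟨ sum-shift k (fold x s) ⟩
      orbitSum x + fold x s k                           ≈⟨ +-congˡ (s-period x) ⟩
      orbitSum x + x                                    ≈⟨ +-comm _ _ ⟩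
      x + orbitSum x                                    ∎)

  private
    module Frobenius = PeriodicEndomorphism σ σ-cong σ-+ σ-0 (suc m) fold-σ-period

  trace-cong : ∀ {x y} → x ≈ y → trace x ≈ trace y
  trace-cong = Frobenius.orbitSum-cong

  trace-+ : ∀ x y → trace (x + y) ≈ trace x + trace y
  trace-+ = Frobenius.orbitSum-+

  σ-trace : ∀ x → σ (trace x) ≈ trace x
  σ-trace = Frobenius.s-orbitSum

  T-idempotent : ∀ {x} → T x → x * x ≈ x → x ≈ 0# ⊎ x ≈ 1#
  T-idempotent (inj₁ x≈0) _ = inj₁ x≈0
  T-idempotent {x} (inj₂ (i , x≈)) xx≈x = inj₂ (trans x≈ (ξ-cancelˡ (toℕ i) (begin
    ξ ^ toℕ i * ξ ^ toℕ i     ≈⟨ *-cong x≈ x≈ ⟨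
    x * x                     ≈⟨ trans xx≈x x≈ ⟩
    ξ ^ toℕ i                 ≈⟨ *-identityʳ _ ⟨
    ξ ^ toℕ i * 1#            ∎)))

  σ-fixed : ∀ {y} → σ y ≈ y → ∃ λ (k : Fin 4) → y ≈ toℕ k · 1#
  σ-fixed {y} fixed = fixed′ (expansion y)
    where
    digits : ∀ {a b} → y ≈ a + 2 · b → a ≈ 0# ⊎ a ≈ 1# → b ≈ 0# ⊎ b ≈ 1# →
             ∃ λ (k : Fin 4) → y ≈ toℕ k · 1#
    digits y≈ (inj₁ p) (inj₁ q) = 0F , trans y≈ (trans (+-cong p (×-congʳ 2 q)) (solve 0 (con 0 :+ 2 :× con 0 := con 0) refl))
    digits y≈ (inj₂ p) (inj₁ q) = 1F , trans y≈ (trans (+-cong p (×-congʳ 2 q)) (+-congˡ 2·0≈0))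
    digits y≈ (inj₁ p) (inj₂ q) = 2F , trans y≈ (trans (+-cong p (×-congʳ 2 q)) (+-identityˡ _))
    digits y≈ (inj₂ p) (inj₂ q) = 3F , trans y≈ (+-cong p (×-congʳ 2 q))

    fixed′ : ∃₂ (IsExpansion y) → ∃ λ (k : Fin 4) → y ≈ toℕ k · 1#
    fixed′ (a , b , ta , tb , y≈) = digits y≈ (T-idempotent ta aa≈a)
      (T-idempotent tb (T-∼⇒≈ (T-* tb tb) tb (+-cancelˡ a _ _ (trans (+-congʳ (sym aa≈a)) eq))))
      where
      eq : a * a + 2 · (b * b) ≈ a + 2 · b
      eq = trans (sym (σ-expand ta y≈)) (trans fixed y≈)
      aa≈a : a * a ≈ a
      aa≈a = T-∼⇒≈ (T-* ta ta) ta
        (trans (sym (+2·-∼ {a * a + 2 · (b * b)} {a * a} {b * b} refl)) (+2·-∼ {a * a + 2 · (b * b)} {a} {b} eq))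

  χ-spec : ∀ a x → ∃ λ (k : Fin 4) → trace (a * x) ≈ toℕ k · 1# × χ[ a ] x ≡ 𝐢 ℂ.^ toℕ k
  χ-spec a x = χ-elim a x (σ-fixed (σ-trace (a * x)))

  sum-geometric : ∀ {w} → T w → w ^ M ≈ 1# → ¬ w ≈ 1# → sum {M} (λ j → w ^ toℕ j) ≈ 0#
  sum-geometric {w} tw wᴹ≈1 w≉1 with s ≟ 0#
    where
    s : Carrier
    s = sum {M} (λ j → w ^ toℕ j)
  ... | yes s≈0 = s≈0
  ... | no  s≉0 = contradiction
    (T-∼⇒≈ tw (T-ξ^ 0) (begin
      2 · w                        ≈⟨ ×-congʳ 2 (lemma w) ⟩
      2 · (w - 1# + 1#)            ≈⟨ +-∼ {w - 1#} {0#} {1#} {1#} (Z⇒∼0 (Equivalence.to (zeroDivisors (w - 1#)) (s , s≉0 , ws))) refl ⟩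
      2 · (0# + 1#)                ≈⟨ ×-congʳ 2 (+-identityˡ 1#) ⟩
      2 · 1#                       ∎)) w≉1
    where
    s : Carrier
    s = sum {M} (λ j → w ^ toℕ j)
    lemma : ∀ w → w ≈ w - 1# + 1#
    lemma w = sym (trans (+-assoc _ _ _) (trans (+-congˡ (-‿inverseˡ 1#)) (+-identityʳ w)))
    w*s≈s : w * s ≈ s
    w*s≈s = +-cancelˡ 1# _ _ (begin
      1# + w * s                                     ≈⟨ +-congˡ (*-distribˡ-sum {M} w (λ j → w ^ toℕ j)) ⟩
      1# + sum {M} (λ j → w ^ suc (toℕ j))           ≈⟨ sum-shift M (w ^_) ⟩
      s + w ^ M                                      ≈⟨ +-congˡ wᴹ≈1 ⟩
      s + 1#                                         ≈⟨ +-comm s 1# ⟩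
      1# + s                                         ∎)
    ws : (w - 1#) * s ≈ 0#
    ws = begin
      (w - 1#) * s          ≈⟨ distribʳ s w (- 1#) ⟩
      w * s + - 1# * s      ≈⟨ +-cong w*s≈s (trans (sym (-‿distribˡ-* 1# s)) (-‿cong (*-identityˡ s))) ⟩
      s - s                 ≈⟨ -‿inverseʳ s ⟩
      0#                    ∎

  private
    w : ℕ → Carrier
    w i = ξ⁻¹ * ξ ^ (2 ℕ.^ i)

    T-w : ∀ i → T (w i)
    T-w i = T-* (T-ξ^ (ℕ.pred M)) (T-ξ^ (2 ℕ.^ i))

    [ξ^k]^M≈1 : ∀ k → (ξ ^ k) ^ M ≈ 1#
    [ξ^k]^M≈1 k = trans (^-assocʳ ξ k M) (ξ^[k*M]≈1 k)

    w^M≈1 : ∀ i → w i ^ M ≈ 1#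
    w^M≈1 i = trans (^-distrib-* ξ⁻¹ (ξ ^ (2 ℕ.^ i)) M)
      (trans (*-cong ([ξ^k]^M≈1 (ℕ.pred M)) ([ξ^k]^M≈1 (2 ℕ.^ i))) (*-identityˡ 1#))

    w₀≈1 : w 0 ≈ 1#
    w₀≈1 = trans (*-congˡ (*-identityʳ ξ)) ξ⁻¹*ξ≈1

    2^i<M : (i : Fin m) → 2 ℕ.^ suc (toℕ i) ℕ.< M
    2^i<M i = ℕ.≤-pred (ℕ.≤-trans
      (ℕ.+-mono-≤ {2} {2 ℕ.^ m} (2≤2^ 0<m) (ℕ.≤-trans (ℕ.^-monoʳ-≤ 2 (Fin.toℕ<n i)) (ℕ.m≤m+n _ 0)))
      (ℕ.≤-reflexive (≡.sym 1+M≡2^n)))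
      where
      0<m : 0 ℕ.< m
      0<m = ℕ.≤-<-trans ℕ.z≤n (Fin.toℕ<n i)
      2≤2^ : ∀ {k} → 0 ℕ.< k → 2 ℕ.≤ 2 ℕ.^ k
      2≤2^ = ℕ.^-monoʳ-≤ 2

    w≉1 : (i : Fin m) → ¬ w (suc (toℕ i)) ≈ 1#
    w≉1 i eq with ξ-injective (ℕ.m^n>0 2 (suc (toℕ i))) (2^i<M i) (begin
        ξ ^ 1                                   ≈⟨ *-congˡ eq ⟨
        ξ * w (suc (toℕ i))                     ≈⟨ *-assoc ξ ξ⁻¹ _ ⟨
        (ξ * ξ⁻¹) * ξ ^ (2 ℕ.^ suc (toℕ i))     ≈⟨ *-congʳ (trans (*-comm ξ ξ⁻¹) ξ⁻¹*ξ≈1) ⟩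
        1# * ξ ^ (2 ℕ.^ suc (toℕ i))            ≈⟨ *-identityˡ _ ⟩
        ξ ^ (2 ℕ.^ suc (toℕ i))                 ∎)
    ... | 1≡2^i with () ← ∣.∣1⇒≡1 (≡.subst (2 ∣_) (≡.sym 1≡2^i) (∣.m∣m*n (2 ℕ.^ toℕ i)))

    c : Carrier
    c = 2 · 1#

    c*≈2· : ∀ x → c * x ≈ 2 · x
    c*≈2· x = trans (*-congʳ (×-congʳ 2 (sym (+-identityʳ 1#))))
      (solve 1 (λ x → (2 :× con 1) :* x := 2 :× x) refl x)

    c*M≉0 : ¬ c * M · 1# ≈ 0#
    c*M≉0 eq = contradiction (∣.∣⇒≤ (∣.∣m+n∣m⇒∣n 4∣ (Equivalence.to (characteristic (2 ℕ.* M)) (trans (×1-homo-* 2 M) eq))))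
      λ { (ℕ.s≤s (ℕ.s≤s ())) }
      where
      4∣ : 4 ∣ 2 ℕ.* M ℕ.+ 2
      4∣ = ≡.subst (4 ∣_)
        (≡.trans (≡.cong (2 ℕ.*_) (≡.sym 1+M≡2^n)) (≡.trans (ℕ.*-suc 2 M) (ℕ.+-comm 2 _)))
        (divides (2 ℕ.^ m) (≡.trans (≡.sym (ℕ.*-assoc 2 2 (2 ℕ.^ m))) (ℕ.*-comm 4 (2 ℕ.^ m))))

    ξ⁻ʲ*term : ∀ j i → ξ⁻¹ ^ j * (c * (ξ ^ (2 ℕ.^ i)) ^ j) ≈ c * w i ^ j
    ξ⁻ʲ*term j i = trans
      (solve 3 (λ x c y → x :* (c :* y) := c :* (x :* y)) refl (ξ⁻¹ ^ j) c ((ξ ^ (2 ℕ.^ i)) ^ j))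
      (*-congˡ (sym (^-distrib-* ξ⁻¹ (ξ ^ (2 ℕ.^ i)) j)))

  -- Otherwise 0 = Σⱼ ξ⁻ʲ tr(2ξʲ) = Σᵢ 2 Σⱼ (ξ⁻¹ ξ^(2^i))ʲ = 2(2ⁿ - 1), all the
  -- geometric sums but the one for i = 0 being zero.
  power-sum-nonzero : (tr : Carrier → Carrier) →
    (∀ j → tr (2 · ξ ^ j) ≈ sum {suc m} λ i → c * (ξ ^ (2 ℕ.^ toℕ i)) ^ j) →
    ∃ λ z → ¬ tr (2 · z) ≈ 0#
  power-sum-nonzero tr tr≈ with Fin.any? {M} (λ j → ¬? (tr (2 · ξ ^ toℕ j) ≟ 0#))
  ... | yes (j , nonzero) = ξ ^ toℕ j , nonzero
  ... | no ¬nonzero = contradiction (begin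
    c * M · 1#
      ≈⟨ +-identityʳ _ ⟨
    c * M · 1# + 0#
      ≈⟨ +-cong (*-congˡ s₀) (trans (sum-cong-≋ {m} λ i → trans (*-congˡ (sᵢ i)) (zeroʳ c)) (sum-replicate-zero m)) ⟨
    sum {suc m} (λ i → c * sum {M} (λ j → w (toℕ i) ^ toℕ j))
      ≈⟨ sum-cong-≋ {suc m} (λ i → *-distribˡ-sum {M} c (λ j → w (toℕ i) ^ toℕ j)) ⟩
    sum {suc m} (λ i → sum {M} (λ j → c * w (toℕ i) ^ toℕ j))
      ≈⟨ sum-cong-≋ {suc m} (λ i → sum-cong-≋ {M} λ j → ξ⁻ʲ*term (toℕ j) (toℕ i)) ⟨
    sum {suc m} (λ i → sum {M} (λ j → ξ⁻¹ ^ toℕ j * (c * (ξ ^ (2 ℕ.^ toℕ i)) ^ toℕ j)))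
      ≈⟨ ∑-comm {suc m} {M} (λ i j → ξ⁻¹ ^ toℕ j * (c * (ξ ^ (2 ℕ.^ toℕ i)) ^ toℕ j)) ⟩
    sum {M} (λ j → sum {suc m} (λ i → ξ⁻¹ ^ toℕ j * (c * (ξ ^ (2 ℕ.^ toℕ i)) ^ toℕ j)))
      ≈⟨ sum-cong-≋ {M} (λ j → *-distribˡ-sum {suc m} (ξ⁻¹ ^ toℕ j) (λ i → c * (ξ ^ (2 ℕ.^ toℕ i)) ^ toℕ j)) ⟨
    sum {M} (λ j → ξ⁻¹ ^ toℕ j * sum {suc m} (λ i → c * (ξ ^ (2 ℕ.^ toℕ i)) ^ toℕ j))
      ≈⟨ sum-cong-≋ {M} (λ j → trans (*-congˡ (trans (sym (tr≈ (toℕ j))) (zero-trace j))) (zeroʳ _)) ⟩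
    sum {M} (λ j → 0#)
      ≈⟨ sum-replicate-zero M ⟩
    0# ∎) c*M≉0
    where
    zero-trace : ∀ j → tr (2 · ξ ^ toℕ j) ≈ 0#
    zero-trace j = decidable-stable (tr (2 · ξ ^ toℕ j) ≟ 0#) λ nz → ¬nonzero (j , nz)
    s₀ : sum {M} (λ j → w 0 ^ toℕ j) ≈ M · 1#
    s₀ = trans (sum-cong-≋ {M} λ j → trans (^-congˡ (toℕ j) w₀≈1) (1^k≈1 (toℕ j))) (sum-replicate M)
    sᵢ : (i : Fin m) → sum {M} (λ j → w (suc (toℕ i)) ^ toℕ j) ≈ 0#
    sᵢ i = sum-geometric (T-w (suc (toℕ i))) (w^M≈1 (suc (toℕ i))) (w≉1 i)

  trace-nondegenerate : ∃ λ z → ¬ trace (2 · z) ≈ 0#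
  trace-nondegenerate = power-sum-nonzero trace λ j → sum-cong-≋ {suc m} λ i → begin
    fold (2 · ξ ^ j) σ (toℕ i)
      ≈⟨ fold-σ (toℕ i) {2 · ξ ^ j} {0#} {ξ ^ j} T-0 (sym (+-identityˡ _)) ⟩
    0# ^ (2 ℕ.^ toℕ i) + 2 · (ξ ^ j) ^ (2 ℕ.^ toℕ i)
      ≈⟨ +-cong (0^2^≈0 (toℕ i)) (sym (c*≈2· _)) ⟩
    0# + c * (ξ ^ j) ^ (2 ℕ.^ toℕ i)
      ≈⟨ +-identityˡ _ ⟩
    c * (ξ ^ j) ^ (2 ℕ.^ toℕ i)
      ≈⟨ *-congˡ (trans (^-assocʳ ξ j (2 ℕ.^ toℕ i))
           (trans (^-congʳ ξ (ℕ.*-comm j (2 ℕ.^ toℕ i))) (sym (^-assocʳ ξ (2 ℕ.^ toℕ i) j)))) ⟩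
    c * (ξ ^ (2 ℕ.^ toℕ i)) ^ j ∎

-- Fourier analysis on finite abelian groups

module ℚ[i]-Domain where
  open ℚ[i]-Properties

  square-nonNegative : ∀ p → ℚ.NonNegative (p ℚ.* p)
  square-nonNegative p@(mkℚ (+ _)    _ _) = ℚ.nonNeg*nonNeg⇒nonNeg p p
  square-nonNegative p@(mkℚ -[1+ _ ] _ _) = ℚ.pos⇒nonNeg (p ℚ.* p) {{ℚ.neg*neg⇒pos p p}}

  square-positive : ∀ p → p ≢ 0ℚ → ℚ.Positive (p ℚ.* p)
  square-positive p@(mkℚ (+ zero)   _ _) p≢0 = contradiction (ℚ.↥p≡0⇒p≡0 p ≡.refl) p≢0
  square-positive p@(mkℚ ℤ.+[1+ _ ] _ _) _   = ℚ.pos*pos⇒pos p p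
  square-positive p@(mkℚ -[1+ _ ]   _ _) _   = ℚ.neg*neg⇒pos p p

  positive⇒≢0 : ∀ {p} → ℚ.Positive p → p ≢ 0ℚ
  positive⇒≢0 () ≡.refl

  ∥z∥²≢0 : ∀ {z} → z ≢ ℂ.0# → ℂ.∥ z ∥² ≢ 0ℚ
  ∥z∥²≢0 {a +i b} z≢0 with a ℚ.≟ 0ℚ | b ℚ.≟ 0ℚ
  ... | no a≢0  | _       = positive⇒≢0 (ℚ.pos+nonNeg⇒pos (a ℚ.* a) {{square-positive a a≢0}} (b ℚ.* b) {{square-nonNegative b}})
  ... | yes _   | no b≢0  = positive⇒≢0 (ℚ.nonNeg+pos⇒pos (a ℚ.* a) {{square-nonNegative a}} (b ℚ.* b) {{square-positive b b≢0}})
  ... | yes a≡0 | yes b≡0 = contradiction (ext a≡0 b≡0) z≢0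

  z*w≡0⇒w≡0 : ∀ {z w} → z ≢ ℂ.0# → z ℂ.* w ≡ ℂ.0# → w ≡ ℂ.0#
  z*w≡0⇒w≡0 {z} {w} z≢0 = *-≢0 {z} {w} (∥z∥²≢0 z≢0)

  z-w≡0⇒z≡w : ∀ z w → z ℂ.- w ≡ ℂ.0# → z ≡ w
  z-w≡0⇒z≡w z w eq = ≡.trans (solve 2 (λ z w → z := (z :- w) :+ w) ≡.refl z w)
    (≡.trans (cong (ℂ._+ w) eq) (+-identityˡ w))
    where open Solver

  *-cancelˡ : ∀ {z} u v → z ≢ ℂ.0# → z ℂ.* u ≡ z ℂ.* v → u ≡ v
  *-cancelˡ {z} u v z≢0 eq = z-w≡0⇒z≡w u v (z*w≡0⇒w≡0 {z} {u ℂ.- v} z≢0 (≡.trans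
    (solve 3 (λ z u v → z :* (u :- v) := z :* u :- z :* v) ≡.refl z u v)
    (≡.trans (cong (ℂ._- z ℂ.* v) eq) (+-inverseʳ (z ℂ.* v)))))
    where open Solver

  fromℕ≢0 : ∀ {n} → n ≢ 0 → fromℕ n ≢ ℂ.0#
  fromℕ≢0 n≢0 eq = n≢0 (fromℕ-injective eq)

  z*w≡z⇒z≡0 : ∀ {z w} → w ≢ ℂ.1# → z ℂ.* w ≡ z → z ≡ ℂ.0#
  z*w≡z⇒z≡0 {z} {w} w≢1 eq = z*w≡0⇒w≡0 {w ℂ.- ℂ.1#} {z} (w≢1 ∘ z-w≡0⇒z≡w w ℂ.1#)
    (≡.trans (solve 2 (λ z w → (w :- con ℂ.1#) :* z := z :* w :- z) ≡.refl z w)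
    (≡.trans (cong (ℂ._- z) eq) (+-inverseʳ z)))
    where open Solver

  inverse : ∀ z → z ≢ ℂ.0# → ∃ λ u → u ℂ.* z ≡ ℂ.1#
  inverse z z≢0 = conj z ℂ.* s , ≡.trans
    (solve 3 (λ z c s → c :* s :* z := z :* c :* s) ≡.refl z (conj z) s) (z*conj-z*∥z∥⁻² z (∥z∥²≢0 z≢0))
    where
    open Solver
    s : ℚ[i]
    s = fromℚ ((ℚ.1/ ℂ.∥ z ∥²) {{ℚ.≢-nonZero (∥z∥²≢0 z≢0)}})

  conj-sum : ∀ {n} (f : Fin n → ℚ[i]) → conj (ℂ.sum f) ≡ ℂ.sum (conj ∘ f)
  conj-sum {zero}  f = ≡.refl
  conj-sum {suc n} f = ≡.trans (conj-+ (f zero) (ℂ.sum (f ∘ suc))) (cong (conj (f zero) ℂ.+_) (conj-sum (f ∘ suc)))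

record Bicharacter (G : AbelianGroup 0ℓ 0ℓ) : Set where
  open AbelianGroup G
  field
    χ               : Carrier → Carrier → ℚ[i]
    χ-cong          : ∀ {a b x y} → a ≈ b → x ≈ y → χ a x ≡ χ b y
    χ-∙             : ∀ a x y → χ a (x ∙ y) ≡ χ a x ℂ.* χ a y
    χ-ε             : ∀ a → χ a ε ≡ ℂ.1#
    χ-sym           : ∀ a x → χ a x ≡ χ x a
    χ-⁻¹            : ∀ a x → χ a (x ⁻¹) ≡ ℚ[i]-Properties.conj (χ a x)
    χ-nondegenerate : ∀ {a} → ¬ a ≈ ε → ∃ λ x → χ a x ≢ ℂ.1#

module Fourier (G : AbelianGroup 0ℓ 0ℓ) {N : ℕ} (enum : Enumeration (AbelianGroup.setoid G) N)
               (bicharacter : Bicharacter G) (N≢0 : N ≢ 0) where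
  open AbelianGroup G
  open Bicharacter bicharacter
  open AbelianGroupProperties G using (⁻¹-involutive; ⁻¹-anti-homo-∙; x∙y⁻¹≈ε⇒x≈y; x≈y⇒x∙y⁻¹≈ε)
  open Finite enum
  open FiniteSums {AbelianGroup.setoid G} enum
  open Summation
  open ℚ[i]-Properties hiding (_≟_)
  open ℚ[i]-Domain
  open ≡-Reasoning

  x∙y∙y⁻¹≈x : ∀ x y → (x ∙ y) ∙ y ⁻¹ ≈ x
  x∙y∙y⁻¹≈x x y = trans (assoc x y (y ⁻¹)) (trans (∙-congˡ (inverseʳ y)) (identityʳ x))

  x∙y⁻¹∙y≈x : ∀ x y → (x ∙ y ⁻¹) ∙ y ≈ x
  x∙y⁻¹∙y≈x x y = trans (assoc x (y ⁻¹) y) (trans (∙-congˡ (inverseˡ y)) (identityʳ x))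

  x-[x-y]≈y : ∀ x y → x - (x - y) ≈ y
  x-[x-y]≈y x y = trans (∙-congˡ (⁻¹-anti-homo-∙ x (y ⁻¹))) (trans (∙-congˡ (∙-congʳ (⁻¹-involutive y)))
    (trans (comm x _) (x∙y⁻¹∙y≈x y x)))

  sumAll-translate : ∀ c φ → Respecting φ → sumAll (λ x → φ (x ∙ c)) ≡ sumAll φ
  sumAll-translate c φ φ-resp = sumAll-permute {_∙ c} {_∙ c ⁻¹} ∙-congʳ ∙-congʳ
    (λ x → x∙y⁻¹∙y≈x x c) (λ x → x∙y∙y⁻¹≈x x c) φ-resp

  sumAll-reflect : ∀ c φ → Respecting φ → sumAll (λ x → φ (c - x)) ≡ sumAll φ
  sumAll-reflect c φ φ-resp = sumAll-permute {λ x → c - x} {λ x → c - x} cong-c cong-c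
    (x-[x-y]≈y c) (x-[x-y]≈y c) φ-resp
    where
    cong-c : ∀ {x y} → x ≈ y → c - x ≈ c - y
    cong-c x≈y = ∙-congˡ (⁻¹-cong x≈y)

  orthogonality : ∀ {P : Pred Carrier 0ℓ} (P? : Decidable P) → (∀ {x y} → x ≈ y → P x → P y) →
    ∀ a h → (∀ x → P x → P (x ∙ h)) → (∀ x → P (x ∙ h) → P x) → χ a h ≢ ℂ.1# →
    sumAll (λ x → 𝟙 (P? x) ℂ.* χ a x) ≡ ℂ.0#
  orthogonality P? P-resp a h P⇒ P⇐ χ≢1 = z*w≡z⇒z≡0 {S} {χ a h} χ≢1 (begin
    S ℂ.* χ a h
      ≡⟨ sumAll-*ʳ (χ a h) (λ x → 𝟙 (P? x) ℂ.* χ a x) ⟨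
    sumAll (λ x → 𝟙 (P? x) ℂ.* χ a x ℂ.* χ a h)
      ≡⟨ sumAll-cong (λ x → ≡.trans (*-assoc (𝟙 (P? x)) (χ a x) (χ a h))
           (cong₂ ℂ._*_ (𝟙-cong (P? x) (P? (x ∙ h)) (P⇒ x) (P⇐ x)) (≡.sym (χ-∙ a x h)))) ⟩
    sumAll (λ x → 𝟙 (P? (x ∙ h)) ℂ.* χ a (x ∙ h))
      ≡⟨ sumAll-translate h (λ x → 𝟙 (P? x) ℂ.* χ a x)
           (λ x≈y → cong₂ ℂ._*_ (𝟙-resp P? P-resp x≈y) (χ-cong refl x≈y)) ⟩
    S ∎)
    where
    S : ℚ[i]
    S = sumAll (λ x → 𝟙 (P? x) ℂ.* χ a x)

  hat : (Carrier → ℚ[i]) → Carrier → ℚ[i]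
  hat φ a = sumAll λ x → φ x ℂ.* χ a x

  one : Carrier → ℚ[i]
  one _ = ℂ.1#

  hat-one-≉ε : ∀ {a} → ¬ a ≈ ε → hat one a ≡ ℂ.0#
  hat-one-≉ε {a} a≉ε with h , χ≢1 ← χ-nondegenerate a≉ε = begin
    hat one a                                 ≡⟨ sumAll-cong (λ x → cong (ℂ._* χ a x) (𝟙-true (x ≟ x) refl)) ⟨
    sumAll (λ x → 𝟙 (x ≟ x) ℂ.* χ a x)        ≡⟨ orthogonality (λ x → x ≟ x) (λ _ _ → refl) a h (λ _ _ → refl) (λ _ _ → refl) χ≢1 ⟩
    ℂ.0#                                      ∎

  χε : ∀ {a} x → a ≈ ε → χ a x ≡ ℂ.1#
  χε {a} x a≈ε = ≡.trans (χ-sym a x) (≡.trans (χ-cong refl a≈ε) (χ-ε x))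

  hat-ε : ∀ φ {a} → a ≈ ε → hat φ a ≡ sumAll φ
  hat-ε φ {a} a≈ε = sumAll-cong λ x → ≡.trans (cong (φ x ℂ.*_) (χε x a≈ε))
    (z*1 (φ x))

  hat-one-ε : ∀ {a} → a ≈ ε → hat one a ≡ fromℕ N
  hat-one-ε a≈ε = ≡.trans (hat-ε one a≈ε) (sum-one N)

  hat-one : ∀ a → hat one a ≡ 𝟙 (a ≟ ε) ℂ.* fromℕ N
  hat-one a = lemma (a ≟ ε)
    where
    lemma : (d : Dec (a ≈ ε)) → hat one a ≡ 𝟙 d ℂ.* fromℕ N
    lemma (yes a≈ε) = ≡.trans (hat-one-ε a≈ε) (≡.sym (1*z (fromℕ N)))
    lemma (no a≉ε)  = ≡.trans (hat-one-≉ε a≉ε) (≡.sym (0*z (fromℕ N)))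

  hat-cong : ∀ {φ ψ} → (∀ x → φ x ≡ ψ x) → ∀ a → hat φ a ≡ hat ψ a
  hat-cong eq a = sumAll-cong λ x → cong (ℂ._* χ a x) (eq x)

  hat-combination : ∀ {m} (c : Fin m → ℚ[i]) (φ : Fin m → Carrier → ℚ[i]) a →
    hat (λ x → ℂ.sum λ k → c k ℂ.* φ k x) a ≡ ℂ.sum λ k → c k ℂ.* hat (φ k) a
  hat-combination c φ a = ≡.trans
    (sumAll-cong λ x → ≡.trans (*-distribʳ-sum (χ a x) (λ k → c k ℂ.* φ k x))
      (sum-cong-≗ λ k → *-assoc (c k) (φ k x) (χ a x)))
    (sumAll-combination c (λ k x → φ k x ℂ.* χ a x))

  hat-+ : ∀ φ ψ a → hat (λ x → φ x ℂ.+ ψ x) a ≡ hat φ a ℂ.+ hat ψ a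
  hat-+ φ ψ a = ≡.trans (sumAll-cong λ x → *-distribʳ-+ (χ a x) (φ x) (ψ x))
    (sumAll-+ (λ x → φ x ℂ.* χ a x) (λ x → ψ x ℂ.* χ a x))

  hat-* : ∀ c φ a → hat (λ x → c ℂ.* φ x) a ≡ c ℂ.* hat φ a
  hat-* c φ a = ≡.trans (sumAll-cong λ x → *-assoc c (φ x) (χ a x))
    (sumAll-*ˡ c (λ x → φ x ℂ.* χ a x))

  sumAll-hat : ∀ φ x → Respecting φ → sumAll (λ a → hat φ a ℂ.* χ a (x ⁻¹)) ≡ φ x ℂ.* fromℕ N
  sumAll-hat φ x φ-resp = begin
    sumAll (λ a → hat φ a ℂ.* χ a (x ⁻¹))
      ≡⟨ sumAll-cong (λ a → ≡.trans (≡.sym (sumAll-*ʳ (χ a (x ⁻¹)) (λ y → φ y ℂ.* χ a y)))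
           (sumAll-cong λ y → ≡.trans (*-assoc (φ y) (χ a y) (χ a (x ⁻¹)))
             (cong (φ y ℂ.*_) (≡.trans (≡.sym (χ-∙ a y (x ⁻¹))) (χ-sym a (y - x)))))) ⟩
    sumAll (λ a → sumAll (λ y → φ y ℂ.* χ (y - x) a))
      ≡⟨ sumAll-comm (λ a y → φ y ℂ.* χ (y - x) a) ⟩
    sumAll (λ y → sumAll (λ a → φ y ℂ.* χ (y - x) a))
      ≡⟨ sumAll-cong (λ y → ≡.trans (sumAll-*ˡ (φ y) (χ (y - x)))
           (cong (φ y ℂ.*_) (≡.trans (sumAll-cong λ a → ≡.sym (1*z (χ (y - x) a))) (hat-one (y - x))))) ⟩
    sumAll (λ y → φ y ℂ.* (𝟙 ((y - x) ≟ ε) ℂ.* fromℕ N))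
      ≡⟨ sumAll-cong (λ y → ≡.trans (rearrange (φ y) (𝟙 ((y - x) ≟ ε)) (fromℕ N))
           (cong (ℂ._* (φ y ℂ.* fromℕ N)) (𝟙-cong ((y - x) ≟ ε) (y ≟ x) (x∙y⁻¹≈ε⇒x≈y y x) x≈y⇒x∙y⁻¹≈ε))) ⟩
    sumAll (λ y → 𝟙 (y ≟ x) ℂ.* (φ y ℂ.* fromℕ N))
      ≡⟨ sumAll-delta (λ y → φ y ℂ.* fromℕ N) x (λ x≈y → cong (ℂ._* fromℕ N) (φ-resp x≈y)) ⟩
    φ x ℂ.* fromℕ N ∎
    where
    rearrange : ∀ u v w → u ℂ.* (v ℂ.* w) ≡ v ℂ.* (u ℂ.* w)
    rearrange u v w = ≡.trans (≡.sym (*-assoc u v w)) (≡.trans (cong (ℂ._* w) (*-comm u v)) (*-assoc v u w))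

  hat-injective : ∀ φ ψ → Respecting φ → Respecting ψ → (∀ a → hat φ a ≡ hat ψ a) → ∀ x → φ x ≡ ψ x
  hat-injective φ ψ φ-resp ψ-resp eq x = *-cancelˡ {fromℕ N} (φ x) (ψ x) (fromℕ≢0 N≢0) (begin
    fromℕ N ℂ.* φ x                              ≡⟨ *-comm (fromℕ N) (φ x) ⟩
    φ x ℂ.* fromℕ N                              ≡⟨ sumAll-hat φ x φ-resp ⟨
    sumAll (λ a → hat φ a ℂ.* χ a (x ⁻¹))        ≡⟨ sumAll-cong (λ a → cong (ℂ._* χ a (x ⁻¹)) (eq a)) ⟩
    sumAll (λ a → hat ψ a ℂ.* χ a (x ⁻¹))        ≡⟨ sumAll-hat ψ x ψ-resp ⟩
    ψ x ℂ.* fromℕ N                              ≡⟨ *-comm (ψ x) (fromℕ N) ⟩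
    fromℕ N ℂ.* ψ x                              ∎)

  infixl 7 _∗_
  _∗_ : (Carrier → ℚ[i]) → (Carrier → ℚ[i]) → Carrier → ℚ[i]
  (φ ∗ ψ) x = sumAll λ y → φ y ℂ.* ψ (x - y)

  ∗-resp : ∀ φ ψ → Respecting ψ → Respecting (φ ∗ ψ)
  ∗-resp φ ψ ψ-resp x≈y = sumAll-cong λ z → cong (φ z ℂ.*_) (ψ-resp (∙-congʳ {z ⁻¹} x≈y))

  hat-∗ : ∀ φ ψ → Respecting ψ → ∀ a → hat (φ ∗ ψ) a ≡ hat φ a ℂ.* hat ψ a
  hat-∗ φ ψ ψ-resp a = begin
    sumAll (λ x → sumAll (λ y → φ y ℂ.* ψ (x - y)) ℂ.* χ a x)
      ≡⟨ sumAll-cong (λ x → ≡.trans (≡.sym (sumAll-*ʳ (χ a x) (λ y → φ y ℂ.* ψ (x - y))))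
           (sumAll-cong λ y → *-assoc (φ y) (ψ (x - y)) (χ a x))) ⟩
    sumAll (λ x → sumAll (λ y → φ y ℂ.* (ψ (x - y) ℂ.* χ a x)))
      ≡⟨ sumAll-comm (λ x y → φ y ℂ.* (ψ (x - y) ℂ.* χ a x)) ⟩
    sumAll (λ y → sumAll (λ x → φ y ℂ.* (ψ (x - y) ℂ.* χ a x)))
      ≡⟨ sumAll-cong inner ⟩
    sumAll (λ y → (φ y ℂ.* χ a y) ℂ.* hat ψ a)
      ≡⟨ sumAll-*ʳ (hat ψ a) (λ y → φ y ℂ.* χ a y) ⟩
    hat φ a ℂ.* hat ψ a ∎
    where
    rearrange : ∀ u v w → u ℂ.* (v ℂ.* w) ≡ (u ℂ.* w) ℂ.* v
    rearrange u v w = ≡.trans (cong (u ℂ.*_) (*-comm v w)) (≡.sym (*-assoc u w v))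

    inner : ∀ y → sumAll (λ x → φ y ℂ.* (ψ (x - y) ℂ.* χ a x)) ≡ (φ y ℂ.* χ a y) ℂ.* hat ψ a
    inner y = begin
      sumAll (λ x → φ y ℂ.* (ψ (x - y) ℂ.* χ a x))
        ≡⟨ sumAll-cong (λ x → cong (λ z → φ y ℂ.* (ψ (x - y) ℂ.* z)) (≡.trans (χ-cong refl (sym (x∙y⁻¹∙y≈x x y))) (χ-∙ a (x - y) y))) ⟩
      sumAll (λ x → φ y ℂ.* (ψ (x - y) ℂ.* (χ a (x - y) ℂ.* χ a y)))
        ≡⟨ sumAll-translate (y ⁻¹) (λ x → φ y ℂ.* (ψ x ℂ.* (χ a x ℂ.* χ a y)))
             (λ x≈y → cong (φ y ℂ.*_) (cong₂ ℂ._*_ (ψ-resp x≈y) (cong (ℂ._* χ a y) (χ-cong refl x≈y)))) ⟩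
      sumAll (λ x → φ y ℂ.* (ψ x ℂ.* (χ a x ℂ.* χ a y)))
        ≡⟨ sumAll-cong (λ x → ≡.trans (cong (φ y ℂ.*_) (≡.sym (*-assoc (ψ x) (χ a x) (χ a y)))) (rearrange (φ y) (ψ x ℂ.* χ a x) (χ a y))) ⟩
      sumAll (λ x → (φ y ℂ.* χ a y) ℂ.* (ψ x ℂ.* χ a x))
        ≡⟨ sumAll-*ˡ (φ y ℂ.* χ a y) (λ x → ψ x ℂ.* χ a x) ⟩
      (φ y ℂ.* χ a y) ℂ.* hat ψ a ∎

  sumAll-product : ∀ φ ψ x y → Respecting φ → Respecting ψ →
                   sumAll (λ z → φ (x - z) ℂ.* ψ (z - y)) ≡ (φ ∗ ψ) (x - y)
  sumAll-product φ ψ x y φ-resp ψ-resp = ≡.trans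
    (sumAll-cong λ z → cong (φ (x - z) ℂ.*_) (ψ-resp (sym (rearrange z))))
    (sumAll-reflect x (λ z → φ z ℂ.* ψ (x - y - z))
      λ x≈y → cong₂ ℂ._*_ (φ-resp x≈y) (ψ-resp (∙-congˡ (⁻¹-cong x≈y))))
    where
    rearrange : ∀ z → x - y - (x - z) ≈ z - y
    rearrange z = trans (∙-congʳ (comm x (y ⁻¹))) (trans (assoc (y ⁻¹) x _)
      (trans (∙-congˡ {y ⁻¹} (x-[x-y]≈y x z)) (comm (y ⁻¹) z)))

  hat-⁻¹ : ∀ φ → Respecting φ → (∀ x → conj (φ x) ≡ φ x) → ∀ a → hat (φ ∘ _⁻¹) a ≡ conj (hat φ a)
  hat-⁻¹ φ φ-resp real a = begin
    sumAll (λ x → φ (x ⁻¹) ℂ.* χ a x)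
      ≡⟨ sumAll-cong (λ x → cong (φ (x ⁻¹) ℂ.*_) (χ-cong refl (sym (⁻¹-involutive x)))) ⟩
    sumAll (λ x → φ (x ⁻¹) ℂ.* χ a (x ⁻¹ ⁻¹))
      ≡⟨ sumAll-permute {_⁻¹} {_⁻¹} ⁻¹-cong ⁻¹-cong ⁻¹-involutive ⁻¹-involutive
           {λ x → φ x ℂ.* χ a (x ⁻¹)} (λ x≈y → cong₂ ℂ._*_ (φ-resp x≈y) (χ-cong refl (⁻¹-cong x≈y))) ⟩
    sumAll (λ x → φ x ℂ.* χ a (x ⁻¹))
      ≡⟨ sumAll-cong (λ x → ≡.trans (cong₂ ℂ._*_ (≡.sym (real x)) (χ-⁻¹ a x)) (≡.sym (conj-* (φ x) (χ a x)))) ⟩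
    sumAll (λ x → conj (φ x ℂ.* χ a x))
      ≡⟨ conj-sum {N} (λ k → φ (Inverse.from enum k) ℂ.* χ a (Inverse.from enum k)) ⟨
    conj (hat φ a) ∎

module PowersOf𝐢 where
  open ℚ[i]-Properties
  private module E = Exp (CommutativeRing.commutativeSemiring commutativeRing)

  𝐢^-+ : ∀ k l → 𝐢 ℂ.^ (k ℕ.+ l) ≡ 𝐢 ℂ.^ k ℂ.* 𝐢 ℂ.^ l
  𝐢^-+ k l = E.^-homo-* 𝐢 k l

  1^n≡1 : ∀ n → ℂ.1# ℂ.^ n ≡ ℂ.1#
  1^n≡1 zero    = ≡.refl
  1^n≡1 (suc n) = ≡.trans (*-identityˡ (ℂ.1# ℂ.^ n)) (1^n≡1 n)

  𝐢^-periodic : ∀ k q → 𝐢 ℂ.^ (k ℕ.+ q ℕ.* 4) ≡ 𝐢 ℂ.^ k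
  𝐢^-periodic k q = ≡.trans (𝐢^-+ k (q ℕ.* 4)) (≡.trans (cong (𝐢 ℂ.^ k ℂ.*_) (begin
    𝐢 ℂ.^ (q ℕ.* 4)      ≡⟨ cong (𝐢 ℂ.^_) (ℕ.*-comm q 4) ⟩
    𝐢 ℂ.^ (4 ℕ.* q)      ≡⟨ E.^-assocʳ 𝐢 4 q ⟨
    (𝐢 ℂ.^ 4) ℂ.^ q      ≡⟨ 1^n≡1 q ⟩
    ℂ.1#                 ∎)) (≡.trans (*-comm (𝐢 ℂ.^ k) ℂ.1#) (*-identityˡ (𝐢 ℂ.^ k))))
    where open ≡.≡-Reasoning

  conj-𝐢^ : (k : Fin 4) → conj (𝐢 ℂ.^ toℕ k) ℂ.* 𝐢 ℂ.^ toℕ k ≡ ℂ.1#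
  conj-𝐢^ 0F = ≡.refl
  conj-𝐢^ 1F = ≡.refl
  conj-𝐢^ 2F = ≡.refl
  conj-𝐢^ 3F = ≡.refl

  𝐢^≡1 : (k : Fin 4) → 𝐢 ℂ.^ toℕ k ≡ ℂ.1# → toℕ k ≡ 0
  𝐢^≡1 0F _ = ≡.refl
  𝐢^≡1 1F ()
  𝐢^≡1 2F ()
  𝐢^≡1 3F ()

record TraceCharacter {n : ℕ} (G : GR4 n) : Set where
  open GR4 G
  field
    trace               : Carrier → Carrier
    trace-cong          : ∀ {x y} → x ≈ y → trace x ≈ trace y
    trace-+             : ∀ x y → trace (x + y) ≈ trace x + trace y
    trace-nondegenerate : ∃ λ z → ¬ trace (2 · z) ≈ 0#
    χ                   : Carrier → Carrier → ℚ[i]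
    χ-spec              : ∀ a x → ∃ λ (k : Fin 4) → trace (a * x) ≈ toℕ k · 1# × χ a x ≡ 𝐢 ℂ.^ toℕ k

module TraceCharacterProperties {m : ℕ} (G : GR4 (suc m)) (ξ : GR4.Carrier G)
  (order : Teichmüller.HasTeichmüllerOrder G ξ) (traceCharacter : TraceCharacter G) where
  open GR4 G hiding (zero; *-identityˡ; *-assoc; *-comm)
  open TraceCharacter traceCharacter
  open RingOfCharacteristic4 G
  open TeichmüllerProperties G ξ order using (unit)
  open Solver using (solve; _:=_; _:*_; _:×_)
  open RingProperties ring using (+-cancelˡ)
  open Mult semiring using (×-homo-+)
  open PowersOf𝐢
  open ℚ[i]-Properties using (conj; *-assoc; *-comm; *-identityˡ)

  private
    𝐢^-cong-≤ : ∀ {k l} → k ℕ.≤ l → k · 1# ≈ l · 1# → 𝐢 ℂ.^ k ≡ 𝐢 ℂ.^ l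
    𝐢^-cong-≤ {k} {l} k≤l eq with divides q l∸k≡ ← Equivalence.to (characteristic (l ℕ.∸ k))
      (+-cancelˡ (k · 1#) _ _ (trans (sym (×-homo-+ 1# k (l ℕ.∸ k)))
        (trans (reflexive (≡.cong (_· 1#) (ℕ.m+[n∸m]≡n k≤l))) (trans (sym eq) (sym (+-identityʳ _)))))) =
      ≡.trans (≡.sym (𝐢^-periodic k q)) (cong (𝐢 ℂ.^_)
        (≡.trans (cong (k ℕ.+_) (≡.sym l∸k≡)) (ℕ.m+[n∸m]≡n k≤l)))

    𝐢^-cong : ∀ {k l} → k · 1# ≈ l · 1# → 𝐢 ℂ.^ k ≡ 𝐢 ℂ.^ l
    𝐢^-cong {k} {l} eq with ℕ.≤-total k l
    ... | inj₁ k≤l = 𝐢^-cong-≤ k≤l eq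
    ... | inj₂ l≤k = ≡.sym (𝐢^-cong-≤ l≤k (sym eq))

    exponent : Carrier → Carrier → Fin 4
    exponent a x = proj₁ (χ-spec a x)

    trace≈ : ∀ a x → trace (a * x) ≈ toℕ (exponent a x) · 1#
    trace≈ a x = proj₁ (proj₂ (χ-spec a x))

    χ≡𝐢^ : ∀ a x → χ a x ≡ 𝐢 ℂ.^ toℕ (exponent a x)
    χ≡𝐢^ a x = proj₂ (proj₂ (χ-spec a x))

    χ-trace : ∀ a x k → trace (a * x) ≈ k · 1# → χ a x ≡ 𝐢 ℂ.^ k
    χ-trace a x k eq = ≡.trans (χ≡𝐢^ a x) (𝐢^-cong {toℕ (exponent a x)} {k} (trans (sym (trace≈ a x)) eq))

    trace-0 : trace 0# ≈ 0#
    trace-0 = +-cancelˡ (trace 0#) _ _ (trans (sym (trace-+ 0# 0#))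
      (trans (trace-cong (+-identityʳ 0#)) (sym (+-identityʳ _))))

  χ-≈ : ∀ {a b x y} → a * x ≈ b * y → χ a x ≡ χ b y
  χ-≈ {a} {b} {x} {y} eq = ≡.trans
    (χ-trace a x (toℕ (exponent b y)) (trans (trace-cong eq) (trace≈ b y))) (≡.sym (χ≡𝐢^ b y))

  χ-cong : ∀ {a b x y} → a ≈ b → x ≈ y → χ a x ≡ χ b y
  χ-cong a≈b x≈y = χ-≈ (*-cong a≈b x≈y)

  χ-+ : ∀ a x y → χ a (x + y) ≡ χ a x ℂ.* χ a y
  χ-+ a x y = ≡.trans
    (χ-trace a (x + y) (toℕ (exponent a x) ℕ.+ toℕ (exponent a y)) (trans (trace-cong (distribˡ a x y))
      (trans (trace-+ (a * x) (a * y)) (trans (+-cong (trace≈ a x) (trace≈ a y))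
        (sym (×-homo-+ 1# (toℕ (exponent a x)) (toℕ (exponent a y))))))))
    (≡.trans (𝐢^-+ (toℕ (exponent a x)) (toℕ (exponent a y)))
      (≡.sym (cong₂ ℂ._*_ (χ≡𝐢^ a x) (χ≡𝐢^ a y))))

  χ-annihilated : ∀ {a x} → a * x ≈ 0# → χ a x ≡ ℂ.1#
  χ-annihilated {a} {x} ax≈0 = χ-trace a x 0 (trans (trace-cong ax≈0) trace-0)

  χ-0 : ∀ a → χ a 0# ≡ ℂ.1#
  χ-0 a = χ-annihilated (zeroʳ a)

  χ-sym : ∀ a x → χ a x ≡ χ x a
  χ-sym a x = χ-≈ (GR4.*-comm G a x)

  χ-neg : ∀ a x → χ a (- x) ≡ conj (χ a x)
  χ-neg a x = begin
    χ a (- x)                                      ≡⟨ *-identityˡ (χ a (- x)) ⟨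
    ℂ.1# ℂ.* χ a (- x)                             ≡⟨ cong (ℂ._* χ a (- x)) conj*χ≡1 ⟨
    (conj (χ a x) ℂ.* χ a x) ℂ.* χ a (- x)         ≡⟨ *-assoc (conj (χ a x)) (χ a x) (χ a (- x)) ⟩
    conj (χ a x) ℂ.* (χ a x ℂ.* χ a (- x))         ≡⟨ cong (conj (χ a x) ℂ.*_) (≡.trans (≡.sym (χ-+ a x (- x))) (≡.trans (χ-cong refl (-‿inverseʳ x)) (χ-0 a))) ⟩
    conj (χ a x) ℂ.* ℂ.1#                          ≡⟨ *-comm (conj (χ a x)) ℂ.1# ⟩
    ℂ.1# ℂ.* conj (χ a x)                          ≡⟨ *-identityˡ (conj (χ a x)) ⟩
    conj (χ a x)                                   ∎
    where
    open ≡.≡-Reasoning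
    conj*χ≡1 : conj (χ a x) ℂ.* χ a x ≡ ℂ.1#
    conj*χ≡1 = ≡.trans (cong (λ z → conj z ℂ.* z) (χ≡𝐢^ a x)) (conj-𝐢^ (exponent a x))

  χ-values : ∀ a x → ∃ λ (k : Fin 4) → χ a x ≡ 𝐢 ℂ.^ toℕ k
  χ-values a x = exponent a x , χ≡𝐢^ a x

  private
    χ≢1 : ∀ {a x z} → a * x ≈ 2 · z → ¬ trace (2 · z) ≈ 0# → χ a x ≢ ℂ.1#
    χ≢1 {a} {x} eq trace≉0 χ≡1 = trace≉0 (trans (trace-cong (sym eq)) (trans (trace≈ a x)
      (reflexive (≡.cong (_· 1#) (𝐢^≡1 (exponent a x) (≡.trans (≡.sym (χ≡𝐢^ a x)) χ≡1))))))

    z : Carrier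
    z = proj₁ trace-nondegenerate

    double-unit : ∀ {c} → ¬ Z c → ∃ λ y → 2 · (c * y) ≈ 2 · z
    double-unit {c} c∉Z with y , cy≈1 ← unit c∉Z = y * z , ×-congʳ 2
      (trans (sym (GR4.*-assoc G c y z)) (trans (*-congʳ cy≈1) (GR4.*-identityˡ G z)))

  χ-nondegenerate-Z : ∀ {a} → ¬ Z a → ∃ λ x → Z x × χ a x ≢ ℂ.1#
  χ-nondegenerate-Z {a} a∉Z with y , eq ← double-unit a∉Z = 2 · y , (y , refl) ,
    χ≢1 (trans (solve 2 (λ a y → a :* (2 :× y) := 2 :× (a :* y)) refl a y) eq) (proj₂ trace-nondegenerate)

  χ-nondegenerate : (Z? : ∀ x → Dec (Z x)) → ∀ {a} → ¬ a ≈ 0# → ∃ λ x → χ a x ≢ ℂ.1#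
  χ-nondegenerate Z? {a} a≉0 = cases (Z? a)
    where
    cases : Dec (Z a) → ∃ λ x → χ a x ≢ ℂ.1#
    cases (no a∉Z) = proj₁ (χ-nondegenerate-Z a∉Z) , proj₂ (proj₂ (χ-nondegenerate-Z a∉Z))
    cases (yes (c , a≈2c)) = proj₁ y , χ≢1 (trans (*-congʳ a≈2c)
      (trans (solve 2 (λ c y → (2 :× c) :* y := 2 :× (c :* y)) refl c (proj₁ y)) (proj₂ y))) (proj₂ trace-nondegenerate)
      where
      y : ∃ λ y → 2 · (c * y) ≈ 2 · z
      y = double-unit {c} λ c∈Z → a≉0 (trans a≈2c (trans (Z⇒∼0 c∈Z) 2·0≈0))

-- Eigenmatrices

÷-unique : ∀ {u z w} → w ≢ ℂ.0# → u ℂ.* w ≡ z → u ≡ z ℂ.÷ w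
÷-unique {u} {z} {w} w≢0 eq with ℂ.∥ w ∥² ℚ.≟ 0ℚ
... | yes ∥w∥≡0 = contradiction ∥w∥≡0 (ℚ[i]-Domain.∥z∥²≢0 w≢0)
... | no  ∥w∥≢0 = begin
  u                                          ≡⟨ *-identityˡ u ⟨
  ℂ.1# ℂ.* u                                 ≡⟨ cong (ℂ._* u) (z*conj-z*∥z∥⁻² w ∥w∥≢0) ⟨
  (w ℂ.* conj w ℂ.* s) ℂ.* u                 ≡⟨ solve 4 (λ w c s u → (w :* c :* s) :* u := (u :* w) :* c :* s) refl w (conj w) s u ⟩
  (u ℂ.* w) ℂ.* conj w ℂ.* s                 ≡⟨ cong (λ t → t ℂ.* conj w ℂ.* s) eq ⟩
  z ℂ.* conj w ℂ.* s                         ∎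
  where
  open ≡ using (refl)
  open ℚ[i]-Properties
  open Solver
  open ≡-Reasoning
  s : ℚ[i]
  s = fromℚ ((ℚ.1/ ℂ.∥ w ∥²) {{ℚ.≢-nonZero ∥w∥≢0}})

module EigenmatrixPolynomials where
  open ≡ using (refl; sym; trans)
  open import Agda.Builtin.FromNat using (Number; fromNat)
  open ℚ[i]-Properties using (module Solver)
  open Solver public using (Polynomial; con; var; ⟦_⟧; normalise; correct; ⟦_⟧N)
  open Solver public using () renaming
    (_:+_ to infixl 6 _+_; _:*_ to infixl 7 _*_; :-_ to infix 8 -_; _:^_ to infixr 9 _^_; _:-_ to infixl 6 _-_)

  instance
    number-ℕ : Number ℕ
    number-ℕ = Data.Nat.Literals.number

    number-ℚ[i] : Number ℚ[i]
    number-ℚ[i] = record { Constraint = λ _ → ⊤ ; fromNat = λ m → fromℕ m }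

    number-Polynomial : Number (Polynomial 1)
    number-Polynomial = record { Constraint = λ _ → ⊤ ; fromNat = λ m → con (fromℕ m) }

  PolynomialMatrix : Set
  PolynomialMatrix = Vec (Vec (Polynomial 1) 6) 6

  b ı : Polynomial 1
  b = var 0F
  ı = con 𝐢

  entry : PolynomialMatrix → Fin 6 → Fin 6 → Polynomial 1
  entry M j i = lookup (lookup M j) i

  infix 9 _at_
  _at_ : Polynomial 1 → ℚ[i] → ℚ[i]
  p at x = ⟦ p ⟧ (x ∷ [])

  evaluate : PolynomialMatrix → ℚ[i] → Values.SquareMatrix
  evaluate M x = Vec.map (Vec.map (_at x)) M

  entry-evaluate : ∀ M x j i → entry M j i at x ≡ Values.entry (evaluate M x) j i
  entry-evaluate M x j i = sym (trans
    (cong (λ r → lookup r i) (Vec.lookup-map j (Vec.map (_at x)) M))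
    (Vec.lookup-map i (_at x) (lookup M j)))

  ∑ : ∀ {n} → (Fin n → Polynomial 1) → Polynomial 1
  ∑ = Vector.foldr _+_ 0

  ∑-at : ∀ {n} (f : Fin n → Polynomial 1) x → (∑ f) at x ≡ ℂ.sum λ i → f i at x
  ∑-at {zero}  f x = refl
  ∑-at {suc n} f x = cong (f zero at x ℂ.+_) (∑-at (f ∘ suc) x)

  ≡-at : ∀ p q → normalise p ≡ normalise q → ∀ x → p at x ≡ q at x
  ≡-at p q eq x = trans (sym (correct p (x ∷ []))) (trans (cong (λ r → ⟦ r ⟧N (x ∷ [])) eq) (correct q (x ∷ [])))

  ≡-at-Fin : ∀ {n} (f g : Fin n → Polynomial 1) → tabulate (normalise ∘ f) ≡ tabulate (normalise ∘ g) →
             ∀ i x → f i at x ≡ g i at x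
  ≡-at-Fin f g eq i = ≡-at (f i) (g i) (trans (sym (Vec.lookup∘tabulate (normalise ∘ f) i))
    (trans (cong (λ v → lookup v i) eq) (Vec.lookup∘tabulate (normalise ∘ g) i)))

  ≡-at-Fin² : ∀ {n} (f g : Fin n → Fin n → Polynomial 1) →
    tabulate (λ j → tabulate (normalise ∘ f j)) ≡ tabulate (λ j → tabulate (normalise ∘ g j)) →
    ∀ j i x → f j i at x ≡ g j i at x
  ≡-at-Fin² f g eq j = ≡-at-Fin (f j) (g j) (trans (sym (Vec.lookup∘tabulate (λ j → tabulate (normalise ∘ f j)) j))
    (trans (cong (λ v → lookup v j) eq) (Vec.lookup∘tabulate (λ j → tabulate (normalise ∘ g j)) j)))

  scalar : Polynomial 1 → Fin 6 → Fin 6 → Polynomial 1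
  scalar N j k = if does (j Fin.≟ k) then N else 0

  conjᵖ : Polynomial 1 → Polynomial 1
  conjᵖ (Solver.op o p q) = Solver.op o (conjᵖ p) (conjᵖ q)
  conjᵖ (con c)           = con (ℚ[i]-Properties.conj c)
  conjᵖ (var i)           = var i
  conjᵖ (p Solver.:^ n)   = conjᵖ p Solver.:^ n
  conjᵖ (Solver.:- p)     = Solver.:- conjᵖ p

  conj-at : ∀ p {x} → ℚ[i]-Properties.conj x ≡ x → ℚ[i]-Properties.conj (p at x) ≡ conjᵖ p at x
  conj-at (Solver.op Solver.[+] p q) {x} real = trans (ℚ[i]-Properties.conj-+ (p at x) (q at x)) (cong₂ ℂ._+_ (conj-at p real) (conj-at q real))
  conj-at (Solver.op Solver.[*] p q) {x} real = trans (ℚ[i]-Properties.conj-* (p at x) (q at x)) (cong₂ ℂ._*_ (conj-at p real) (conj-at q real))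
  conj-at (con c)                 real = refl
  conj-at (var 0F)                real = real
  conj-at (p Solver.:^ zero)      real = refl
  conj-at (p Solver.:^ suc n) {x} real = trans (ℚ[i]-Properties.conj-* (p at x) ((p Solver.:^ n) at x)) (cong₂ ℂ._*_ (conj-at p real) (conj-at (p Solver.:^ n) real))
  conj-at (Solver.:- p)           real = cong (λ z → ℂ.- z) (conj-at p real)

  substitute : Polynomial 1 → Polynomial 1 → Polynomial 1
  substitute s (Solver.op o p q) = Solver.op o (substitute s p) (substitute s q)
  substitute s (con c)           = con c
  substitute s (var i)           = s
  substitute s (p Solver.:^ n)   = substitute s p Solver.:^ n
  substitute s (Solver.:- p)     = Solver.:- substitute s p

  substitute-at : ∀ s p x → substitute s p at x ≡ p at (s at x)
  substitute-at s (Solver.op Solver.[+] p q) x = cong₂ ℂ._+_ (substitute-at s p x) (substitute-at s q x)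
  substitute-at s (Solver.op Solver.[*] p q) x = cong₂ ℂ._*_ (substitute-at s p x) (substitute-at s q x)
  substitute-at s (con c)              x = refl
  substitute-at s (var 0F)             x = refl
  substitute-at s (p Solver.:^ zero)   x = refl
  substitute-at s (p Solver.:^ suc n)  x = cong₂ ℂ._*_ (substitute-at s p x) (substitute-at s (p Solver.:^ n) x)
  substitute-at s (Solver.:- p)        x = cong (λ z → ℂ.- z) (substitute-at s p x)

  horner : List ℕ → Polynomial 1
  horner []       = 0
  horner (c ∷ cs) = con (fromℕ c) + b * horner cs

  hornerℕ : List ℕ → ℕ → ℕ
  hornerℕ []       k = 0
  hornerℕ (c ∷ cs) k = c ℕ.+ k ℕ.* hornerℕ cs k

  horner-at : ∀ cs k → horner cs at fromℕ k ≡ fromℕ (hornerℕ cs k)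
  horner-at []       k = refl
  horner-at (c ∷ cs) k = trans (cong (λ z → fromℕ c ℂ.+ fromℕ k ℂ.* z) (horner-at cs k))
    (sym (trans (ℚ[i]-Properties.fromℕ-+ c (k ℕ.* hornerℕ cs k))
      (cong (fromℕ c ℂ.+_) (ℚ[i]-Properties.fromℕ-* k (hornerℕ cs k)))))

  record PolynomialEigendata : Set where
    field
      P Q         : PolynomialMatrix
      w w̄ r z     : Fin 6 → Polynomial 1
      q sgn       : Polynomial 1
      opposite    : Fin 6 → Fin 6
      directions  : Fin 4 → ℚ[i]
      -- P 0 i, expanded in powers of b - 2, has natural coefficients and a
      -- positive constant term.
      constants   : Fin 6 → ℕ
      higher      : Fin 6 → List ℕ
      P*Q     : ∀ j k x → ∑ (λ i → entry P j i * entry Q i k) at x ≡ scalar (q * q) j k at x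
      row₀    : ∀ j x → entry P j 0F at x ≡ 1 at x
      row₁    : ∀ j x → entry P j 1F at x ≡ (w j - 1) at x
      row₂    : ∀ j x → entry P j 2F at x ≡ (w̄ j - 1) at x
      row₃    : ∀ j x → entry P j 3F at x ≡ (z j - 1) at x
      row₄    : ∀ j x → (2 * entry P j 4F) at x ≡ (w j * w j - z j - 2 * (w j - 1) - (1 + sgn) * (w̄ j - 1)) at x
      rowSum  : ∀ j x → ∑ (entry P j) at x ≡ r j at x
      cube    : ∀ k x → (w (suc (suc k)) * w (suc (suc k)) * w (suc (suc k))) at x ≡ (sgn * q * w̄ (suc (suc k))) at x
      norm    : ∀ k x → (w (suc (suc k)) * w̄ (suc (suc k))) at x ≡ q at x
      scaled  : ∀ k x → w (suc (suc k)) at x ≡ (b * con (directions k)) at x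
      conj-w  : ∀ j x → conjᵖ (w j) at x ≡ w̄ j at x
      conj-P  : ∀ j i x → conjᵖ (entry P j i) at x ≡ entry P j (opposite i) at x
      P₀      : ∀ i x → substitute (2 + b) (entry P 0F i) at x ≡ horner (suc (constants i) ∷ higher i) at x

  module OddPolynomials where

    P : PolynomialMatrix
    P =
      (1 ∷ 2 * b ^ 2 - 1 ∷ 2 * b ^ 2 - 1 ∷ 2 * b ^ 2 - 1
         ∷ 2 * b ^ 4 - 3 * b ^ 2 + 1 ∷ 2 * b ^ 4 - 3 * b ^ 2 + 1 ∷ []) ∷
      (1 ∷ - 1 ∷ - 1 ∷ 2 * b ^ 2 - 1 ∷ - b ^ 2 + 1 ∷ - b ^ 2 + 1 ∷ []) ∷
      (1 ∷ - 1 + b + b * ı ∷ - 1 + b - b * ı ∷ - 1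
         ∷ (1 - b) * (1 - b * ı) ∷ (1 - b) * (1 + b * ı) ∷ []) ∷
      (1 ∷ - 1 + b - b * ı ∷ - 1 + b + b * ı ∷ - 1
         ∷ (1 - b) * (1 + b * ı) ∷ (1 - b) * (1 - b * ı) ∷ []) ∷
      (1 ∷ - 1 - b + b * ı ∷ - 1 - b - b * ı ∷ - 1
         ∷ (1 + b) * (1 - b * ı) ∷ (1 + b) * (1 + b * ı) ∷ []) ∷
      (1 ∷ - 1 - b - b * ı ∷ - 1 - b + b * ı ∷ - 1
         ∷ (1 + b) * (1 + b * ı) ∷ (1 + b) * (1 - b * ı) ∷ []) ∷
      []

    h : Polynomial 1
    h = b * con (re 2 +i (ℚ.- im 2)) * con (fromℚ (ℚ.1/ ℂ.∥ 2 ∥²))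

    Q : PolynomialMatrix
    Q =
      (1 ∷ 2 * b ^ 2 - 1
         ∷ h * (2 * b ^ 3 + 2 * b ^ 2 - b - 1) ∷ h * (2 * b ^ 3 + 2 * b ^ 2 - b - 1)
         ∷ h * (2 * b ^ 3 - 2 * b ^ 2 - b + 1) ∷ h * (2 * b ^ 3 - 2 * b ^ 2 - b + 1) ∷ []) ∷
      (1 ∷ - 1
         ∷ h * (b ^ 2 - 1 - (b ^ 2 + b) * ı) ∷ h * (b ^ 2 - 1 + (b ^ 2 + b) * ı)
         ∷ h * (1 - b ^ 2 - (b ^ 2 - b) * ı) ∷ h * (1 - b ^ 2 + (b ^ 2 - b) * ı) ∷ []) ∷
      (1 ∷ - 1
         ∷ h * (b ^ 2 - 1 + (b ^ 2 + b) * ı) ∷ h * (b ^ 2 - 1 - (b ^ 2 + b) * ı)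
         ∷ h * (1 - b ^ 2 + (b ^ 2 - b) * ı) ∷ h * (1 - b ^ 2 - (b ^ 2 - b) * ı) ∷ []) ∷
      (1 ∷ 2 * b ^ 2 - 1
         ∷ - h * (1 + b) ∷ - h * (1 + b) ∷ h * (1 - b) ∷ h * (1 - b) ∷ []) ∷
      (1 ∷ - 1
         ∷ - h * (1 + b * ı) ∷ h * (- 1 + b * ı) ∷ h * (1 + b * ı) ∷ h * (1 - b * ı) ∷ []) ∷
      (1 ∷ - 1
         ∷ h * (- 1 + b * ı) ∷ - h * (1 + b * ı) ∷ h * (1 - b * ı)
         ∷ h * (1 + b * ı) ∷ []) ∷
      []

    q sgn : Polynomial 1
    q = 2 * b ^ 2
    sgn = - 1

    w w̄ r z : Fin 6 → Polynomial 1
    w = lookup (q ∷ 0 ∷ b + b * ı ∷ b - b * ı ∷ - b + b * ı ∷ - b - b * ı ∷ [])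
    w̄ = lookup (q ∷ 0 ∷ b - b * ı ∷ b + b * ı ∷ - b - b * ı ∷ - b + b * ı ∷ [])
    r = lookup (q * q ∷ 0 ∷ 0 ∷ 0 ∷ 0 ∷ 0 ∷ [])
    z = lookup (q ∷ q ∷ 0 ∷ 0 ∷ 0 ∷ 0 ∷ [])

    eigendata : PolynomialEigendata
    eigendata = record
      { P = P ; Q = Q ; w = w ; w̄ = w̄ ; r = r ; z = z ; q = q ; sgn = sgn
      ; opposite = opposite
      ; directions = lookup (1 ℂ.+ 𝐢 ∷ 1 ℂ.- 𝐢 ∷ ℂ.- 1 ℂ.+ 𝐢 ∷ ℂ.- 1 ℂ.- 𝐢 ∷ [])
      ; constants = lookup (0 ∷ 6 ∷ 6 ∷ 6 ∷ 20 ∷ 20 ∷ [])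
      ; higher = lookup ([] ∷ (8 ∷ 2 ∷ []) ∷ (8 ∷ 2 ∷ []) ∷ (8 ∷ 2 ∷ []) ∷ (52 ∷ 45 ∷ 16 ∷ 2 ∷ []) ∷ (52 ∷ 45 ∷ 16 ∷ 2 ∷ []) ∷ [])
      ; P*Q = ≡-at-Fin² (λ j k → ∑ λ i → entry P j i * entry Q i k) (scalar (q * q)) refl
      ; row₀ = ≡-at-Fin (λ j → entry P j 0F) (λ j → 1) refl
      ; row₁ = ≡-at-Fin (λ j → entry P j 1F) (λ j → w j - 1) refl
      ; row₂ = ≡-at-Fin (λ j → entry P j 2F) (λ j → w̄ j - 1) refl
      ; row₃ = ≡-at-Fin (λ j → entry P j 3F) (λ j → z j - 1) refl
      ; row₄ = ≡-at-Fin (λ j → 2 * entry P j 4F) (λ j → w j * w j - z j - 2 * (w j - 1) - (1 + sgn) * (w̄ j - 1)) refl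
      ; rowSum = ≡-at-Fin (λ j → ∑ (entry P j)) r refl
      ; cube = ≡-at-Fin (λ k → w (suc (suc k)) * w (suc (suc k)) * w (suc (suc k))) (λ k → sgn * q * w̄ (suc (suc k))) refl
      ; norm = ≡-at-Fin (λ k → w (suc (suc k)) * w̄ (suc (suc k))) (λ k → q) refl
      ; scaled = ≡-at-Fin (λ k → w (suc (suc k))) (λ k → b * con (lookup (1 ℂ.+ 𝐢 ∷ 1 ℂ.- 𝐢 ∷ ℂ.- 1 ℂ.+ 𝐢 ∷ ℂ.- 1 ℂ.- 𝐢 ∷ []) k)) refl
      ; conj-w = ≡-at-Fin (λ j → conjᵖ (w j)) w̄ refl
      ; conj-P = ≡-at-Fin² (λ j i → conjᵖ (entry P j i)) (λ j i → entry P j (opposite i)) refl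
      ; P₀ = ≡-at-Fin (λ i → substitute (2 + b) (entry P 0F i)) (λ i → horner (suc (lookup (0 ∷ 6 ∷ 6 ∷ 6 ∷ 20 ∷ 20 ∷ []) i) ∷ lookup ([] ∷ (8 ∷ 2 ∷ []) ∷ (8 ∷ 2 ∷ []) ∷ (8 ∷ 2 ∷ []) ∷ (52 ∷ 45 ∷ 16 ∷ 2 ∷ []) ∷ (52 ∷ 45 ∷ 16 ∷ 2 ∷ []) ∷ []) i)) refl
      }
      where
      opposite : Fin 6 → Fin 6
      opposite = lookup (0F ∷ 2F ∷ 1F ∷ 3F ∷ 5F ∷ 4F ∷ [])

  module EvenPolynomials where

    P : PolynomialMatrix
    P =
      (1 ∷ 4 * b ^ 2 - 1 ∷ 4 * b ^ 2 - 1 ∷ 4 * b ^ 2 - 1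
         ∷ 8 * b ^ 4 - 10 * b ^ 2 + 2 ∷ 8 * b ^ 4 - 2 * b ^ 2 ∷ []) ∷
      (1 ∷ - 1 ∷ - 1 ∷ 4 * b ^ 2 - 1 ∷ - 2 * b ^ 2 + 2 ∷ - 2 * b ^ 2 ∷ []) ∷
      (1 ∷ 2 * b - 1 ∷ 2 * b - 1 ∷ - 1 ∷ 2 * b ^ 2 - 4 * b + 2 ∷ - 2 * b ^ 2 ∷ []) ∷
      (1 ∷ - 2 * b - 1 ∷ - 2 * b - 1 ∷ - 1 ∷ 2 * b ^ 2 + 4 * b + 2 ∷ - 2 * b ^ 2 ∷ []) ∷
      (1 ∷ - 1 + 2 * b * ı ∷ - 1 - 2 * b * ı ∷ - 1 ∷ - 2 * b ^ 2 + 2 ∷ 2 * b ^ 2 ∷ []) ∷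
      (1 ∷ - 1 - 2 * b * ı ∷ - 1 + 2 * b * ı ∷ - 1 ∷ - 2 * b ^ 2 + 2 ∷ 2 * b ^ 2 ∷ []) ∷
      []

    Q : PolynomialMatrix
    Q =
      (1 ∷ 4 * b ^ 2 - 1
         ∷ b * (4 * b ^ 3 + 4 * b ^ 2 - b - 1) ∷ b * (4 * b ^ 3 - 4 * b ^ 2 - b + 1)
         ∷ b ^ 2 * (4 * b ^ 2 - 1) ∷ b ^ 2 * (4 * b ^ 2 - 1) ∷ []) ∷
      (1 ∷ - 1
         ∷ b * (2 * b ^ 2 + b - 1) ∷ - (2 * b ^ 2 - b - 1) * b
         ∷ - b ^ 2 * (1 + 2 * b * ı) ∷ b ^ 2 * (- 1 + 2 * b * ı) ∷ []) ∷
      (1 ∷ - 1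
         ∷ b * (2 * b ^ 2 + b - 1) ∷ - (2 * b ^ 2 - b - 1) * b
         ∷ b ^ 2 * (- 1 + 2 * b * ı) ∷ - b ^ 2 * (1 + 2 * b * ı) ∷ []) ∷
      (1 ∷ 4 * b ^ 2 - 1
         ∷ - b * (1 + b) ∷ - b * (- 1 + b) ∷ - b ^ 2 ∷ - b ^ 2 ∷ []) ∷
      (1 ∷ - 1
         ∷ b * (- 1 + b) ∷ b * (1 + b) ∷ - b ^ 2 ∷ - b ^ 2 ∷ []) ∷
      (1 ∷ - 1
         ∷ - b * (1 + b) ∷ - b * (- 1 + b) ∷ b ^ 2 ∷ b ^ 2 ∷ []) ∷
      []

    q sgn : Polynomial 1
    q = 4 * b ^ 2
    sgn = 1

    w w̄ r z : Fin 6 → Polynomial 1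
    w = lookup (q ∷ 0 ∷ 2 * b ∷ - (2 * b) ∷ 2 * b * ı ∷ - (2 * b * ı) ∷ [])
    w̄ = lookup (q ∷ 0 ∷ 2 * b ∷ - (2 * b) ∷ - (2 * b * ı) ∷ 2 * b * ı ∷ [])
    r = lookup (q * q ∷ 0 ∷ 0 ∷ 0 ∷ 0 ∷ 0 ∷ [])
    z = lookup (q ∷ q ∷ 0 ∷ 0 ∷ 0 ∷ 0 ∷ [])

    eigendata : PolynomialEigendata
    eigendata = record
      { P = P ; Q = Q ; w = w ; w̄ = w̄ ; r = r ; z = z ; q = q ; sgn = sgn
      ; opposite = opposite
      ; directions = lookup (2 ∷ ℂ.- 2 ∷ 2 ℂ.* 𝐢 ∷ ℂ.- (2 ℂ.* 𝐢) ∷ [])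
      ; constants = lookup (0 ∷ 14 ∷ 14 ∷ 14 ∷ 89 ∷ 119 ∷ [])
      ; higher = lookup ([] ∷ (16 ∷ 4 ∷ []) ∷ (16 ∷ 4 ∷ []) ∷ (16 ∷ 4 ∷ []) ∷ (216 ∷ 182 ∷ 64 ∷ 8 ∷ []) ∷ (248 ∷ 190 ∷ 64 ∷ 8 ∷ []) ∷ [])
      ; P*Q = ≡-at-Fin² (λ j k → ∑ λ i → entry P j i * entry Q i k) (scalar (q * q)) refl
      ; row₀ = ≡-at-Fin (λ j → entry P j 0F) (λ j → 1) refl
      ; row₁ = ≡-at-Fin (λ j → entry P j 1F) (λ j → w j - 1) refl
      ; row₂ = ≡-at-Fin (λ j → entry P j 2F) (λ j → w̄ j - 1) refl
      ; row₃ = ≡-at-Fin (λ j → entry P j 3F) (λ j → z j - 1) refl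
      ; row₄ = ≡-at-Fin (λ j → 2 * entry P j 4F) (λ j → w j * w j - z j - 2 * (w j - 1) - (1 + sgn) * (w̄ j - 1)) refl
      ; rowSum = ≡-at-Fin (λ j → ∑ (entry P j)) r refl
      ; cube = ≡-at-Fin (λ k → w (suc (suc k)) * w (suc (suc k)) * w (suc (suc k))) (λ k → sgn * q * w̄ (suc (suc k))) refl
      ; norm = ≡-at-Fin (λ k → w (suc (suc k)) * w̄ (suc (suc k))) (λ k → q) refl
      ; scaled = ≡-at-Fin (λ k → w (suc (suc k))) (λ k → b * con (lookup (2 ∷ ℂ.- 2 ∷ 2 ℂ.* 𝐢 ∷ ℂ.- (2 ℂ.* 𝐢) ∷ []) k)) refl
      ; conj-w = ≡-at-Fin (λ j → conjᵖ (w j)) w̄ refl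
      ; conj-P = ≡-at-Fin² (λ j i → conjᵖ (entry P j i)) (λ j i → entry P j (opposite i)) refl
      ; P₀ = ≡-at-Fin (λ i → substitute (2 + b) (entry P 0F i)) (λ i → horner (suc (lookup (0 ∷ 14 ∷ 14 ∷ 14 ∷ 89 ∷ 119 ∷ []) i) ∷ lookup ([] ∷ (16 ∷ 4 ∷ []) ∷ (16 ∷ 4 ∷ []) ∷ (16 ∷ 4 ∷ []) ∷ (216 ∷ 182 ∷ 64 ∷ 8 ∷ []) ∷ (248 ∷ 190 ∷ 64 ∷ 8 ∷ []) ∷ []) i)) refl
      }
      where
      opposite : Fin 6 → Fin 6
      opposite = lookup (0F ∷ 2F ∷ 1F ∷ 3F ∷ 4F ∷ 5F ∷ [])

  Q-odd : ∀ m j i → Values.entry (evaluate OddPolynomials.Q (fromℕ m)) j i ≡ Values.entry (Values.Odd.Q (fromℕ m)) j i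
  Q-odd m 0F i  = refl
  Q-odd m 1F i  = refl
  Q-odd m 2F i  = refl
  Q-odd m 3F i  = refl
  Q-odd m 4F i  = refl
  Q-odd m 5F 0F = refl
  Q-odd m 5F 1F = refl
  Q-odd m 5F 2F = refl
  Q-odd m 5F 3F = refl
  Q-odd m 5F 4F = refl
  Q-odd m 5F 5F = ÷-unique {(OddPolynomials.h * (1 + b * ı)) at x} denominator≢0
    (≡-at (OddPolynomials.h * (1 + b * ı) * (2 * (1 - b * ı))) (b * (b ^ 2 + 1)) refl x)
    where
    x : ℚ[i]
    x = fromℕ m
    denominator≢0 : (2 * (1 - b * ı)) at x ≢ ℂ.0#
    denominator≢0 eq = ℚ[i]-Domain.fromℕ≢0 {2 ℕ.* (1 ℕ.+ m ℕ.* m)} (λ ()) (begin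
      fromℕ (2 ℕ.* (1 ℕ.+ m ℕ.* m))                ≡⟨ fromℕ-* 2 (1 ℕ.+ m ℕ.* m) ⟩
      fromℕ 2 ℂ.* fromℕ (1 ℕ.+ m ℕ.* m)            ≡⟨ cong (fromℕ 2 ℂ.*_) (trans (fromℕ-+ 1 (m ℕ.* m)) (cong (ℂ.1# ℂ.+_) (fromℕ-* m m))) ⟩
      (2 * (1 + b * b)) at x                         ≡⟨ ≡-at (2 * (1 + b * b)) (2 * (1 - b * ı) * (1 + b * ı)) refl x ⟩
      (2 * (1 - b * ı)) at x ℂ.* (1 + b * ı) at x    ≡⟨ cong (ℂ._* (1 + b * ı) at x) eq ⟩
      ℂ.0# ℂ.* (1 + b * ı) at x                      ≡⟨ Summation.0*z ((1 + b * ı) at x) ⟩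
      ℂ.0#                                           ∎)
      where
      open ≡-Reasoning
      open ℚ[i]-Properties using (fromℕ-*; fromℕ-+)

module SumsOfTwoSquares where
  open ≡ using (refl; sym; trans)
  open ℕSolver.+-*-Solver

  even⊎odd : ∀ n → ∃ λ k → n ≡ 2 ℕ.* k ⊎ n ≡ 1 ℕ.+ 2 ℕ.* k
  even⊎odd zero = 0 , inj₁ refl
  even⊎odd (suc n) with even⊎odd n
  ... | k , inj₁ refl = k , inj₂ refl
  ... | k , inj₂ refl = suc k , inj₁ (cong suc (sym (ℕ.+-suc k (k ℕ.+ 0))))

  even≢odd : ∀ j k → 2 ℕ.* j ≢ 1 ℕ.+ 2 ℕ.* k
  even≢odd = ℕ.even≢odd

  descend : ∀ A B C → A ℕ.* A ℕ.+ B ℕ.* B ≡ 4 ℕ.* C →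
            ∃₂ λ a b → A ≡ 2 ℕ.* a × B ≡ 2 ℕ.* b × a ℕ.* a ℕ.+ b ℕ.* b ≡ C
  descend A B C eq with even⊎odd A | even⊎odd B
  ... | a , inj₁ refl | b , inj₁ refl = a , b , refl , refl , ℕ.*-cancelˡ-≡ (a ℕ.* a ℕ.+ b ℕ.* b) C 4 (trans
    (solve 2 (λ a b → con 4 :* (a :* a :+ b :* b) := con 2 :* a :* (con 2 :* a) :+ con 2 :* b :* (con 2 :* b)) refl a b) eq)
  ... | a , inj₁ refl | b , inj₂ refl = contradiction (trans
    (solve 1 (λ C → con 2 :* (con 2 :* C) := con 4 :* C) refl C) (trans (sym eq)
    (solve 2 (λ a b → con 2 :* a :* (con 2 :* a) :+ (con 1 :+ con 2 :* b) :* (con 1 :+ con 2 :* b)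
      := con 1 :+ con 2 :* (con 2 :* (a :* a) :+ con 2 :* (b :* b :+ b))) refl a b))) (even≢odd (2 ℕ.* C) (2 ℕ.* (a ℕ.* a) ℕ.+ 2 ℕ.* (b ℕ.* b ℕ.+ b)))
  ... | a , inj₂ refl | b , inj₁ refl = contradiction (trans
    (solve 1 (λ C → con 2 :* (con 2 :* C) := con 4 :* C) refl C) (trans (sym eq)
    (solve 2 (λ b a → (con 1 :+ con 2 :* b) :* (con 1 :+ con 2 :* b) :+ con 2 :* a :* (con 2 :* a)
      := con 1 :+ con 2 :* (con 2 :* (a :* a) :+ con 2 :* (b :* b :+ b))) refl a b))) (even≢odd (2 ℕ.* C) (2 ℕ.* (b ℕ.* b) ℕ.+ 2 ℕ.* (a ℕ.* a ℕ.+ a)))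
  ... | a , inj₂ refl | b , inj₂ refl = contradiction (ℕ.*-cancelˡ-≡ (2 ℕ.* C) (1 ℕ.+ 2 ℕ.* (b ℕ.* b ℕ.+ b ℕ.+ a ℕ.* a ℕ.+ a)) 2 (trans
    (solve 1 (λ C → con 2 :* (con 2 :* C) := con 4 :* C) refl C) (trans (sym eq)
    (solve 2 (λ b a → (con 1 :+ con 2 :* b) :* (con 1 :+ con 2 :* b) :+ (con 1 :+ con 2 :* a) :* (con 1 :+ con 2 :* a)
      := con 2 :* (con 1 :+ con 2 :* (a :* a :+ a :+ b :* b :+ b))) refl a b)))) (even≢odd C (b ℕ.* b ℕ.+ b ℕ.+ a ℕ.* a ℕ.+ a))

  private
    4^ : ∀ l → 2 ℕ.^ (2 ℕ.+ l) ≡ 4 ℕ.* 2 ℕ.^ l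
    4^ l = sym (ℕ.*-assoc 2 2 (2 ℕ.^ l))

    *≡0 : ∀ B → B ℕ.* B ≡ 0 → B ≡ 0
    *≡0 zero _ = refl

    *≡1 : ∀ B → B ℕ.* B ≡ 1 → B ≡ 1
    *≡1 1 _ = refl

  even-case : ∀ l A B → A ℕ.* A ℕ.+ B ℕ.* B ≡ 2 ℕ.^ (l ℕ.* 2) →
              (A ≡ 2 ℕ.^ l × B ≡ 0) ⊎ (A ≡ 0 × B ≡ 2 ℕ.^ l)
  even-case zero 0 B eq = inj₂ (refl , *≡1 B eq)
  even-case zero 1 B eq = inj₁ (refl , *≡0 B (ℕ.suc-injective eq))
  even-case (suc l) A B eq with a , b , refl , refl , eq′ ← descend A B (2 ℕ.^ (l ℕ.* 2)) (trans eq (4^ (l ℕ.* 2)))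
    with even-case l a b eq′
  ... | inj₁ (refl , refl) = inj₁ (refl , refl)
  ... | inj₂ (refl , refl) = inj₂ (refl , refl)

  odd-case : ∀ l A B → A ℕ.* A ℕ.+ B ℕ.* B ≡ 2 ℕ.^ (1 ℕ.+ l ℕ.* 2) → A ≡ 2 ℕ.^ l × B ≡ 2 ℕ.^ l
  odd-case zero 1 B eq = refl , *≡1 B (ℕ.suc-injective eq)
  odd-case zero 0 (suc (suc B)) eq with () ← ℕ.m+n≡0⇒n≡0 B (ℕ.suc-injective (ℕ.suc-injective eq))
  odd-case zero (suc (suc A)) B eq with () ← ℕ.m+n≡0⇒n≡0 A (ℕ.m+n≡0⇒m≡0 _ (ℕ.suc-injective (ℕ.suc-injective eq)))
  odd-case (suc l) A B eq with a , b , refl , refl , eq′ ← descend A B (2 ℕ.^ (1 ℕ.+ l ℕ.* 2)) (trans eq (4^ (1 ℕ.+ l ℕ.* 2)))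
    with refl , refl ← odd-case l a b eq′ = refl , refl

module GaussianIntegers where
  open ≡ using (refl; sym; trans)
  open ℚ[i]-Properties
  open SumsOfTwoSquares

  IsGaussian : ℚ[i] → Set
  IsGaussian z = ∃₂ λ a b → z ≡ fromℤ a +i fromℤ b

  IsGaussian-+ : ∀ {z w} → IsGaussian z → IsGaussian w → IsGaussian (z ℂ.+ w)
  IsGaussian-+ (a , b , refl) (c , d , refl) = a ℤ.+ c , b ℤ.+ d , sym (ext (fromℤ-+ a c) (fromℤ-+ b d))

  IsGaussian-sum : ∀ {n} (f : Fin n → ℚ[i]) → (∀ k → IsGaussian (f k)) → IsGaussian (ℂ.sum f)
  IsGaussian-sum {zero}  f g = + 0 , + 0 , refl
  IsGaussian-sum {suc n} f g = IsGaussian-+ {f zero} {ℂ.sum (f ∘ suc)} (g zero) (IsGaussian-sum (f ∘ suc) (g ∘ suc))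

  IsGaussian-0 : IsGaussian ℂ.0#
  IsGaussian-0 = + 0 , + 0 , refl

  IsGaussian-𝐢^ : ∀ (k : Fin 4) → IsGaussian (𝐢 ℂ.^ Fin.toℕ k)
  IsGaussian-𝐢^ 0F = + 1 , + 0 , refl
  IsGaussian-𝐢^ 1F = + 0 , + 1 , refl
  IsGaussian-𝐢^ 2F = -[1+ 0 ] , + 0 , refl
  IsGaussian-𝐢^ 3F = + 0 , -[1+ 0 ] , refl

  ∣a∣*∣a∣ : ∀ a → a ℤ.* a ≡ + (ℤ.∣ a ∣ ℕ.* ℤ.∣ a ∣)
  ∣a∣*∣a∣ (+ a)    = sym (ℤ.pos-* a a)
  ∣a∣*∣a∣ -[1+ a ] = refl

  norm-ℕ : ∀ a b {N} → (fromℤ a +i fromℤ b) ℂ.* conj (fromℤ a +i fromℤ b) ≡ fromℕ N →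
           ℤ.∣ a ∣ ℕ.* ℤ.∣ a ∣ ℕ.+ ℤ.∣ b ∣ ℕ.* ℤ.∣ b ∣ ≡ N
  norm-ℕ a b {N} eq = ℤ.+-injective (fromℤ-injective (begin
    fromℤ (+ (ℤ.∣ a ∣ ℕ.* ℤ.∣ a ∣) ℤ.+ + (ℤ.∣ b ∣ ℕ.* ℤ.∣ b ∣))
      ≡⟨ cong₂ (λ x y → fromℤ (x ℤ.+ y)) (∣a∣*∣a∣ a) (∣a∣*∣a∣ b) ⟨
    fromℤ (a ℤ.* a ℤ.+ b ℤ.* b)
      ≡⟨ trans (fromℤ-+ (a ℤ.* a) (b ℤ.* b)) (cong₂ ℚ._+_ (fromℤ-* a a) (fromℤ-* b b)) ⟩
    ℂ.∥ fromℤ a +i fromℤ b ∥²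
      ≡⟨ cong re (trans (sym (z*conj-z (fromℤ a +i fromℤ b))) eq) ⟩
    fromℤ (+ N) ∎))
    where open ≡-Reasoning

  ±∣a∣ : ∀ a {c} → ℤ.∣ a ∣ ≡ c → a ≡ + c ⊎ a ≡ ℤ.- (+ c)
  ±∣a∣ (+ a)    refl = inj₁ refl
  ±∣a∣ -[1+ a ] refl = inj₂ refl

  ±fromℤ : ∀ a {c} → ℤ.∣ a ∣ ≡ c → fromℤ a ≡ fromℤ (+ c) ⊎ fromℤ a ≡ ℚ.- fromℤ (+ c)
  ±fromℤ a {c} eq with ±∣a∣ a eq
  ... | inj₁ refl = inj₁ refl
  ... | inj₂ refl = inj₂ (fromℤ-neg (+ c))

module UnitVectors where
  open ≡ using (refl; sym; trans)
  open ℚ[i]-Properties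

  fromℕ-^ : ∀ a k → fromℕ a ℂ.^ k ≡ fromℕ (a ℕ.^ k)
  fromℕ-^ a zero    = refl
  fromℕ-^ a (suc k) = trans (cong (fromℕ a ℂ.*_) (fromℕ-^ a k)) (sym (fromℕ-* a (a ℕ.^ k)))

  v-odd : ∀ n c → n % 2 ≡ 1 → fromℕ 2 ℂ.^ ((n ℕ.∸ 1) / 2) ≡ c → ∀ k →
    Values.v n k ≡ lookup (c ℂ.+ c ℂ.* 𝐢 ∷ c ℂ.- c ℂ.* 𝐢 ∷ ℂ.- c ℂ.+ c ℂ.* 𝐢 ∷ ℂ.- c ℂ.- c ℂ.* 𝐢 ∷ []) k
  v-odd n c odd refl k with n % 2
  ... | suc _ = refl

  v-even : ∀ n c → n % 2 ≡ 0 → fromℕ 2 ℂ.^ (n / 2) ≡ c → ∀ k →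
    Values.v n k ≡ lookup (c ∷ ℂ.- c ∷ c ℂ.* 𝐢 ∷ ℂ.- (c ℂ.* 𝐢) ∷ []) k
  v-even n c even refl k with n % 2
  ... | zero = refl

-- The values at D, R and Z of the characters in each of the classes 𝓔 j.
module ClassValues (n : ℕ) where
  q : ℚ[i]
  q = fromℕ (2 ℕ.^ n)

  w r z : Fin 6 → ℚ[i]
  w 0F            = q
  w 1F            = ℂ.0#
  w (suc (suc k)) = Values.v n k
  r = lookup (q ℂ.* q ∷ ℂ.0# ∷ ℂ.0# ∷ ℂ.0# ∷ ℂ.0# ∷ ℂ.0# ∷ [])
  z = lookup (q ∷ q ∷ ℂ.0# ∷ ℂ.0# ∷ ℂ.0# ∷ ℂ.0# ∷ [])

module _ (n : ℕ) (P Q : Values.SquareMatrix) where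
  open ℚ[i]-Properties using (conj)
  open GaussianIntegers using (IsGaussian)
  open Summation using (𝟙)
  open ClassValues n

  -- The sign is that of the identity χ(D)³ = ± 2ⁿ conj χ(D), valid for the
  -- characters χ that are nontrivial on Z.
  record Eigendata : Set where
    field
      sgn         : ℚ[i]
      sgn≡±1      : sgn ≡ ℂ.1# ⊎ sgn ≡ ℂ.- ℂ.1#
      opposite    : Fin 6 → Fin 6
      P*Q         : ∀ j k → ℂ.sum (λ i → Values.entry P j i ℂ.* Values.entry Q i k) ≡ 𝟙 (j Fin.≟ k) ℂ.* (q ℂ.* q)
      row₀        : ∀ j → Values.entry P j 0F ≡ ℂ.1#
      row₁        : ∀ j → Values.entry P j 1F ≡ w j ℂ.- ℂ.1#
      row₂        : ∀ j → Values.entry P j 2F ≡ conj (w j) ℂ.- ℂ.1#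
      row₃        : ∀ j → Values.entry P j 3F ≡ z j ℂ.- ℂ.1#
      row₄        : ∀ j → fromℕ 2 ℂ.* Values.entry P j 4F ≡
                    w j ℂ.* w j ℂ.- z j ℂ.- fromℕ 2 ℂ.* (w j ℂ.- ℂ.1#) ℂ.- (ℂ.1# ℂ.+ sgn) ℂ.* (conj (w j) ℂ.- ℂ.1#)
      rowSum      : ∀ j → ℂ.sum (Values.entry P j) ≡ r j
      cube        : ∀ k → Values.v n k ℂ.* Values.v n k ℂ.* Values.v n k ≡ sgn ℂ.* q ℂ.* conj (Values.v n k)
      conj-P      : ∀ j i → conj (Values.entry P j i) ≡ Values.entry P j (opposite i)
      classify    : ∀ x → IsGaussian x → x ℂ.* conj x ≡ q → ∃ λ k → x ≡ Values.v n k
      w-injective : ∀ {j k} → w j ≡ w k → j ≡ k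
      P₀≢0        : 3 ℕ.≤ n → ∀ i → Values.entry P 0F i ≢ ℂ.0#

module EigendataConstruction where
  open ≡ using (refl; sym; trans)
  open ℚ[i]-Properties
  open ℚ[i]-Domain
  open GaussianIntegers
  open SumsOfTwoSquares
  open UnitVectors
  open Summation using (𝟙; 0*z; 1*z; sum-cong-≗)
  open EigenmatrixPolynomials using
    (PolynomialEigendata; _at_; ∑-at; entry-evaluate; evaluate; scalar; hornerℕ; horner-at; substitute-at; conj-at;
     module OddPolynomials; module EvenPolynomials)
  private module E = EigenmatrixPolynomials

  2^≢0 : ∀ k → 2 ℕ.^ k ≢ 0
  2^≢0 k eq = contradiction (ℕ.m^n≡0⇒m≡0 2 k eq) λ ()

  fromPolynomials : ∀ n′ l (d : PolynomialEigendata) {P′ Q′} →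
    let open PolynomialEigendata d
        n = suc n′
        x = fromℕ (2 ℕ.^ l) in
    (∀ j i → Values.entry (evaluate P x) j i ≡ Values.entry P′ j i) →
    (∀ j i → Values.entry (evaluate Q x) j i ≡ Values.entry Q′ j i) →
    sgn at x ≡ ℂ.1# ⊎ sgn at x ≡ ℂ.- ℂ.1# →
    q at x ≡ fromℕ (2 ℕ.^ n) →
    w 0F at x ≡ q at x → w 1F at x ≡ ℂ.0# → (∀ k → w (suc (suc k)) at x ≡ Values.v n k) →
    (∀ j → r j at x ≡ lookup (q at x ℂ.* q at x ∷ ℂ.0# ∷ ℂ.0# ∷ ℂ.0# ∷ ℂ.0# ∷ ℂ.0# ∷ []) j) →
    (∀ j → z j at x ≡ lookup (q at x ∷ q at x ∷ ℂ.0# ∷ ℂ.0# ∷ ℂ.0# ∷ ℂ.0# ∷ []) j) →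
    (∀ j k → directions j ≡ directions k → j ≡ k) →
    (∀ y → IsGaussian y → y ℂ.* conj y ≡ fromℕ (2 ℕ.^ n) → ∃ λ k → y ≡ Values.v n k) →
    (3 ℕ.≤ n → 1 ℕ.≤ l) →
    Eigendata n P′ Q′
  fromPolynomials n′ l d {P′} {Q′} P≡ Q≡ sgn≡±1 q≡ w₀ w₁ w₂₊ r≡ z≡ directions-injective classify 1≤l = record
    { sgn = sgn at x
    ; sgn≡±1 = sgn≡±1
    ; opposite = opposite
    ; P*Q = λ j k → begin
        ℂ.sum (λ i → Values.entry P′ j i ℂ.* Values.entry Q′ i k)
          ≡⟨ sum-cong-≗ (λ i → cong₂ ℂ._*_ (entry-P j i) (entry-Q i k)) ⟨
        ℂ.sum (λ i → E.entry P j i at x ℂ.* E.entry Q i k at x)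
          ≡⟨ ∑-at (λ i → E.entry P j i E.* E.entry Q i k) x ⟨
        E.∑ (λ i → E.entry P j i E.* E.entry Q i k) at x
          ≡⟨ P*Q j k x ⟩
        scalar (q E.* q) j k at x
          ≡⟨ scalar-at j k ⟩
        𝟙 (j Fin.≟ k) ℂ.* (qₙ ℂ.* qₙ) ∎
    ; row₀ = λ j → trans (sym (entry-P j 0F)) (row₀ j x)
    ; row₁ = λ j → trans (sym (entry-P j 1F)) (trans (row₁ j x) (cong (ℂ._- ℂ.1#) (w≡ j)))
    ; row₂ = λ j → trans (sym (entry-P j 2F)) (trans (row₂ j x) (cong (ℂ._- ℂ.1#) (w̄≡ j)))
    ; row₃ = λ j → trans (sym (entry-P j 3F)) (trans (row₃ j x) (cong (ℂ._- ℂ.1#) (z≡′ j)))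
    ; row₄ = λ j → trans (cong (fromℕ 2 ℂ.*_) (sym (entry-P j 4F))) (trans (row₄ j x)
        (cong₂ (λ w′ u → w′ ℂ.- fromℕ 2 ℂ.* (u ℂ.- ℂ.1#) ℂ.- (ℂ.1# ℂ.+ sgn at x) ℂ.* (w̄ j at x ℂ.- ℂ.1#))
          (cong₂ (λ u t → u ℂ.* u ℂ.- t) (w≡ j) (z≡′ j)) (w≡ j)
         ∙ cong (λ u → W j ℂ.* W j ℂ.- Z j ℂ.- fromℕ 2 ℂ.* (W j ℂ.- ℂ.1#) ℂ.- (ℂ.1# ℂ.+ sgn at x) ℂ.* (u ℂ.- ℂ.1#)) (w̄≡ j)))
    ; rowSum = λ j → trans (sum-cong-≗ λ i → sym (entry-P j i)) (trans (sym (∑-at (E.entry P j) x))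
        (trans (rowSum j x) (trans (r≡ j) (cong (λ t → lookup (t ℂ.* t ∷ ℂ.0# ∷ ℂ.0# ∷ ℂ.0# ∷ ℂ.0# ∷ ℂ.0# ∷ []) j) q≡))))
    ; cube = λ k → subst₂ (λ u ū → u ℂ.* u ℂ.* u ≡ sgn at x ℂ.* qₙ ℂ.* ū) (w₂₊ k) (w̄≡ (suc (suc k)))
        (trans (cube k x) (cong (λ t → sgn at x ℂ.* t ℂ.* w̄ (suc (suc k)) at x) q≡))
    ; conj-P = λ j i → trans (cong conj (sym (entry-P j i))) (trans (conj-at (E.entry P j i) {x} refl)
        (trans (conj-P j i x) (entry-P j (opposite i))))
    ; classify = classify
    ; w-injective = λ {j} {k} → w-injective j k
    ; P₀≢0 = P₀≢0
    }
    where
    open PolynomialEigendata d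
    open ≡-Reasoning
    infixr 5 _∙_
    _∙_ : ∀ {A : Set} {a b c : A} → a ≡ b → b ≡ c → a ≡ c
    _∙_ = trans

    n : ℕ
    n = suc n′

    x : ℚ[i]
    x = fromℕ (2 ℕ.^ l)

    open ClassValues n using () renaming (q to qₙ; w to W; z to Z)

    entry-P : ∀ j i → E.entry P j i at x ≡ Values.entry P′ j i
    entry-P j i = trans (entry-evaluate P x j i) (P≡ j i)

    entry-Q : ∀ j i → E.entry Q j i at x ≡ Values.entry Q′ j i
    entry-Q j i = trans (entry-evaluate Q x j i) (Q≡ j i)

    scalar-at : ∀ j k → scalar (q E.* q) j k at x ≡ 𝟙 (j Fin.≟ k) ℂ.* (qₙ ℂ.* qₙ)
    scalar-at j k = lemma (j Fin.≟ k)
      where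
      lemma : (e : Dec (j ≡ k)) → (if does e then q E.* q else E.con ℂ.0#) at x ≡ 𝟙 e ℂ.* (qₙ ℂ.* qₙ)
      lemma (yes _) = trans (cong₂ ℂ._*_ q≡ q≡) (sym (1*z (qₙ ℂ.* qₙ)))
      lemma (no _)  = sym (0*z (qₙ ℂ.* qₙ))

    z≡′ : ∀ j → z j at x ≡ Z j
    z≡′ j = trans (z≡ j) (cong (λ t → lookup (t ∷ t ∷ ℂ.0# ∷ ℂ.0# ∷ ℂ.0# ∷ ℂ.0# ∷ []) j) q≡)

    w≡ : ∀ j → w j at x ≡ W j
    w≡ 0F            = trans w₀ q≡
    w≡ 1F            = w₁
    w≡ (suc (suc k)) = w₂₊ k

    w̄≡ : ∀ j → w̄ j at x ≡ conj (W j)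
    w̄≡ j = trans (sym (conj-w j x)) (trans (sym (conj-at (w j) {x} refl)) (cong conj (w≡ j)))

    qₙ≢0 : qₙ ≢ ℂ.0#
    qₙ≢0 = fromℕ≢0 (2^≢0 n)

    norm-v : ∀ k → Values.v n k ℂ.* conj (Values.v n k) ≡ qₙ
    norm-v k = subst₂ (λ u ū → u ℂ.* ū ≡ qₙ) (w₂₊ k) (w̄≡ (suc (suc k))) (trans (norm k x) q≡)

    v≢0 : ∀ k → Values.v n k ≢ ℂ.0#
    v≢0 k eq = qₙ≢0 (trans (sym (norm-v k)) (trans (cong (λ u → u ℂ.* conj u) eq) refl))

    v≢qₙ : ∀ k → Values.v n k ≢ qₙ
    v≢qₙ k eq = contradiction (ℕ.m^n≡1⇒n≡0∨m≡1 2 n 2^n≡1) λ { (inj₁ ()) ; (inj₂ ()) }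
      where
      2^n≡1 : 2 ℕ.^ n ≡ 1
      2^n≡1 = fromℕ-injective (*-cancelˡ {qₙ} qₙ ℂ.1# qₙ≢0
        (trans (trans (cong (λ u → u ℂ.* conj u) (sym eq)) (norm-v k)) (trans (sym (1*z qₙ)) (*-comm ℂ.1# qₙ))))

    w-injective : ∀ j k → W j ≡ W k → j ≡ k
    w-injective 0F 0F _ = refl
    w-injective 0F 1F eq = contradiction eq qₙ≢0
    w-injective 0F (suc (suc k)) eq = contradiction (sym eq) (v≢qₙ k)
    w-injective 1F 0F eq = contradiction (sym eq) qₙ≢0
    w-injective 1F 1F eq = refl
    w-injective 1F (suc (suc k)) eq = contradiction (sym eq) (v≢0 k)
    w-injective (suc (suc j)) 0F eq = contradiction eq (v≢qₙ j)
    w-injective (suc (suc j)) 1F eq = contradiction eq (v≢0 j)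
    w-injective (suc (suc j)) (suc (suc k)) eq = cong (λ i → suc (suc i)) (directions-injective j k
      (*-cancelˡ {x} (directions j) (directions k) (fromℕ≢0 (2^≢0 l))
        (trans (sym (scaled j x)) (trans (trans (w₂₊ j) (trans eq (sym (w₂₊ k)))) (scaled k x)))))

    P₀≢0 : 3 ℕ.≤ n → ∀ i → Values.entry P′ 0F i ≢ ℂ.0#
    P₀≢0 3≤n i eq = fromℕ≢0 {hornerℕ (suc (constants i) ∷ higher i) k} (λ ()) (begin
      fromℕ (hornerℕ (suc (constants i) ∷ higher i) k)
        ≡⟨ horner-at (suc (constants i) ∷ higher i) k ⟨
      E.horner (suc (constants i) ∷ higher i) at fromℕ k
        ≡⟨ P₀ i (fromℕ k) ⟨
      E.substitute (E.con (fromℕ 2) E.+ E.b) (E.entry P 0F i) at fromℕ k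
        ≡⟨ substitute-at (E.con (fromℕ 2) E.+ E.b) (E.entry P 0F i) (fromℕ k) ⟩
      E.entry P 0F i at (fromℕ 2 ℂ.+ fromℕ k)
        ≡⟨ cong (E.entry P 0F i at_) (trans (sym (fromℕ-+ 2 k)) (cong fromℕ 2+k≡)) ⟩
      E.entry P 0F i at x
        ≡⟨ trans (entry-P 0F i) eq ⟩
      ℂ.0# ∎)
      where
      k : ℕ
      k = 2 ℕ.^ l ℕ.∸ 2
      2+k≡ : 2 ℕ.+ k ≡ 2 ℕ.^ l
      2+k≡ = ℕ.m+[n∸m]≡n (ℕ.^-monoʳ-≤ 2 (1≤l 3≤n))

  private
    module ℚS = ℚSolver.+-*-Solver
    open ℚS using (_:=_; _:+_; _:*_; _:-_; :-_)

    2^[l*2]≡ : ∀ l → fromℕ (2 ℕ.^ (l ℕ.* 2)) ≡ fromℕ (2 ℕ.^ l) ℂ.* (fromℕ (2 ℕ.^ l) ℂ.* ℂ.1#)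
    2^[l*2]≡ l = trans (cong fromℕ (sym (ℕ.^-*-assoc 2 l 2))) (sym (fromℕ-^ (2 ℕ.^ l) 2))

    [1+l*2]%2≡1 : ∀ l → (1 ℕ.+ l ℕ.* 2) % 2 ≡ 1
    [1+l*2]%2≡1 l = [m+kn]%n≡m%n 1 l 2

    [2+l*2]%2≡0 : ∀ l → (2 ℕ.+ l ℕ.* 2) % 2 ≡ 0
    [2+l*2]%2≡0 l = m*n%n≡0 (suc l) 2

    directions-injective : PolynomialEigendata → Set
    directions-injective d = ∀ j k → directions j ≡ directions k → j ≡ k
      where open PolynomialEigendata d

    odd-directions : directions-injective OddPolynomials.eigendata
    odd-directions = from-yes (Fin.all? λ j → Fin.all? λ k → (directions j ≟ directions k) →-dec (j Fin.≟ k))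
      where open PolynomialEigendata OddPolynomials.eigendata

    even-directions : directions-injective EvenPolynomials.eigendata
    even-directions = from-yes (Fin.all? λ j → Fin.all? λ k → (directions j ≟ directions k) →-dec (j Fin.≟ k))
      where open PolynomialEigendata EvenPolynomials.eigendata

  eigendata-odd : ∀ l → let x = fromℕ (2 ℕ.^ l) in
                  Eigendata (1 ℕ.+ l ℕ.* 2) (Values.Odd.P x) (Values.Odd.Q x)
  eigendata-odd l = fromPolynomials (l ℕ.* 2) l OddPolynomials.eigendata
    (λ j i → refl) (E.Q-odd (2 ℕ.^ l)) (inj₂ refl)
    (sym (trans (fromℕ-* 2 (2 ℕ.^ (l ℕ.* 2))) (cong (fromℕ 2 ℂ.*_) (2^[l*2]≡ l))))
    refl refl w₂₊
    (λ { 0F → refl ; 1F → refl ; 2F → refl ; 3F → refl ; 4F → refl ; 5F → refl })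
    (λ { 0F → refl ; 1F → refl ; 2F → refl ; 3F → refl ; 4F → refl ; 5F → refl })
    odd-directions
    (λ { _ (a , b , refl) norm → classify a b (odd-case l ℤ.∣ a ∣ ℤ.∣ b ∣ (norm-ℕ a b norm)) })
    (1≤ l)
    where
    n : ℕ
    n = 1 ℕ.+ l ℕ.* 2
    x : ℚ[i]
    x = fromℕ (2 ℕ.^ l)
    γ : ℚ
    γ = fromℤ (+ (2 ℕ.^ l))

    1≤ : ∀ l → 3 ℕ.≤ 1 ℕ.+ l ℕ.* 2 → 1 ℕ.≤ l
    1≤ zero    (ℕ.s≤s ())
    1≤ (suc l) _ = ℕ.s≤s ℕ.z≤n

    v≡ : ∀ k → Values.v n k ≡ lookup (x ℂ.+ x ℂ.* 𝐢 ∷ x ℂ.- x ℂ.* 𝐢 ∷ ℂ.- x ℂ.+ x ℂ.* 𝐢 ∷ ℂ.- x ℂ.- x ℂ.* 𝐢 ∷ []) k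
    v≡ = v-odd n x ([1+l*2]%2≡1 l) (trans (cong (fromℕ 2 ℂ.^_) (m*n/n≡m l 2)) (fromℕ-^ 2 l))

    w₂₊ : ∀ k → OddPolynomials.w (suc (suc k)) at x ≡ Values.v n k
    w₂₊ 0F = sym (v≡ 0F)
    w₂₊ 1F = sym (v≡ 1F)
    w₂₊ 2F = sym (v≡ 2F)
    w₂₊ 3F = sym (v≡ 3F)

    classify : ∀ a b → ℤ.∣ a ∣ ≡ 2 ℕ.^ l × ℤ.∣ b ∣ ≡ 2 ℕ.^ l → ∃ λ k → fromℤ a +i fromℤ b ≡ Values.v n k
    classify a b (∣a∣ , ∣b∣) = signs (±fromℤ a ∣a∣) (±fromℤ b ∣b∣)
      where
      signs : fromℤ a ≡ γ ⊎ fromℤ a ≡ ℚ.- γ → fromℤ b ≡ γ ⊎ fromℤ b ≡ ℚ.- γ → ∃ λ k → fromℤ a +i fromℤ b ≡ Values.v n k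
      signs (inj₁ p) (inj₁ q) = 0F , trans (ext
        (trans p (ℚS.solve 1 (λ γ → γ := γ :+ (γ :* ℚS.con 0ℚ :- ℚS.con 0ℚ :* ℚS.con 1ℚ)) refl γ))
        (trans q (ℚS.solve 1 (λ γ → γ := ℚS.con 0ℚ :+ (γ :* ℚS.con 1ℚ :+ ℚS.con 0ℚ :* ℚS.con 0ℚ)) refl γ))) (sym (v≡ 0F))
      signs (inj₁ p) (inj₂ q) = 1F , trans (ext
        (trans p (ℚS.solve 1 (λ γ → γ := γ :- (γ :* ℚS.con 0ℚ :- ℚS.con 0ℚ :* ℚS.con 1ℚ)) refl γ))
        (trans q (ℚS.solve 1 (λ γ → :- γ := ℚS.con 0ℚ :- (γ :* ℚS.con 1ℚ :+ ℚS.con 0ℚ :* ℚS.con 0ℚ)) refl γ))) (sym (v≡ 1F))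
      signs (inj₂ p) (inj₁ q) = 2F , trans (ext
        (trans p (ℚS.solve 1 (λ γ → :- γ := :- γ :+ (γ :* ℚS.con 0ℚ :- ℚS.con 0ℚ :* ℚS.con 1ℚ)) refl γ))
        (trans q (ℚS.solve 1 (λ γ → γ := :- ℚS.con 0ℚ :+ (γ :* ℚS.con 1ℚ :+ ℚS.con 0ℚ :* ℚS.con 0ℚ)) refl γ))) (sym (v≡ 2F))
      signs (inj₂ p) (inj₂ q) = 3F , trans (ext
        (trans p (ℚS.solve 1 (λ γ → :- γ := :- γ :- (γ :* ℚS.con 0ℚ :- ℚS.con 0ℚ :* ℚS.con 1ℚ)) refl γ))
        (trans q (ℚS.solve 1 (λ γ → :- γ := :- ℚS.con 0ℚ :- (γ :* ℚS.con 1ℚ :+ ℚS.con 0ℚ :* ℚS.con 0ℚ)) refl γ))) (sym (v≡ 3F))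

  eigendata-even : ∀ l → let x = fromℕ (2 ℕ.^ l) in
                   Eigendata (2 ℕ.+ l ℕ.* 2) (Values.Even.P x) (Values.Even.Q x)
  eigendata-even l = fromPolynomials (1 ℕ.+ l ℕ.* 2) l EvenPolynomials.eigendata
    (λ j i → refl) (λ j i → refl) (inj₁ refl)
    (sym (trans (cong fromℕ (sym (ℕ.*-assoc 2 2 (2 ℕ.^ (l ℕ.* 2)))))
      (trans (fromℕ-* 4 (2 ℕ.^ (l ℕ.* 2))) (cong (fromℕ 4 ℂ.*_) (2^[l*2]≡ l)))))
    refl refl w₂₊
    (λ { 0F → refl ; 1F → refl ; 2F → refl ; 3F → refl ; 4F → refl ; 5F → refl })
    (λ { 0F → refl ; 1F → refl ; 2F → refl ; 3F → refl ; 4F → refl ; 5F → refl })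
    even-directions
    (λ { _ (a , b , refl) norm → classify a b (even-case (suc l) ℤ.∣ a ∣ ℤ.∣ b ∣ (norm-ℕ a b norm)) })
    (1≤ l)
    where
    n : ℕ
    n = 2 ℕ.+ l ℕ.* 2
    x c : ℚ[i]
    x = fromℕ (2 ℕ.^ l)
    c = fromℕ (2 ℕ.^ suc l)
    γ : ℚ
    γ = fromℤ (+ (2 ℕ.^ suc l))

    1≤ : ∀ l → 3 ℕ.≤ 2 ℕ.+ l ℕ.* 2 → 1 ℕ.≤ l
    1≤ zero    (ℕ.s≤s (ℕ.s≤s ()))
    1≤ (suc l) _ = ℕ.s≤s ℕ.z≤n

    v≡ : ∀ k → Values.v n k ≡ lookup (c ∷ ℂ.- c ∷ c ℂ.* 𝐢 ∷ ℂ.- (c ℂ.* 𝐢) ∷ []) k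
    v≡ = v-even n c ([2+l*2]%2≡0 l) (trans (cong (fromℕ 2 ℂ.^_) (m*n/n≡m (suc l) 2)) (fromℕ-^ 2 (suc l)))

    2x≡c : fromℕ 2 ℂ.* x ≡ c
    2x≡c = sym (fromℕ-* 2 (2 ℕ.^ l))

    w₂₊ : ∀ k → EvenPolynomials.w (suc (suc k)) at x ≡ Values.v n k
    w₂₊ 0F = trans 2x≡c (sym (v≡ 0F))
    w₂₊ 1F = trans (cong (λ u → ℂ.- u) 2x≡c) (sym (v≡ 1F))
    w₂₊ 2F = trans (cong (ℂ._* 𝐢) 2x≡c) (sym (v≡ 2F))
    w₂₊ 3F = trans (cong (λ u → ℂ.- (u ℂ.* 𝐢)) 2x≡c) (sym (v≡ 3F))

    fromℤ-0 : ∀ b → ℤ.∣ b ∣ ≡ 0 → fromℤ b ≡ 0ℚ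
    fromℤ-0 (+ zero) _ = refl

    classify : ∀ a b → (ℤ.∣ a ∣ ≡ 2 ℕ.^ suc l × ℤ.∣ b ∣ ≡ 0) ⊎ (ℤ.∣ a ∣ ≡ 0 × ℤ.∣ b ∣ ≡ 2 ℕ.^ suc l) →
               ∃ λ k → fromℤ a +i fromℤ b ≡ Values.v n k
    classify a b (inj₁ (∣a∣ , ∣b∣)) = sign (±fromℤ a ∣a∣)
      where
      sign : fromℤ a ≡ γ ⊎ fromℤ a ≡ ℚ.- γ → ∃ λ k → fromℤ a +i fromℤ b ≡ Values.v n k
      sign (inj₁ p) = 0F , trans (ext p (fromℤ-0 b ∣b∣)) (sym (v≡ 0F))
      sign (inj₂ p) = 1F , trans (ext p (fromℤ-0 b ∣b∣)) (sym (v≡ 1F))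
    classify a b (inj₂ (∣a∣ , ∣b∣)) = sign (±fromℤ b ∣b∣)
      where
      sign : fromℤ b ≡ γ ⊎ fromℤ b ≡ ℚ.- γ → ∃ λ k → fromℤ a +i fromℤ b ≡ Values.v n k
      sign (inj₁ p) = 2F , trans (ext
        (trans (fromℤ-0 a ∣a∣) (ℚS.solve 1 (λ γ → ℚS.con 0ℚ := γ :* ℚS.con 0ℚ :- ℚS.con 0ℚ :* ℚS.con 1ℚ) refl γ))
        (trans p (ℚS.solve 1 (λ γ → γ := γ :* ℚS.con 1ℚ :+ ℚS.con 0ℚ :* ℚS.con 0ℚ) refl γ))) (sym (v≡ 2F))
      sign (inj₂ p) = 3F , trans (ext
        (trans (fromℤ-0 a ∣a∣) (ℚS.solve 1 (λ γ → ℚS.con 0ℚ := :- (γ :* ℚS.con 0ℚ :- ℚS.con 0ℚ :* ℚS.con 1ℚ)) refl γ))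
        (trans p (ℚS.solve 1 (λ γ → :- γ := :- (γ :* ℚS.con 1ℚ :+ ℚS.con 0ℚ :* ℚS.con 0ℚ)) refl γ))) (sym (v≡ 3F))

-- The association scheme of a planar set D

module PlanarClasses (G : AbelianGroup 0ℓ 0ℓ) (Z D : Pred (AbelianGroup.Carrier G) 0ℓ) where
  open AbelianGroup G

  SumOfTwo : Pred Carrier 0ℓ
  SumOfTwo x = ∃₂ λ d d′ → D d × D d′ × x ≈ d ∙ d′

  S₀₋₃ : Pred Carrier 0ℓ
  S₀₋₃ x = x ≈ ε ⊎ (D x × ¬ x ≈ ε) ⊎ (D (x ⁻¹) × ¬ x ≈ ε) ⊎ (Z x × ¬ x ≈ ε)

  Class : Fin 6 → Pred Carrier 0ℓ
  Class 0F x = x ≈ ε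
  Class 1F x = D x × ¬ x ≈ ε
  Class 2F x = D (x ⁻¹) × ¬ x ≈ ε
  Class 3F x = Z x × ¬ x ≈ ε
  Class 4F x = ¬ S₀₋₃ x × SumOfTwo x
  Class 5F x = ¬ S₀₋₃ x × ¬ SumOfTwo x

record PlanarSetting (G : AbelianGroup 0ℓ 0ℓ) {N : ℕ} (enum : Enumeration (AbelianGroup.setoid G) N)
                     (n : ℕ) : Set₁ where
  open AbelianGroup G
  field
    order : N ≡ 2 ℕ.^ n ℕ.* 2 ℕ.^ n
    bicharacter : Bicharacter G

  open Bicharacter bicharacter public

  field
    χ-values : ∀ a x → ∃ λ (k : Fin 4) → χ a x ≡ 𝐢 ℂ.^ toℕ k

    Z D : Pred Carrier 0ℓ
    Z? : Decidable Z
    D? : Decidable D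
    Z-resp : ∀ {x y} → x ≈ y → Z x → Z y
    D-resp : ∀ {x y} → x ≈ y → D x → D y
    Z-ε : Z ε
    Z-∙ : ∀ {x y} → Z x → Z y → Z (x ∙ y)
    Z-⁻¹ : ∀ {x} → Z x → Z (x ⁻¹)
    Z-double : ∀ x → Z (x ∙ x)
    Z-torsion : ∀ {x} → x ∙ x ≈ ε → Z x
    χ-nondegenerate-Z : ∀ {a} → ¬ Z a → ∃ λ x → Z x × χ a x ≢ ℂ.1#
    χ-trivial-Z : ∀ {a x} → Z a → Z x → χ a x ≡ ℂ.1#
    D-ε : D ε
    D-injective : ∀ {x y} → D x → D y → Z (x - y) → x ≈ y
    D-difference : ∀ x → ¬ Z x → ∃ λ y → (D y × D (y - x)) × (∀ y′ → D y′ → D (y′ - x) → y′ ≈ y)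
    D-half : ∀ x → Z x → ∃ λ y → D y × D (x - y)
    count-Z : FiniteSums.count enum Z? ≡ fromℕ (2 ℕ.^ n)
    count-D : FiniteSums.count enum D? ≡ fromℕ (2 ℕ.^ n)

  open PlanarClasses G Z D public

  field
    S : Fin 6 → Pred Carrier 0ℓ
    S? : ∀ i → Decidable (S i)
    S⇔Class : ∀ i x → S i x ⇔ Class i x

discardEmpty : ∀ {A : Set} {m} (U : Fin m → Pred A 0ℓ) → (∀ i → Dec (Satisfiable (U i))) →
  ∃₂ λ d (ι : Fin d → Fin m) → (∀ {i j} → i Fin.< j → ι i Fin.< ι j) ×
                               (∀ i → (∃ λ j → ι j ≡ i) ⇔ Satisfiable (U i))
discardEmpty {m = zero}  U U? = 0 , (λ ()) , (λ { {()} }) , λ ()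
discardEmpty {A} {suc m} U U? = extend (U? zero) (discardEmpty (U ∘ suc) (U? ∘ suc))
  where
  extend : Dec (Satisfiable (U zero)) →
    (∃₂ λ d (ι : Fin d → Fin m) → (∀ {i j} → i Fin.< j → ι i Fin.< ι j) ×
                                  (∀ i → (∃ λ j → ι j ≡ i) ⇔ Satisfiable (U (suc i)))) →
    ∃₂ λ d (ι : Fin d → Fin (suc m)) → (∀ {i j} → i Fin.< j → ι i Fin.< ι j) ×
                                       (∀ i → (∃ λ j → ι j ≡ i) ⇔ Satisfiable (U i))
  extend (yes u) (d , ι , increasing , image) = suc d , ι′ , increasing′ , image′
    where
    ι′ : Fin (suc d) → Fin (suc m)
    ι′ zero    = zero
    ι′ (suc j) = suc (ι j)
    increasing′ : ∀ {i j} → i Fin.< j → ι′ i Fin.< ι′ j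
    increasing′ {zero}  {suc j} _           = ℕ.s≤s ℕ.z≤n
    increasing′ {suc i} {suc j} (ℕ.s≤s i<j) = ℕ.s≤s (increasing i<j)
    image′ : ∀ i → (∃ λ j → ι′ j ≡ i) ⇔ Satisfiable (U i)
    image′ zero    = mk⇔ (λ _ → u) (λ _ → zero , ≡.refl)
    image′ (suc i) = mk⇔ (λ { (suc j , eq) → Equivalence.to (image i) (j , Fin.suc-injective eq) })
      (λ u′ → suc (proj₁ (Equivalence.from (image i) u′)) , cong suc (proj₂ (Equivalence.from (image i) u′)))
  extend (no ¬u) (d , ι , increasing , image) = d , (suc ∘ ι) , (λ i<j → ℕ.s≤s (increasing i<j)) , image′
    where
    image′ : ∀ i → (∃ λ j → suc (ι j) ≡ i) ⇔ Satisfiable (U i)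
    image′ zero    = mk⇔ (λ { (_ , ()) }) (λ u → contradiction u ¬u)
    image′ (suc i) = mk⇔ (λ (j , eq) → Equivalence.to (image i) (j , Fin.suc-injective eq))
      (λ u → proj₁ (Equivalence.from (image i) u) , cong suc (proj₂ (Equivalence.from (image i) u)))

discardsEmpty : ∀ {A : Set} {m} (U : Fin (suc m) → Pred A 0ℓ) → (∀ i → Dec (Satisfiable (U i))) →
                Satisfiable (U zero) → ∃₂ λ d (ι : Fin (suc d) → Fin (suc m)) → DiscardsEmpty U ι
discardsEmpty U U? u₀ = nonempty (discardEmpty U U?)
  where
  nonempty : (∃₂ λ d (ι : Fin d → Fin _) → (∀ {i j} → i Fin.< j → ι i Fin.< ι j) ×
                                           (∀ i → (∃ λ j → ι j ≡ i) ⇔ Satisfiable (U i))) →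
             ∃₂ λ d (ι : Fin (suc d) → Fin _) → DiscardsEmpty U ι
  nonempty (zero , ι , _ , image) with () ← proj₁ (Equivalence.from (image zero) u₀)
  nonempty (suc d , ι , increasing , image) = d , ι , record { increasing = increasing ; image = image }

module DiscardsEmptyProperties {A : Set} {m d} {U : Fin (suc m) → Pred A 0ℓ} {ι : Fin (suc d) → Fin (suc m)}
                               (discards : DiscardsEmpty U ι) where
  open DiscardsEmpty discards

  ι-injective : ∀ {k l} → ι k ≡ ι l → k ≡ l
  ι-injective {k} {l} eq with Fin.<-cmp k l
  ... | tri< k<l _ _ = contradiction eq (Fin.<⇒≢ (increasing k<l))
  ... | tri≈ _ k≡l _ = k≡l
  ... | tri> _ _ l<k = contradiction (≡.sym eq) (Fin.<⇒≢ (increasing l<k))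

  ι-satisfiable : ∀ l → Satisfiable (U (ι l))
  ι-satisfiable l = Equivalence.to (image (ι l)) (l , ≡.refl)

  ι-image : ∀ i → Satisfiable (U i) → ∃ λ l → ι l ≡ i
  ι-image i = Equivalence.from (image i)

  ι-zero : Satisfiable (U zero) → ι zero ≡ zero
  ι-zero u₀ = first (proj₁ (ι-image zero u₀)) (proj₂ (ι-image zero u₀))
    where
    first : ∀ l → ι l ≡ zero → ι zero ≡ zero
    first zero    eq = eq
    first (suc l) eq with () ← subst (ι zero Fin.<_) eq (increasing (ℕ.s≤s ℕ.z≤n))

module PlanarScheme
  {G : AbelianGroup 0ℓ 0ℓ} {N : ℕ} {enum : Enumeration (AbelianGroup.setoid G) N} {n : ℕ}
  (setting : PlanarSetting G enum n) {P Q : Values.SquareMatrix} (eigendata : Eigendata n P Q) where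
  open AbelianGroup G
  open PlanarSetting setting
  open Eigendata eigendata
  open ClassValues n
  open AbelianGroupProperties G using (⁻¹-involutive; ⁻¹-anti-homo-∙; ⁻¹-∙-comm; ε⁻¹≈ε; x∙y⁻¹≈ε⇒x≈y; x≈y⇒x∙y⁻¹≈ε)
  open CommutativeSemigroupProperties commutativeSemigroup using (interchange)
  open Finite enum
  open FiniteSums {AbelianGroup.setoid G} enum
  open Summation
  open ℚ[i]-Properties hiding (_≟_)
  open ℚ[i]-Domain hiding (inverse)
  open GaussianIntegers
  open EigendataConstruction using (2^≢0)

  N≡q*q : fromℕ N ≡ q ℂ.* q
  N≡q*q = ≡.trans (cong fromℕ order) (fromℕ-* (2 ℕ.^ n) (2 ℕ.^ n))

  q≢0 : q ≢ ℂ.0#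
  q≢0 = fromℕ≢0 (2^≢0 n)

  N≢0 : N ≢ 0
  N≢0 N≡0 = q≢0 (z*w≡0⇒w≡0 {q} {q} q≢0 (≡.trans (≡.sym N≡q*q) (cong fromℕ N≡0)))

  open Fourier G enum bicharacter N≢0

  Z-- : ∀ {x y} → Z x → Z y → Z (x - y)
  Z-- zx zy = Z-∙ zx (Z-⁻¹ zy)

  x-ε≈x : ∀ x → x - ε ≈ x
  x-ε≈x x = trans (∙-congˡ ε⁻¹≈ε) (identityʳ x)

  [x-y]⁻¹≈y-x : ∀ x y → (x - y) ⁻¹ ≈ y - x
  [x-y]⁻¹≈y-x x y = trans (⁻¹-anti-homo-∙ x (y ⁻¹)) (∙-congʳ (⁻¹-involutive y))

  D∩Z : ∀ {x} → D x → Z x → x ≈ ε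
  D∩Z {x} dx zx = D-injective dx D-ε (Z-resp (sym (x-ε≈x x)) zx)

  x⁻¹≈ε⇒x≈ε : ∀ {x} → x ⁻¹ ≈ ε → x ≈ ε
  x⁻¹≈ε⇒x≈ε {x} eq = trans (sym (⁻¹-involutive x)) (trans (⁻¹-cong eq) ε⁻¹≈ε)

  Z-half : ∀ {x y z} → Z x → D y → D z → x ≈ y ∙ z → y ≈ z
  Z-half {x} {y} {z} zx dy dz eq = D-injective dy dz (Z-resp (trans (∙-congʳ eq) lemma) (Z-- zx (Z-double z)))
    where
    lemma : (y ∙ z) - (z ∙ z) ≈ y - z
    lemma = trans (∙-congˡ (⁻¹-anti-homo-∙ z z)) (trans (sym (assoc (y ∙ z) (z ⁻¹) (z ⁻¹))) (∙-congʳ (x∙y∙y⁻¹≈x y z)))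

  D∩D⁻¹ : ∀ {x} → D x → D (x ⁻¹) → x ≈ ε
  D∩D⁻¹ {x} dx dx⁻¹ = D∩Z dx (Z-torsion (trans (∙-congˡ x≈x⁻¹) (inverseʳ x)))
    where
    x≈x⁻¹ : x ≈ x ⁻¹
    x≈x⁻¹ = Z-half Z-ε dx dx⁻¹ (sym (inverseʳ x))

  Class-resp : ∀ i {x y} → x ≈ y → Class i x → Class i y
  Class-resp i {x} {y} x≈y = transport i
    where
    ≉-resp : ¬ x ≈ ε → ¬ y ≈ ε
    ≉-resp x≉ε y≈ε = x≉ε (trans x≈y y≈ε)
    S₀₋₃-resp : S₀₋₃ y → S₀₋₃ x
    S₀₋₃-resp (inj₁ y≈ε) = inj₁ (trans x≈y y≈ε)
    S₀₋₃-resp (inj₂ (inj₁ (dy , y≉ε))) = inj₂ (inj₁ (D-resp (sym x≈y) dy , λ x≈ε → y≉ε (trans (sym x≈y) x≈ε)))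
    S₀₋₃-resp (inj₂ (inj₂ (inj₁ (dy , y≉ε)))) = inj₂ (inj₂ (inj₁ (D-resp (⁻¹-cong (sym x≈y)) dy , λ x≈ε → y≉ε (trans (sym x≈y) x≈ε))))
    S₀₋₃-resp (inj₂ (inj₂ (inj₂ (zy , y≉ε)))) = inj₂ (inj₂ (inj₂ (Z-resp (sym x≈y) zy , λ x≈ε → y≉ε (trans (sym x≈y) x≈ε))))
    transport : ∀ i → Class i x → Class i y
    transport 0F x≈ε = trans (sym x≈y) x≈ε
    transport 1F (dx , x≉ε) = D-resp x≈y dx , ≉-resp x≉ε
    transport 2F (dx , x≉ε) = D-resp (⁻¹-cong x≈y) dx , ≉-resp x≉ε
    transport 3F (zx , x≉ε) = Z-resp x≈y zx , ≉-resp x≉ε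
    transport 4F (¬s , d , d′ , dd , dd′ , eq) = (λ s → ¬s (S₀₋₃-resp s)) , d , d′ , dd , dd′ , trans (sym x≈y) eq
    transport 5F (¬s , ¬m) = (λ s → ¬s (S₀₋₃-resp s)) , λ (d , d′ , dd , dd′ , eq) → ¬m (d , d′ , dd , dd′ , trans x≈y eq)

  S⇒Class : ∀ {i x} → S i x → Class i x
  S⇒Class = Equivalence.to (S⇔Class _ _)

  Class⇒S : ∀ {i x} → Class i x → S i x
  Class⇒S = Equivalence.from (S⇔Class _ _)

  S-resp : ∀ i {x y} → x ≈ y → S i x → S i y
  S-resp i x≈y six = Class⇒S (Class-resp i x≈y (S⇒Class six))

  Class-covering : ∀ x → ∃ λ i → Class i x
  Class-covering x with x ≟ ε | D? x | D? (x ⁻¹) | Z? x | S? 4F x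
  ... | yes x≈ε | _      | _       | _      | _      = 0F , x≈ε
  ... | no x≉ε  | yes dx | _       | _      | _      = 1F , dx , x≉ε
  ... | no x≉ε  | no _   | yes dx⁻ | _      | _      = 2F , dx⁻ , x≉ε
  ... | no x≉ε  | no _   | no _    | yes zx | _      = 3F , zx , x≉ε
  ... | no _    | no _   | no _    | no _   | yes s₄ = 4F , S⇒Class s₄
  ... | no x≉ε  | no ¬d  | no ¬d⁻  | no ¬z  | no ¬s₄ = 5F , ¬S₀₋₃ , λ m → ¬s₄ (Class⇒S (¬S₀₋₃ , m))
    where
    ¬S₀₋₃ : ¬ S₀₋₃ x
    ¬S₀₋₃ (inj₁ x≈ε) = x≉ε x≈ε
    ¬S₀₋₃ (inj₂ (inj₁ (d , _))) = ¬d d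
    ¬S₀₋₃ (inj₂ (inj₂ (inj₁ (d , _)))) = ¬d⁻ d
    ¬S₀₋₃ (inj₂ (inj₂ (inj₂ (z , _)))) = ¬z z

  Class-disjoint< : ∀ {x} i j → i Fin.< j → Class i x → ¬ Class j x
  Class-disjoint< _ 0F ()
  Class-disjoint< (suc _) 1F (ℕ.s≤s ())
  Class-disjoint< (suc (suc _)) 2F (ℕ.s≤s (ℕ.s≤s ()))
  Class-disjoint< (suc (suc (suc _))) 3F (ℕ.s≤s (ℕ.s≤s (ℕ.s≤s ())))
  Class-disjoint< (suc (suc (suc (suc _)))) 4F (ℕ.s≤s (ℕ.s≤s (ℕ.s≤s (ℕ.s≤s ()))))
  Class-disjoint< 5F 5F (ℕ.s≤s (ℕ.s≤s (ℕ.s≤s (ℕ.s≤s (ℕ.s≤s ())))))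
  Class-disjoint< 0F 1F _ x≈ε (_ , x≉ε) = x≉ε x≈ε
  Class-disjoint< 0F 2F _ x≈ε (_ , x≉ε) = x≉ε x≈ε
  Class-disjoint< 0F 3F _ x≈ε (_ , x≉ε) = x≉ε x≈ε
  Class-disjoint< 0F 4F _ s (¬s , _) = ¬s (inj₁ s)
  Class-disjoint< 0F 5F _ s (¬s , _) = ¬s (inj₁ s)
  Class-disjoint< 1F 2F _ (d , x≉ε) (d⁻ , _) = x≉ε (D∩D⁻¹ d d⁻)
  Class-disjoint< 1F 3F _ (d , x≉ε) (z , _) = x≉ε (D∩Z d z)
  Class-disjoint< 1F 4F _ s (¬s , _) = ¬s (inj₂ (inj₁ s))
  Class-disjoint< 1F 5F _ s (¬s , _) = ¬s (inj₂ (inj₁ s))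
  Class-disjoint< 2F 3F _ (d⁻ , x≉ε) (z , _) = x≉ε (x⁻¹≈ε⇒x≈ε (D∩Z d⁻ (Z-⁻¹ z)))
  Class-disjoint< 2F 4F _ s (¬s , _) = ¬s (inj₂ (inj₂ (inj₁ s)))
  Class-disjoint< 2F 5F _ s (¬s , _) = ¬s (inj₂ (inj₂ (inj₁ s)))
  Class-disjoint< 3F 4F _ s (¬s , _) = ¬s (inj₂ (inj₂ (inj₂ s)))
  Class-disjoint< 3F 5F _ s (¬s , _) = ¬s (inj₂ (inj₂ (inj₂ s)))
  Class-disjoint< 4F 5F _ (_ , m) (_ , ¬m) = ¬m m

  S-covering : ∀ x → ∃ λ i → S i x
  S-covering x = proj₁ (Class-covering x) , Class⇒S (proj₂ (Class-covering x))

  S-disjoint : ∀ {i j x} → S i x → S j x → i ≡ j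
  S-disjoint {i} {j} six sjx with Fin.<-cmp i j
  ... | tri< i<j _ _ = contradiction (S⇒Class sjx) (Class-disjoint< i j i<j (S⇒Class six))
  ... | tri≈ _ i≡j _ = i≡j
  ... | tri> _ _ j<i = contradiction (S⇒Class six) (Class-disjoint< j i j<i (S⇒Class sjx))

  s : Fin 6 → Carrier → ℚ[i]
  s i x = 𝟙 (S? i x)

  s-resp : ∀ i → Respecting (s i)
  s-resp i = 𝟙-resp (S? i) (S-resp i)

  combination-s : ∀ (c : Fin 6 → ℚ[i]) {i x} → S i x → (ℂ.sum λ k → c k ℂ.* s k x) ≡ c i
  combination-s c {i} {x} six = ≡.trans
    (sum-single _ i λ j j≢i → ≡.trans
      (cong (c j ℂ.*_) (𝟙-false (S? j x) λ sjx → j≢i (S-disjoint sjx six)))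
      (z*0 (c j)))
    (≡.trans (cong (c i ℂ.*_) (𝟙-true (S? i x) six)) (z*1 (c i)))

  hat-classwise : ∀ (φ : Carrier → ℚ[i]) (c : Fin 6 → ℚ[i]) → (∀ i x → Class i x → φ x ≡ c i) →
                  ∀ a → hat φ a ≡ ℂ.sum λ k → c k ℂ.* hat (s k) a
  hat-classwise φ c φ≡c a = ≡.trans
    (hat-cong (λ x → ≡.trans (φ≡c _ x (proj₂ (Class-covering x))) (≡.sym (combination-s c (proj₂ (S-covering x))))) a)
    (hat-combination c s a)

  φ ζ : Carrier → ℚ[i]
  φ x = 𝟙 (D? x)
  ζ x = 𝟙 (Z? x)

  φ-resp : Respecting φ
  φ-resp = 𝟙-resp D? D-resp

  𝟙-real : {A : Set} (d : Dec A) → conj (𝟙 d) ≡ 𝟙 d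
  𝟙-real (yes _) = ≡.refl
  𝟙-real (no _)  = ≡.refl

  hat-φ⁻¹ : ∀ a → hat (φ ∘ _⁻¹) a ≡ conj (hat φ a)
  hat-φ⁻¹ = hat-⁻¹ φ φ-resp (λ x → 𝟙-real (D? x))

  D-differences? : ∀ x → Decidable λ y → D y × D (y - x)
  D-differences? x y = D? y ×-dec D? (y - x)

  D-differences-resp : ∀ x {y z} → y ≈ z → D y × D (y - x) → D z × D (z - x)
  D-differences-resp x y≈z (d , d′) = D-resp y≈z d , D-resp (∙-congʳ y≈z) d′

  φ∗φ⁻¹-count : ∀ x → (φ ∗ (φ ∘ _⁻¹)) x ≡ count (D-differences? x)
  φ∗φ⁻¹-count x = sumAll-cong λ y → ≡.trans (cong (φ y ℂ.*_) (φ-resp ([x-y]⁻¹≈y-x x y)))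
    (≡.sym (𝟙-× (D? y) (D? (y - x))))

  φ∗φ⁻¹+ζ : ∀ x → (φ ∗ (φ ∘ _⁻¹)) x ℂ.+ ζ x ≡ ℂ.1# ℂ.+ q ℂ.* 𝟙 (x ≟ ε)
  φ∗φ⁻¹+ζ x = ≡.trans (cong (ℂ._+ ζ x) (φ∗φ⁻¹-count x)) (cases (Z? x) (x ≟ ε))
    where
    cases : (d : Dec (Z x)) (e : Dec (x ≈ ε)) →
            count (D-differences? x) ℂ.+ 𝟙 d ≡ ℂ.1# ℂ.+ q ℂ.* 𝟙 e
    cases (no ¬z) (yes x≈ε) = contradiction (Z-resp (sym x≈ε) Z-ε) ¬z
    cases (no ¬z) (no _) with y , (dy , dy′) , unique ← D-difference x ¬z = ≡.trans
      (cong (ℂ._+ ℂ.0#) (count≡1 (D-differences? x) (D-differences-resp x) y (dy , dy′) λ z (dz , dz′) → unique z dz dz′))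
      (Solver.solve 1 (λ q → Solver.con ℂ.1# Solver.:+ Solver.con ℂ.0# Solver.:= Solver.con ℂ.1# Solver.:+ q Solver.:* Solver.con ℂ.0#) ≡.refl q)
    cases (yes z) (no x≉ε) = ≡.trans
      (cong (ℂ._+ ℂ.1#) (count≡0 (D-differences? x) λ y (dy , dy′) → x≉ε
        (trans (sym (x-[x-y]≈y y x)) (x≈y⇒x∙y⁻¹≈ε (D-injective dy dy′ (Z-resp (sym (x-[x-y]≈y y x)) z))))))
      (Solver.solve 1 (λ q → Solver.con ℂ.0# Solver.:+ Solver.con ℂ.1# Solver.:= Solver.con ℂ.1# Solver.:+ q Solver.:* Solver.con ℂ.0#) ≡.refl q)
    cases (yes z) (yes x≈ε) = ≡.trans
      (cong (ℂ._+ ℂ.1#) (≡.trans (sumAll-cong λ y → 𝟙-cong (D-differences? x y) (D? y) proj₁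
        λ dy → dy , D-resp (sym (trans (∙-congˡ (⁻¹-cong x≈ε)) (x-ε≈x y))) dy) count-D))
      (Solver.solve 1 (λ q → q Solver.:+ Solver.con ℂ.1# Solver.:= Solver.con ℂ.1# Solver.:+ q Solver.:* Solver.con ℂ.1#) ≡.refl q)

  hat-𝟙≟ε : ∀ a → hat (λ x → 𝟙 (x ≟ ε)) a ≡ ℂ.1#
  hat-𝟙≟ε a = ≡.trans (sumAll-delta (χ a) ε (χ-cong refl)) (χ-ε a)

  norm-identity : ∀ a → hat φ a ℂ.* conj (hat φ a) ℂ.+ hat ζ a ≡ hat one a ℂ.+ q
  norm-identity a = begin
    hat φ a ℂ.* conj (hat φ a) ℂ.+ hat ζ a
      ≡⟨ cong (ℂ._+ hat ζ a) (≡.trans (hat-∗ φ (φ ∘ _⁻¹) (λ x≈y → φ-resp (⁻¹-cong x≈y)) a) (cong (hat φ a ℂ.*_) (hat-φ⁻¹ a))) ⟨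
    hat (φ ∗ (φ ∘ _⁻¹)) a ℂ.+ hat ζ a
      ≡⟨ hat-+ (φ ∗ (φ ∘ _⁻¹)) ζ a ⟨
    hat (λ x → (φ ∗ (φ ∘ _⁻¹)) x ℂ.+ ζ x) a
      ≡⟨ hat-cong φ∗φ⁻¹+ζ a ⟩
    hat (λ x → one x ℂ.+ q ℂ.* 𝟙 (x ≟ ε)) a
      ≡⟨ hat-+ one (λ x → q ℂ.* 𝟙 (x ≟ ε)) a ⟩
    hat one a ℂ.+ hat (λ x → q ℂ.* 𝟙 (x ≟ ε)) a
      ≡⟨ cong (hat one a ℂ.+_) (≡.trans (hat-* q (λ x → 𝟙 (x ≟ ε)) a) (≡.trans (cong (q ℂ.*_) (hat-𝟙≟ε a)) (z*1 q))) ⟩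
    hat one a ℂ.+ q ∎
    where open ≡-Reasoning

  hat-ζ-Z : ∀ {a} → Z a → hat ζ a ≡ q
  hat-ζ-Z {a} za = ≡.trans (sumAll-cong λ x → lemma x (Z? x)) count-Z
    where
    lemma : ∀ x (d : Dec (Z x)) → 𝟙 d ℂ.* χ a x ≡ 𝟙 d
    lemma x (yes zx) = ≡.trans (1*z (χ a x)) (χ-trivial-Z za zx)
    lemma x (no _)   = 0*z (χ a x)

  hat-ζ-¬Z : ∀ {a} → ¬ Z a → hat ζ a ≡ ℂ.0#
  hat-ζ-¬Z {a} ¬za with h , zh , χ≢1 ← χ-nondegenerate-Z ¬za =
    orthogonality Z? Z-resp a h (λ _ zx → Z-∙ zx zh)
      (λ x zxh → Z-resp (x∙y∙y⁻¹≈x x h) (Z-- zxh zh)) χ≢1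

  IsGaussian-hat-φ : ∀ a → IsGaussian (hat φ a)
  IsGaussian-hat-φ a = IsGaussian-sum (λ k → φ (Inverse.from enum k) ℂ.* χ a (Inverse.from enum k))
    λ k → lemma (Inverse.from enum k) (D? (Inverse.from enum k))
    where
    lemma : ∀ x (d : Dec (D x)) → IsGaussian (𝟙 d ℂ.* χ a x)
    lemma x (no _)  = subst IsGaussian (≡.sym (0*z (χ a x))) IsGaussian-0
    lemma x (yes _) with k , χ≡ ← χ-values a x =
      subst IsGaussian (≡.sym (≡.trans (1*z (χ a x)) χ≡)) (IsGaussian-𝐢^ k)

  record HasClass (a : Carrier) (j : Fin 6) : Set where
    field
      hat-φ   : hat φ a ≡ w j
      hat-ζ   : hat ζ a ≡ z j
      hat-1   : hat one a ≡ r j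
      trivial : j ≡ 0F → a ≈ ε

  hasClass : ∀ a → ∃ (HasClass a)
  hasClass a = cases (a ≟ ε) (Z? a)
    where
    open ≡-Reasoning
    cases : Dec (a ≈ ε) → Dec (Z a) → ∃ (HasClass a)
    cases (yes a≈ε) _ = 0F , record
      { hat-φ = ≡.trans (hat-ε φ a≈ε) count-D
      ; hat-ζ = hat-ζ-Z (Z-resp (sym a≈ε) Z-ε)
      ; hat-1 = ≡.trans (hat-one-ε a≈ε) N≡q*q
      ; trivial = λ _ → a≈ε
      }
    cases (no a≉ε) (yes za) = 1F , record
      { hat-φ = φ≡0 (hat φ a ℚ[i]-Properties.≟ ℂ.0#)
      ; hat-ζ = hat-ζ-Z za
      ; hat-1 = hat-one-≉ε a≉ε
      ; trivial = λ ()
      }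
      where
      norm≡0 : hat φ a ℂ.* conj (hat φ a) ≡ ℂ.0#
      norm≡0 = begin
        hat φ a ℂ.* conj (hat φ a)
          ≡⟨ Solver.solve 2 (λ x q → x Solver.:= (x Solver.:+ q) Solver.:- q) ≡.refl (hat φ a ℂ.* conj (hat φ a)) q ⟩
        (hat φ a ℂ.* conj (hat φ a) ℂ.+ q) ℂ.- q
          ≡⟨ cong (λ t → (hat φ a ℂ.* conj (hat φ a) ℂ.+ t) ℂ.- q) (hat-ζ-Z za) ⟨
        (hat φ a ℂ.* conj (hat φ a) ℂ.+ hat ζ a) ℂ.- q
          ≡⟨ cong (ℂ._- q) (≡.trans (norm-identity a) (cong (ℂ._+ q) (hat-one-≉ε a≉ε))) ⟩
        (ℂ.0# ℂ.+ q) ℂ.- q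
          ≡⟨ Solver.solve 1 (λ q → (Solver.con ℂ.0# Solver.:+ q) Solver.:- q Solver.:= Solver.con ℂ.0#) ≡.refl q ⟩
        ℂ.0# ∎
      φ≡0 : Dec (hat φ a ≡ ℂ.0#) → hat φ a ≡ ℂ.0#
      φ≡0 (yes eq) = eq
      φ≡0 (no ≢0)  = ≡.trans (≡.sym (conj-involutive (hat φ a))) (cong conj (z*w≡0⇒w≡0 {hat φ a} {conj (hat φ a)} ≢0 norm≡0))
    cases (no a≉ε) (no ¬za) = suc (suc (proj₁ classified)) , record
      { hat-φ = proj₂ classified
      ; hat-ζ = ≡.trans (hat-ζ-¬Z ¬za) (≡.sym (Vec.lookup-replicate (proj₁ classified) ℂ.0#))
      ; hat-1 = ≡.trans (hat-one-≉ε a≉ε) (≡.sym (Vec.lookup-replicate (proj₁ classified) ℂ.0#))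
      ; trivial = λ ()
      }
      where
      norm≡q : hat φ a ℂ.* conj (hat φ a) ≡ q
      norm≡q = begin
        hat φ a ℂ.* conj (hat φ a)
          ≡⟨ +-identityʳ (hat φ a ℂ.* conj (hat φ a)) ⟨
        hat φ a ℂ.* conj (hat φ a) ℂ.+ ℂ.0#
          ≡⟨ cong (hat φ a ℂ.* conj (hat φ a) ℂ.+_) (hat-ζ-¬Z ¬za) ⟨
        hat φ a ℂ.* conj (hat φ a) ℂ.+ hat ζ a
          ≡⟨ ≡.trans (norm-identity a) (cong (ℂ._+ q) (hat-one-≉ε a≉ε)) ⟩
        ℂ.0# ℂ.+ q
          ≡⟨ +-identityˡ q ⟩
        q ∎
      classified : ∃ λ k → hat φ a ≡ Values.v n k
      classified = classify (hat φ a) (IsGaussian-hat-φ a) norm≡q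

  D-sums? : ∀ x → Decidable λ y → D y × D (x - y)
  D-sums? x y = D? y ×-dec D? (x - y)

  D-sums-resp : ∀ x {y z} → y ≈ z → D y × D (x - y) → D z × D (x - z)
  D-sums-resp x y≈z (d , d′) = D-resp y≈z d , D-resp (∙-congˡ (⁻¹-cong y≈z)) d′

  M : Pred Carrier 0ℓ
  M x = ∃ λ y → D y × D (x - y)

  M? : Decidable M
  M? x = search (D-sums-resp x) (D-sums? x)

  y∙[x-y]≈x : ∀ x y → y ∙ (x - y) ≈ x
  y∙[x-y]≈x x y = trans (comm y (x - y)) (x∙y⁻¹∙y≈x x y)

  x≈y∙z⇒x-y≈z : ∀ {x y z} → x ≈ y ∙ z → x - y ≈ z
  x≈y∙z⇒x-y≈z {x} {y} {z} eq = trans (∙-congʳ (trans eq (comm y z))) (x∙y∙y⁻¹≈x z y)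

  M⇒SumOfTwo : ∀ {x} → M x → SumOfTwo x
  M⇒SumOfTwo {x} (y , dy , dx-y) = y , x - y , dy , dx-y , sym (y∙[x-y]≈x x y)

  SumOfTwo⇒M : ∀ {x} → SumOfTwo x → M x
  SumOfTwo⇒M {x} (d , d′ , dd , dd′ , eq) = d , dd , D-resp (sym (x≈y∙z⇒x-y≈z eq)) dd′

  ψ : Carrier → ℚ[i]
  ψ = φ ∗ φ

  ψ-count : ∀ x → ψ x ≡ count (D-sums? x)
  ψ-count x = sumAll-cong λ y → ≡.sym (𝟙-× (D? y) (D? (x - y)))

  ψ-¬M : ∀ {x} → ¬ SumOfTwo x → ψ x ≡ ℂ.0#
  ψ-¬M {x} ¬m = ≡.trans (ψ-count x) (count≡0 (D-sums? x) λ y dd → ¬m (M⇒SumOfTwo (y , dd)))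

  ψ-Z : ∀ {x} → Z x → ψ x ≡ ℂ.1#
  ψ-Z {x} zx with y , dy , dx-y ← D-half x zx = ≡.trans (ψ-count x)
    (count≡1 (D-sums? x) (D-sums-resp x) y (dy , dx-y) λ y′ (dy′ , dx-y′) →
      D-injective dy′ dy (Z-torsion (trans (interchange y′ (y ⁻¹) y′ (y ⁻¹))
        (trans (∙-cong (double dy′ dx-y′) (trans (⁻¹-∙-comm y y) (⁻¹-cong (double dy dx-y)))) (inverseʳ x)))))
    where
    double : ∀ {y} → D y → D (x - y) → y ∙ y ≈ x
    double {y} dy dx-y = trans (∙-congˡ (Z-half zx dy dx-y (sym (y∙[x-y]≈x x y)))) (y∙[x-y]≈x x y)

  -- A representation y + (x - y) with y ≠ d yields two representations of the
  -- difference d - y, so it is the representation d′ + d.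
  ψ-SumOfTwo : ∀ {x} → ¬ Z x → SumOfTwo x → ψ x ≡ fromℕ 2
  ψ-SumOfTwo {x} ¬zx (d , d′ , dd , dd′ , eq) = ≡.trans (ψ-count x)
    (count≡2 (D-sums? x) (D-sums-resp x) d d′ d≉d′
      (dd , D-resp (sym x-d≈d′) dd′) (dd′ , D-resp (sym x-d′≈d) dd)
      λ y (dy , dx-y) → cases y dy dx-y (Z? (d - y)))
    where
    x-d≈d′ : x - d ≈ d′
    x-d≈d′ = x≈y∙z⇒x-y≈z eq
    x-d′≈d : x - d′ ≈ d
    x-d′≈d = x≈y∙z⇒x-y≈z (trans eq (comm d d′))
    d≉d′ : ¬ d ≈ d′
    d≉d′ d≈d′ = ¬zx (Z-resp (trans (∙-congˡ d≈d′) (sym eq)) (Z-double d))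
    cases : ∀ y → D y → D (x - y) → Dec (Z (d - y)) → y ≈ d ⊎ y ≈ d′
    cases y dy dx-y (yes z) = inj₁ (sym (D-injective dd dy z))
    cases y dy dx-y (no ¬z) with u , _ , unique ← D-difference (d - y) ¬z =
      inj₂ (trans (sym (x-[x-y]≈y x y)) (trans (∙-congˡ (⁻¹-cong x-y≈d)) x-d≈d′))
      where
      shift : x - y - (d - y) ≈ x - d
      shift = trans (∙-congˡ ([x-y]⁻¹≈y-x d y)) (trans (sym (assoc (x - y) y (d ⁻¹))) (∙-congʳ (x∙y⁻¹∙y≈x x y)))
      x-y≈d : x - y ≈ d
      x-y≈d = trans (unique (x - y) dx-y (D-resp (sym (trans shift x-d≈d′)) dd′))
        (sym (unique d dd (D-resp (sym (x-[x-y]≈y d y)) dy)))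

  cube-identity : ∀ a → hat φ a ℂ.* hat φ a ℂ.* hat φ a ≡
                  sgn ℂ.* q ℂ.* conj (hat φ a) ℂ.+ (q ℂ.- sgn) ℂ.* hat one a
  cube-identity a = cases (proj₁ (hasClass a)) (HasClass.hat-φ (proj₂ (hasClass a))) (HasClass.hat-1 (proj₂ (hasClass a)))
    where
    open Solver
    cases : ∀ j {X o} → X ≡ w j → o ≡ r j → X ℂ.* X ℂ.* X ≡ sgn ℂ.* q ℂ.* conj X ℂ.+ (q ℂ.- sgn) ℂ.* o
    cases 0F ≡.refl ≡.refl = solve 2 (λ q s → q :* q :* q := s :* q :* q :+ (q :- s) :* (q :* q)) ≡.refl q sgn
    cases 1F ≡.refl ≡.refl = solve 2 (λ q s → con ℂ.0# :* con ℂ.0# :* con ℂ.0# := s :* q :* con ℂ.0# :+ (q :- s) :* con ℂ.0#) ≡.refl q sgn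
    cases (suc (suc k)) {X} ≡.refl o≡ = ≡.trans (cube k) (≡.trans
      (solve 3 (λ x q s → x := x :+ (q :- s) :* con ℂ.0#) ≡.refl (sgn ℂ.* q ℂ.* conj X) q sgn)
      (cong (λ t → sgn ℂ.* q ℂ.* conj X ℂ.+ (q ℂ.- sgn) ℂ.* t) (≡.sym (≡.trans o≡ (Vec.lookup-replicate k ℂ.0#)))))

  ψ∗φ-resp : Respecting (ψ ∗ φ)
  ψ∗φ-resp = ∗-resp ψ φ φ-resp

  triple : ∀ x → (ψ ∗ φ) x ≡ sgn ℂ.* q ℂ.* φ (x ⁻¹) ℂ.+ (q ℂ.- sgn) ℂ.* one x
  triple = hat-injective (ψ ∗ φ) (λ x → sgn ℂ.* q ℂ.* φ (x ⁻¹) ℂ.+ (q ℂ.- sgn) ℂ.* one x) ψ∗φ-resp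
    (λ x≈y → cong (λ t → sgn ℂ.* q ℂ.* t ℂ.+ (q ℂ.- sgn) ℂ.* ℂ.1#) (φ-resp (⁻¹-cong x≈y)))
    λ a → begin
      hat (ψ ∗ φ) a
        ≡⟨ ≡.trans (hat-∗ ψ φ φ-resp a) (cong (ℂ._* hat φ a) (hat-∗ φ φ φ-resp a)) ⟩
      hat φ a ℂ.* hat φ a ℂ.* hat φ a
        ≡⟨ cube-identity a ⟩
      sgn ℂ.* q ℂ.* conj (hat φ a) ℂ.+ (q ℂ.- sgn) ℂ.* hat one a
        ≡⟨ cong₂ ℂ._+_ (≡.trans (hat-* (sgn ℂ.* q) (φ ∘ _⁻¹) a) (cong (sgn ℂ.* q ℂ.*_) (hat-φ⁻¹ a))) (hat-* (q ℂ.- sgn) one a) ⟨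
      hat (λ x → sgn ℂ.* q ℂ.* φ (x ⁻¹)) a ℂ.+ hat (λ x → (q ℂ.- sgn) ℂ.* one x) a
        ≡⟨ hat-+ (λ x → sgn ℂ.* q ℂ.* φ (x ⁻¹)) (λ x → (q ℂ.- sgn) ℂ.* one x) a ⟨
      hat (λ x → sgn ℂ.* q ℂ.* φ (x ⁻¹) ℂ.+ (q ℂ.- sgn) ℂ.* one x) a ∎
    where open ≡-Reasoning

  S₂∩M? : Decidable λ x → S 2F x × M x
  S₂∩M? x = S? 2F x ×-dec M? x

  S₂∖M? : Decidable λ x → S 2F x × ¬ M x
  S₂∖M? x = S? 2F x ×-dec ¬? (M? x)

  M-resp : ∀ {x y} → x ≈ y → M x → M y
  M-resp x≈y (z , dz , d) = z , dz , D-resp (∙-congʳ x≈y) d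

  D⁻¹-cases : ∀ x → φ (x ⁻¹) ≡ 𝟙 (x ≟ ε) ℂ.+ (𝟙 (S₂∩M? x) ℂ.+ 𝟙 (S₂∖M? x))
  D⁻¹-cases x = cases (x ≟ ε) (D? (x ⁻¹))
    where
    cases : Dec (x ≈ ε) → Dec (D (x ⁻¹)) → φ (x ⁻¹) ≡ 𝟙 (x ≟ ε) ℂ.+ (𝟙 (S₂∩M? x) ℂ.+ 𝟙 (S₂∖M? x))
    cases (yes x≈ε) _ = ≡.trans (𝟙-true (D? (x ⁻¹)) (D-resp (sym (trans (⁻¹-cong x≈ε) ε⁻¹≈ε)) D-ε))
      (≡.sym (cong₂ ℂ._+_ (𝟙-true (x ≟ ε) x≈ε) (cong₂ ℂ._+_
        (𝟙-false (S₂∩M? x) λ (s , _) → proj₂ (S⇒Class s) x≈ε)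
        (𝟙-false (S₂∖M? x) λ (s , _) → proj₂ (S⇒Class s) x≈ε))))
    cases (no x≉ε) (no ¬d) = ≡.trans (𝟙-false (D? (x ⁻¹)) ¬d)
      (≡.sym (cong₂ ℂ._+_ (𝟙-false (x ≟ ε) x≉ε) (cong₂ ℂ._+_
        (𝟙-false (S₂∩M? x) λ (s , _) → ¬d (proj₁ (S⇒Class s)))
        (𝟙-false (S₂∖M? x) λ (s , _) → ¬d (proj₁ (S⇒Class s))))))
    cases (no x≉ε) (yes d) = ≡.trans (𝟙-true (D? (x ⁻¹)) d)
      (≡.sym (cong₂ ℂ._+_ (𝟙-false (x ≟ ε) x≉ε) (M-cases (M? x))))
      where
      M-cases : Dec (M x) → 𝟙 (S₂∩M? x) ℂ.+ 𝟙 (S₂∖M? x) ≡ ℂ.1#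
      M-cases (yes m) = cong₂ ℂ._+_ (𝟙-true (S₂∩M? x) (Class⇒S (d , x≉ε) , m)) (𝟙-false (S₂∖M? x) λ (_ , ¬m) → ¬m m)
      M-cases (no ¬m) = cong₂ ℂ._+_ (𝟙-false (S₂∩M? x) λ (_ , m) → ¬m m) (𝟙-true (S₂∖M? x) (Class⇒S (d , x≉ε) , ¬m))

  S₂⇒¬Z : ∀ {x} → Class 2F x → ¬ Z x
  S₂⇒¬Z (d , x≉ε) zx = x≉ε (x⁻¹≈ε⇒x≈ε (D∩Z d (Z-⁻¹ zx)))

  triple-terms : ∀ y → ψ y ℂ.* φ (ε - y) ≡ 𝟙 (y ≟ ε) ℂ.+ fromℕ 2 ℂ.* 𝟙 (S₂∩M? y)
  triple-terms y = ≡.trans (cong (ψ y ℂ.*_) (φ-resp (identityˡ (y ⁻¹)))) (cases (y ≟ ε) (D? (y ⁻¹)))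
    where
    cases : Dec (y ≈ ε) → Dec (D (y ⁻¹)) → ψ y ℂ.* φ (y ⁻¹) ≡ 𝟙 (y ≟ ε) ℂ.+ fromℕ 2 ℂ.* 𝟙 (S₂∩M? y)
    cases (yes y≈ε) _ = ≡.trans
      (cong₂ ℂ._*_ (ψ-Z (Z-resp (sym y≈ε) Z-ε)) (𝟙-true (D? (y ⁻¹)) (D-resp (sym (trans (⁻¹-cong y≈ε) ε⁻¹≈ε)) D-ε)))
      (≡.sym (cong₂ (λ u v → u ℂ.+ fromℕ 2 ℂ.* v) (𝟙-true (y ≟ ε) y≈ε) (𝟙-false (S₂∩M? y) λ (s , _) → proj₂ (S⇒Class s) y≈ε)))
    cases (no y≉ε) (no ¬d) = ≡.trans
      (≡.trans (cong (ψ y ℂ.*_) (𝟙-false (D? (y ⁻¹)) ¬d)) (z*0 (ψ y)))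
      (≡.sym (cong₂ (λ u v → u ℂ.+ fromℕ 2 ℂ.* v) (𝟙-false (y ≟ ε) y≉ε) (𝟙-false (S₂∩M? y) λ (s , _) → ¬d (proj₁ (S⇒Class s)))))
    cases (no y≉ε) (yes d) = ≡.trans
      (≡.trans (cong (ψ y ℂ.*_) (𝟙-true (D? (y ⁻¹)) d)) (z*1 (ψ y)))
      (≡.trans (M-cases (M? y)) (cong (ℂ._+ fromℕ 2 ℂ.* 𝟙 (S₂∩M? y)) (≡.sym (𝟙-false (y ≟ ε) y≉ε))))
      where
      M-cases : Dec (M y) → ψ y ≡ ℂ.0# ℂ.+ fromℕ 2 ℂ.* 𝟙 (S₂∩M? y)
      M-cases (yes m) = ≡.trans (ψ-SumOfTwo (S₂⇒¬Z (d , y≉ε)) (M⇒SumOfTwo m))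
        (cong (λ t → ℂ.0# ℂ.+ fromℕ 2 ℂ.* t) (≡.sym (𝟙-true (S₂∩M? y) (Class⇒S (d , y≉ε) , m))))
      M-cases (no ¬m) = ≡.trans (ψ-¬M (¬m ∘ SumOfTwo⇒M))
        (cong (λ t → ℂ.0# ℂ.+ fromℕ 2 ℂ.* t) (≡.sym (𝟙-false (S₂∩M? y) (¬m ∘ proj₂))))

  count-S₂ : ℂ.1# ℂ.+ (count S₂∩M? ℂ.+ count S₂∖M?) ≡ q
  count-S₂ = begin
    ℂ.1# ℂ.+ (count S₂∩M? ℂ.+ count S₂∖M?)
      ≡⟨ cong₂ ℂ._+_ (sumAll-𝟙≟ ε) (sumAll-+ (λ x → 𝟙 (S₂∩M? x)) (λ x → 𝟙 (S₂∖M? x))) ⟨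
    sumAll (λ x → 𝟙 (x ≟ ε)) ℂ.+ sumAll (λ x → 𝟙 (S₂∩M? x) ℂ.+ 𝟙 (S₂∖M? x))
      ≡⟨ sumAll-+ (λ x → 𝟙 (x ≟ ε)) (λ x → 𝟙 (S₂∩M? x) ℂ.+ 𝟙 (S₂∖M? x)) ⟨
    sumAll (λ x → 𝟙 (x ≟ ε) ℂ.+ (𝟙 (S₂∩M? x) ℂ.+ 𝟙 (S₂∖M? x)))
      ≡⟨ sumAll-cong D⁻¹-cases ⟨
    sumAll (λ x → φ (x ⁻¹))
      ≡⟨ sumAll-permute {_⁻¹} {_⁻¹} ⁻¹-cong ⁻¹-cong ⁻¹-involutive ⁻¹-involutive {φ} φ-resp ⟩
    sumAll φ
      ≡⟨ count-D ⟩
    q ∎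
    where open ≡-Reasoning

  count-S₂∩M : ℂ.1# ℂ.+ fromℕ 2 ℂ.* count S₂∩M? ≡ sgn ℂ.* q ℂ.+ (q ℂ.- sgn)
  count-S₂∩M = begin
    ℂ.1# ℂ.+ fromℕ 2 ℂ.* count S₂∩M?
      ≡⟨ cong₂ ℂ._+_ (sumAll-𝟙≟ ε) (sumAll-*ˡ (fromℕ 2) (λ x → 𝟙 (S₂∩M? x))) ⟨
    sumAll (λ x → 𝟙 (x ≟ ε)) ℂ.+ sumAll (λ x → fromℕ 2 ℂ.* 𝟙 (S₂∩M? x))
      ≡⟨ sumAll-+ (λ x → 𝟙 (x ≟ ε)) (λ x → fromℕ 2 ℂ.* 𝟙 (S₂∩M? x)) ⟨
    sumAll (λ x → 𝟙 (x ≟ ε) ℂ.+ fromℕ 2 ℂ.* 𝟙 (S₂∩M? x))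
      ≡⟨ sumAll-cong triple-terms ⟨
    (ψ ∗ φ) ε
      ≡⟨ triple ε ⟩
    sgn ℂ.* q ℂ.* φ (ε ⁻¹) ℂ.+ (q ℂ.- sgn) ℂ.* ℂ.1#
      ≡⟨ cong (λ t → sgn ℂ.* q ℂ.* t ℂ.+ (q ℂ.- sgn) ℂ.* ℂ.1#) (𝟙-true (D? (ε ⁻¹)) (D-resp (sym ε⁻¹≈ε) D-ε)) ⟩
    sgn ℂ.* q ℂ.* ℂ.1# ℂ.+ (q ℂ.- sgn) ℂ.* ℂ.1#
      ≡⟨ solve 2 (λ s q → s :* q :* con ℂ.1# :+ (q :- s) :* con ℂ.1# := s :* q :+ (q :- s)) ≡.refl sgn q ⟩
    sgn ℂ.* q ℂ.+ (q ℂ.- sgn) ∎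
    where
    open ≡-Reasoning
    open Solver

  2≢0 : fromℕ 2 ≢ ℂ.0#
  2≢0 = fromℕ≢0 {2} λ ()

  ψ-S₂ : ∀ {x} → Class 2F x → ψ x ≡ ℂ.1# ℂ.+ sgn
  ψ-S₂ {x} cx = cases sgn≡±1
    where
    open Solver
    cases : sgn ≡ ℂ.1# ⊎ sgn ≡ ℂ.- ℂ.1# → ψ x ≡ ℂ.1# ℂ.+ sgn
    cases (inj₁ sgn≡1) = ≡.trans (ψ-SumOfTwo (S₂⇒¬Z cx) (M⇒SumOfTwo (M-holds (M? x)))) (cong (ℂ.1# ℂ.+_) (≡.sym sgn≡1))
      where
      S₂∖M-empty : ∀ y → ¬ (S 2F y × ¬ M y)
      S₂∖M-empty = count≡0⇒¬ S₂∖M? (λ y≈z (s , ¬m) → S-resp 2F y≈z s , λ m → ¬m (M-resp (sym y≈z) m))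
        (z*w≡0⇒w≡0 {fromℕ 2} {count S₂∖M?} 2≢0 (≡.trans
          (solve 2 (λ c c′ → con (fromℕ 2) :* c′ := con (fromℕ 2) :* (con ℂ.1# :+ (c :+ c′)) :- (con ℂ.1# :+ con (fromℕ 2) :* c) :- con ℂ.1#) ≡.refl (count S₂∩M?) (count S₂∖M?))
          (≡.trans (cong₂ (λ u v → fromℕ 2 ℂ.* u ℂ.- v ℂ.- ℂ.1#) count-S₂ (≡.trans count-S₂∩M (cong (λ t → t ℂ.* q ℂ.+ (q ℂ.- t)) sgn≡1)))
          (solve 1 (λ q → con (fromℕ 2) :* q :- (con ℂ.1# :* q :+ (q :- con ℂ.1#)) :- con ℂ.1# := con ℂ.0#) ≡.refl q))))
      M-holds : Dec (M x) → M x
      M-holds (yes m) = m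
      M-holds (no ¬m) = contradiction (Class⇒S cx , ¬m) (S₂∖M-empty x)
    cases (inj₂ sgn≡-1) = ≡.trans (ψ-¬M λ m → S₂∩M-empty x (Class⇒S cx , SumOfTwo⇒M m)) (cong (ℂ.1# ℂ.+_) (≡.sym sgn≡-1))
      where
      S₂∩M-empty : ∀ y → ¬ (S 2F y × M y)
      S₂∩M-empty = count≡0⇒¬ S₂∩M? (λ y≈z (s , m) → S-resp 2F y≈z s , M-resp y≈z m)
        (z*w≡0⇒w≡0 {fromℕ 2} {count S₂∩M?} 2≢0 (≡.trans
          (solve 1 (λ c → con (fromℕ 2) :* c := (con ℂ.1# :+ con (fromℕ 2) :* c) :- con ℂ.1#) ≡.refl (count S₂∩M?))
          (≡.trans (cong (ℂ._- ℂ.1#) (≡.trans count-S₂∩M (cong (λ t → t ℂ.* q ℂ.+ (q ℂ.- t)) sgn≡-1)))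
          (solve 1 (λ q → con (ℂ.- ℂ.1#) :* q :+ (q :- con (ℂ.- ℂ.1#)) :- con ℂ.1# := con ℂ.0#) ≡.refl q))))

  D⇒S₀₋₃ : ∀ {x} → D x → S₀₋₃ x
  D⇒S₀₋₃ {x} dx with x ≟ ε
  ... | yes x≈ε = inj₁ x≈ε
  ... | no x≉ε  = inj₂ (inj₁ (dx , x≉ε))

  D⁻¹⇒S₀₋₃ : ∀ {x} → D (x ⁻¹) → S₀₋₃ x
  D⁻¹⇒S₀₋₃ {x} dx⁻¹ with x ≟ ε
  ... | yes x≈ε = inj₁ x≈ε
  ... | no x≉ε  = inj₂ (inj₂ (inj₁ (dx⁻¹ , x≉ε)))

  Z⇒S₀₋₃ : ∀ {x} → Z x → S₀₋₃ x
  Z⇒S₀₋₃ {x} zx with x ≟ ε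
  ... | yes x≈ε = inj₁ x≈ε
  ... | no x≉ε  = inj₂ (inj₂ (inj₂ (zx , x≉ε)))

  ψ-class : ∀ i x → Class i x → ψ x ≡ lookup (ℂ.1# ∷ fromℕ 2 ∷ ℂ.1# ℂ.+ sgn ∷ ℂ.1# ∷ fromℕ 2 ∷ ℂ.0# ∷ []) i
  ψ-class 0F x x≈ε = ψ-Z (Z-resp (sym x≈ε) Z-ε)
  ψ-class 1F x (dx , x≉ε) = ψ-SumOfTwo (λ zx → x≉ε (D∩Z dx zx)) (ε , x , D-ε , dx , sym (identityˡ x))
  ψ-class 2F x c = ψ-S₂ c
  ψ-class 3F x (zx , _) = ψ-Z zx
  ψ-class 4F x (¬s , m) = ψ-SumOfTwo (λ zx → ¬s (Z⇒S₀₋₃ zx)) m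
  ψ-class 5F x (_ , ¬m) = ψ-¬M ¬m

  φ-class : ∀ i x → Class i x → φ x ≡ lookup (ℂ.1# ∷ ℂ.1# ∷ ℂ.0# ∷ ℂ.0# ∷ ℂ.0# ∷ ℂ.0# ∷ []) i
  φ-class 0F x x≈ε = 𝟙-true (D? x) (D-resp (sym x≈ε) D-ε)
  φ-class 1F x (dx , _) = 𝟙-true (D? x) dx
  φ-class 2F x (d⁻ , x≉ε) = 𝟙-false (D? x) λ dx → x≉ε (D∩D⁻¹ dx d⁻)
  φ-class 3F x (zx , x≉ε) = 𝟙-false (D? x) λ dx → x≉ε (D∩Z dx zx)
  φ-class 4F x (¬s , _) = 𝟙-false (D? x) λ dx → ¬s (D⇒S₀₋₃ dx)
  φ-class 5F x (_ , ¬m) = 𝟙-false (D? x) λ dx → ¬m (ε , x , D-ε , dx , sym (identityˡ x))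

  φ⁻¹-class : ∀ i x → Class i x → φ (x ⁻¹) ≡ lookup (ℂ.1# ∷ ℂ.0# ∷ ℂ.1# ∷ ℂ.0# ∷ ℂ.0# ∷ ℂ.0# ∷ []) i
  φ⁻¹-class 0F x x≈ε = 𝟙-true (D? (x ⁻¹)) (D-resp (sym (trans (⁻¹-cong x≈ε) ε⁻¹≈ε)) D-ε)
  φ⁻¹-class 1F x (dx , x≉ε) = 𝟙-false (D? (x ⁻¹)) λ d⁻ → x≉ε (D∩D⁻¹ dx d⁻)
  φ⁻¹-class 2F x (d⁻ , _) = 𝟙-true (D? (x ⁻¹)) d⁻
  φ⁻¹-class 3F x (zx , x≉ε) = 𝟙-false (D? (x ⁻¹)) λ d⁻ → x≉ε (x⁻¹≈ε⇒x≈ε (D∩Z d⁻ (Z-⁻¹ zx)))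
  φ⁻¹-class 4F x (¬s , _) = 𝟙-false (D? (x ⁻¹)) λ d⁻ → ¬s (D⁻¹⇒S₀₋₃ d⁻)
  φ⁻¹-class 5F x (¬s , _) = 𝟙-false (D? (x ⁻¹)) λ d⁻ → ¬s (D⁻¹⇒S₀₋₃ d⁻)

  ζ-class : ∀ i x → Class i x → ζ x ≡ lookup (ℂ.1# ∷ ℂ.0# ∷ ℂ.0# ∷ ℂ.1# ∷ ℂ.0# ∷ ℂ.0# ∷ []) i
  ζ-class 0F x x≈ε = 𝟙-true (Z? x) (Z-resp (sym x≈ε) Z-ε)
  ζ-class 1F x (dx , x≉ε) = 𝟙-false (Z? x) λ zx → x≉ε (D∩Z dx zx)
  ζ-class 2F x c = 𝟙-false (Z? x) (S₂⇒¬Z c)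
  ζ-class 3F x (zx , _) = 𝟙-true (Z? x) zx
  ζ-class 4F x (¬s , _) = 𝟙-false (Z? x) λ zx → ¬s (Z⇒S₀₋₃ zx)
  ζ-class 5F x (¬s , _) = 𝟙-false (Z? x) λ zx → ¬s (Z⇒S₀₋₃ zx)

  private
    Pₑ Qₑ : Fin 6 → Fin 6 → ℚ[i]
    Pₑ = Values.entry P
    Qₑ = Values.entry Q

  s-hat : Fin 6 → Carrier → ℚ[i]
  s-hat i a = hat (s i) a

  row : ∀ a {j} → HasClass a j → ∀ i → s-hat i a ≡ Pₑ j i
  row a {j} c = λ where
      0F → ≡.trans h₀ (≡.sym (row₀ j))
      1F → ≡.trans h₁ (≡.sym (row₁ j))
      2F → ≡.trans h₂ (≡.sym (row₂ j))
      3F → ≡.trans h₃ (≡.sym (row₃ j))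
      4F → h₄
      5F → h₅
    where
    open HasClass c
    open ≡-Reasoning
    open Solver
    h : Fin 6 → ℚ[i]
    h i = s-hat i a
    X : ℚ[i]
    X = hat φ a

    h₀ : h 0F ≡ ℂ.1#
    h₀ = ≡.trans (hat-cong (λ x → 𝟙-cong (S? 0F x) (x ≟ ε) S⇒Class Class⇒S) a) (hat-𝟙≟ε a)

    difference-of : ∀ {x u v} → u ≡ ℂ.1# → x ≡ u ℂ.+ v → v ≡ x ℂ.- ℂ.1#
    difference-of {x} {u} {v} u≡1 x≡ = ≡.trans (solve 1 (λ v → v := (con ℂ.1# :+ v) :- con ℂ.1#) ≡.refl v)
      (cong (ℂ._- ℂ.1#) (≡.trans (cong (ℂ._+ v) (≡.sym u≡1)) (≡.sym x≡)))

    X≡ : X ≡ h 0F ℂ.+ h 1F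
    X≡ = ≡.trans (hat-classwise φ _ φ-class a)
      (solve 6 (λ a b c d e f → con ℂ.1# :* a :+ (con ℂ.1# :* b :+ (con ℂ.0# :* c :+ (con ℂ.0# :* d :+ (con ℂ.0# :* e :+ (con ℂ.0# :* f :+ con ℂ.0#)))))
        := a :+ b) ≡.refl (h 0F) (h 1F) (h 2F) (h 3F) (h 4F) (h 5F))

    conj-X≡ : conj X ≡ h 0F ℂ.+ h 2F
    conj-X≡ = ≡.trans (≡.sym (hat-φ⁻¹ a)) (≡.trans (hat-classwise (φ ∘ _⁻¹) _ φ⁻¹-class a)
      (solve 6 (λ a b c d e f → con ℂ.1# :* a :+ (con ℂ.0# :* b :+ (con ℂ.1# :* c :+ (con ℂ.0# :* d :+ (con ℂ.0# :* e :+ (con ℂ.0# :* f :+ con ℂ.0#)))))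
        := a :+ c) ≡.refl (h 0F) (h 1F) (h 2F) (h 3F) (h 4F) (h 5F)))

    ζ≡ : hat ζ a ≡ h 0F ℂ.+ h 3F
    ζ≡ = ≡.trans (hat-classwise ζ _ ζ-class a)
      (solve 6 (λ a b c d e f → con ℂ.1# :* a :+ (con ℂ.0# :* b :+ (con ℂ.0# :* c :+ (con ℂ.1# :* d :+ (con ℂ.0# :* e :+ (con ℂ.0# :* f :+ con ℂ.0#)))))
        := a :+ d) ≡.refl (h 0F) (h 1F) (h 2F) (h 3F) (h 4F) (h 5F))

    X²≡ : X ℂ.* X ≡ h 0F ℂ.+ fromℕ 2 ℂ.* h 1F ℂ.+ (ℂ.1# ℂ.+ sgn) ℂ.* h 2F ℂ.+ h 3F ℂ.+ fromℕ 2 ℂ.* h 4F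
    X²≡ = ≡.trans (≡.sym (hat-∗ φ φ φ-resp a)) (≡.trans (hat-classwise ψ _ ψ-class a)
      (solve 7 (λ a b c d e f g → con ℂ.1# :* a :+ (con (fromℕ 2) :* b :+ ((con ℂ.1# :+ g) :* c :+ (con ℂ.1# :* d :+ (con (fromℕ 2) :* e :+ (con ℂ.0# :* f :+ con ℂ.0#)))))
        := a :+ con (fromℕ 2) :* b :+ (con ℂ.1# :+ g) :* c :+ d :+ con (fromℕ 2) :* e) ≡.refl (h 0F) (h 1F) (h 2F) (h 3F) (h 4F) (h 5F) sgn))

    one≡ : hat one a ≡ ℂ.sum h
    one≡ = ≡.trans (hat-classwise one (λ _ → ℂ.1#) (λ _ _ _ → ≡.refl) a) (sum-cong-≗ λ i → 1*z (h i))

    h₁ : h 1F ≡ w j ℂ.- ℂ.1#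
    h₁ = ≡.trans (difference-of h₀ X≡) (cong (ℂ._- ℂ.1#) hat-φ)

    h₂ : h 2F ≡ conj (w j) ℂ.- ℂ.1#
    h₂ = ≡.trans (difference-of h₀ conj-X≡) (cong (λ t → conj t ℂ.- ℂ.1#) hat-φ)

    h₃ : h 3F ≡ z j ℂ.- ℂ.1#
    h₃ = ≡.trans (difference-of h₀ ζ≡) (cong (ℂ._- ℂ.1#) hat-ζ)

    h₄ : h 4F ≡ Pₑ j 4F
    h₄ = *-cancelˡ {fromℕ 2} (h 4F) (Pₑ j 4F) 2≢0 (begin
      fromℕ 2 ℂ.* h 4F
        ≡⟨ solve 6 (λ a b c d e g → con (fromℕ 2) :* e
             := (a :+ con (fromℕ 2) :* b :+ (con ℂ.1# :+ g) :* c :+ d :+ con (fromℕ 2) :* e) :- (a :+ d) :- con (fromℕ 2) :* b :- (con ℂ.1# :+ g) :* c)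
             ≡.refl (h 0F) (h 1F) (h 2F) (h 3F) (h 4F) sgn ⟩
      (h 0F ℂ.+ fromℕ 2 ℂ.* h 1F ℂ.+ (ℂ.1# ℂ.+ sgn) ℂ.* h 2F ℂ.+ h 3F ℂ.+ fromℕ 2 ℂ.* h 4F) ℂ.- (h 0F ℂ.+ h 3F) ℂ.- fromℕ 2 ℂ.* h 1F ℂ.- (ℂ.1# ℂ.+ sgn) ℂ.* h 2F
        ≡⟨ cong₂ (λ u v → u ℂ.- v ℂ.- fromℕ 2 ℂ.* h 1F ℂ.- (ℂ.1# ℂ.+ sgn) ℂ.* h 2F)
             (≡.trans (≡.sym X²≡) (cong (λ t → t ℂ.* t) hat-φ)) (≡.trans (≡.sym ζ≡) hat-ζ) ⟩
      w j ℂ.* w j ℂ.- z j ℂ.- fromℕ 2 ℂ.* h 1F ℂ.- (ℂ.1# ℂ.+ sgn) ℂ.* h 2F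
        ≡⟨ cong₂ (λ u v → w j ℂ.* w j ℂ.- z j ℂ.- fromℕ 2 ℂ.* u ℂ.- (ℂ.1# ℂ.+ sgn) ℂ.* v) h₁ h₂ ⟩
      w j ℂ.* w j ℂ.- z j ℂ.- fromℕ 2 ℂ.* (w j ℂ.- ℂ.1#) ℂ.- (ℂ.1# ℂ.+ sgn) ℂ.* (conj (w j) ℂ.- ℂ.1#)
        ≡⟨ row₄ j ⟨
      fromℕ 2 ℂ.* Pₑ j 4F ∎)

    first : (f : Fin 6 → ℚ[i]) → ℚ[i]
    first f = f 0F ℂ.+ f 1F ℂ.+ f 2F ℂ.+ f 3F ℂ.+ f 4F

    last≡ : ∀ (f : Fin 6 → ℚ[i]) → f 5F ≡ ℂ.sum f ℂ.- first f
    last≡ f = solve 6 (λ a b c d e f → f := (a :+ (b :+ (c :+ (d :+ (e :+ (f :+ con ℂ.0#)))))) :- (a :+ b :+ c :+ d :+ e))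
      ≡.refl (f 0F) (f 1F) (f 2F) (f 3F) (f 4F) (f 5F)

    h₅ : h 5F ≡ Pₑ j 5F
    h₅ = ≡.trans (last≡ h) (≡.trans
      (cong₂ ℂ._-_ (≡.trans (≡.sym one≡) (≡.trans hat-1 (≡.sym (rowSum j))))
        (cong₂ ℂ._+_ (cong₂ ℂ._+_ (cong₂ ℂ._+_ (cong₂ ℂ._+_ (≡.trans h₀ (≡.sym (row₀ j))) (≡.trans h₁ (≡.sym (row₁ j))))
          (≡.trans h₂ (≡.sym (row₂ j)))) (≡.trans h₃ (≡.sym (row₃ j)))) h₄))
      (≡.sym (last≡ (Pₑ j))))

  class : Carrier → Fin 6
  class a = proj₁ (hasClass a)

  class-hasClass : ∀ a → HasClass a (class a)
  class-hasClass a = proj₂ (hasClass a)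

  s-hat≡P : ∀ i a → s-hat i a ≡ Pₑ (class a) i
  s-hat≡P i a = row a (class-hasClass a) i

  ν : ℚ[i]
  ν = ℂ.1# ℂ.÷ fromℕ N

  ν*N≡1 : ν ℂ.* (q ℂ.* q) ≡ ℂ.1#
  ν*N≡1 = ≡.trans (cong (ν ℂ.*_) (≡.sym N≡q*q)) (≡.trans (cong (ℂ._* fromℕ N) (≡.sym (÷-unique {u} {ℂ.1#} {fromℕ N} N≢0ℂ u*N≡1))) u*N≡1)
    where
    N≢0ℂ : fromℕ N ≢ ℂ.0#
    N≢0ℂ = fromℕ≢0 N≢0
    u : ℚ[i]
    u = proj₁ (ℚ[i]-Domain.inverse (fromℕ N) N≢0ℂ)
    u*N≡1 : u ℂ.* fromℕ N ≡ ℂ.1#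
    u*N≡1 = proj₂ (ℚ[i]-Domain.inverse (fromℕ N) N≢0ℂ)

  e : Fin 6 → Carrier → ℚ[i]
  e j x = ν ℂ.* ℂ.sum λ k → Qₑ k j ℂ.* s k x

  e-resp : ∀ j → Respecting (e j)
  e-resp j x≈y = cong (ν ℂ.*_) (sum-cong-≗ λ k → cong (Qₑ k j ℂ.*_) (s-resp k x≈y))

  e-class : ∀ j {k x} → S k x → e j x ≡ ν ℂ.* Qₑ k j
  e-class j skx = cong (ν ℂ.*_) (combination-s (λ k → Qₑ k j) skx)

  hat-e : ∀ j a → hat (e j) a ≡ 𝟙 (class a Fin.≟ j)
  hat-e j a = begin
    hat (e j) a
      ≡⟨ hat-* ν (λ x → ℂ.sum λ k → Qₑ k j ℂ.* s k x) a ⟩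
    ν ℂ.* hat (λ x → ℂ.sum λ k → Qₑ k j ℂ.* s k x) a
      ≡⟨ cong (ν ℂ.*_) (≡.trans (hat-combination (λ k → Qₑ k j) s a)
           (sum-cong-≗ λ k → ≡.trans (*-comm (Qₑ k j) (s-hat k a)) (cong (ℂ._* Qₑ k j) (s-hat≡P k a)))) ⟩
    ν ℂ.* ℂ.sum (λ k → Pₑ (class a) k ℂ.* Qₑ k j)
      ≡⟨ cong (ν ℂ.*_) (P*Q (class a) j) ⟩
    ν ℂ.* (𝟙 (class a Fin.≟ j) ℂ.* (q ℂ.* q))
      ≡⟨ solve 3 (λ n d q → n :* (d :* q) := d :* (n :* q)) ≡.refl ν (𝟙 (class a Fin.≟ j)) (q ℂ.* q) ⟩
    𝟙 (class a Fin.≟ j) ℂ.* (ν ℂ.* (q ℂ.* q))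
      ≡⟨ cong (𝟙 (class a Fin.≟ j) ℂ.*_) ν*N≡1 ⟩
    𝟙 (class a Fin.≟ j) ℂ.* ℂ.1#
      ≡⟨ ≡.trans (*-comm (𝟙 (class a Fin.≟ j)) ℂ.1#) (1*z (𝟙 (class a Fin.≟ j))) ⟩
    𝟙 (class a Fin.≟ j) ∎
    where
    open ≡-Reasoning
    open Solver

  sum-δ : ∀ (c : Fin 6 → ℚ[i]) m → ℂ.sum (λ j → c j ℂ.* 𝟙 (m Fin.≟ j)) ≡ c m
  sum-δ c m = ≡.trans
    (sum-single _ m λ j j≢m → ≡.trans (cong (c j ℂ.*_) (𝟙-false (m Fin.≟ j) (j≢m ∘ ≡.sym)))
      (z*0 (c j)))
    (≡.trans (cong (c m ℂ.*_) (𝟙-true (m Fin.≟ m) ≡.refl)) (z*1 (c m)))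

  combination-e-resp : ∀ (c : Fin 6 → ℚ[i]) → Respecting (λ x → ℂ.sum λ j → c j ℂ.* e j x)
  combination-e-resp c x≈y = sum-cong-≗ λ j → cong (c j ℂ.*_) (e-resp j x≈y)

  hat-combination-e : ∀ (c : Fin 6 → ℚ[i]) a → hat (λ x → ℂ.sum λ j → c j ℂ.* e j x) a ≡ c (class a)
  hat-combination-e c a = ≡.trans (hat-combination c e a)
    (≡.trans (sum-cong-≗ λ j → cong (c j ℂ.*_) (hat-e j a)) (sum-δ c (class a)))

  determined-by-hat : ∀ ρ → Respecting ρ → (c : Fin 6 → ℚ[i]) → (∀ a → hat ρ a ≡ c (class a)) →
                      ∀ x → ρ x ≡ ℂ.sum λ j → c j ℂ.* e j x
  determined-by-hat ρ ρ-resp c eq = hat-injective ρ (λ x → ℂ.sum λ j → c j ℂ.* e j x) ρ-resp (combination-e-resp c)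
    λ a → ≡.trans (eq a) (≡.sym (hat-combination-e c a))

  s-expansion : ∀ i x → s i x ≡ ℂ.sum λ j → Pₑ j i ℂ.* e j x
  s-expansion i = determined-by-hat (s i) (s-resp i) (λ j → Pₑ j i) (s-hat≡P i)

  s∗s-expansion : ∀ i j x → (s i ∗ s j) x ≡ ℂ.sum λ m → (Pₑ m i ℂ.* Pₑ m j) ℂ.* e m x
  s∗s-expansion i j = determined-by-hat (s i ∗ s j) (∗-resp (s i) (s j) (s-resp j)) (λ m → Pₑ m i ℂ.* Pₑ m j)
    λ a → ≡.trans (hat-∗ (s i) (s j) (s-resp j) a) (cong₂ ℂ._*_ (s-hat≡P i a) (s-hat≡P j a))

  s∗s-comm : ∀ i j x → (s i ∗ s j) x ≡ (s j ∗ s i) x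
  s∗s-comm i j x = ≡.trans (s∗s-expansion i j x) (≡.trans
    (sum-cong-≗ λ m → cong (ℂ._* e m x) (*-comm (Pₑ m i) (Pₑ m j))) (≡.sym (s∗s-expansion j i x)))

  e∗e-idempotent : ∀ i x → (e i ∗ e i) x ≡ e i x
  e∗e-idempotent i = hat-injective (e i ∗ e i) (e i) (∗-resp (e i) (e i) (e-resp i)) (e-resp i) λ a →
    ≡.trans (hat-∗ (e i) (e i) (e-resp i) a) (≡.trans (cong (λ t → t ℂ.* t) (hat-e i a))
      (≡.trans (𝟙² (class a Fin.≟ i)) (≡.sym (hat-e i a))))
    where
    𝟙² : {A : Set} (d : Dec A) → 𝟙 d ℂ.* 𝟙 d ≡ 𝟙 d
    𝟙² (yes _) = ≡.refl
    𝟙² (no _)  = ≡.refl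

  e∗e-orthogonal : ∀ i j → i ≢ j → ∀ x → (e i ∗ e j) x ≡ ℂ.0#
  e∗e-orthogonal i j i≢j = hat-injective (e i ∗ e j) (λ _ → ℂ.0#) (∗-resp (e i) (e j) (e-resp j)) (λ _ → ≡.refl) λ a →
    ≡.trans (hat-∗ (e i) (e j) (e-resp j) a) (≡.trans (cong₂ ℂ._*_ (hat-e i a) (hat-e j a))
      (≡.trans (cases (class a Fin.≟ i) (class a Fin.≟ j)) (≡.sym (sumAll-zero _ λ x → 0*z (χ a x)))))
    where
    cases : ∀ {m} (d : Dec (m ≡ i)) (d′ : Dec (m ≡ j)) → 𝟙 d ℂ.* 𝟙 d′ ≡ ℂ.0#
    cases (yes ≡.refl) (yes m≡j) = contradiction m≡j i≢j
    cases (yes _)      (no _)    = ≡.refl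
    cases (no _)       d′        = 0*z (𝟙 d′)

  opposite-class : ∀ i x → s i (x ⁻¹) ≡ s (opposite i) x
  opposite-class i = hat-injective (s i ∘ _⁻¹) (s (opposite i)) (λ x≈y → s-resp i (⁻¹-cong x≈y)) (s-resp (opposite i)) λ a →
    ≡.trans (hat-⁻¹ (s i) (s-resp i) (λ x → 𝟙-real (S? i x)) a) (≡.trans (cong conj (s-hat≡P i a))
      (≡.trans (conj-P (class a) i) (≡.sym (s-hat≡P (opposite i) a))))

  𝟙-reflects : {A B : Set} (d : Dec A) (d′ : Dec B) → 𝟙 d ≡ 𝟙 d′ → A → B
  𝟙-reflects _       (yes b) _  _ = b
  𝟙-reflects (yes _) (no _)  () _
  𝟙-reflects (no ¬a) (no _)  _  a = contradiction a ¬a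

  S-opposite : ∀ i x → S (opposite i) x ⇔ S i (x ⁻¹)
  S-opposite i x = mk⇔ (𝟙-reflects (S? (opposite i) x) (S? i (x ⁻¹)) (≡.sym (opposite-class i x)))
                       (𝟙-reflects (S? i (x ⁻¹)) (S? (opposite i) x) (opposite-class i x))

  Satisfiable? : ∀ k → Dec (Satisfiable (S k))
  Satisfiable? k = search (S-resp k) (S? k)

  S-pairs? : ∀ i j x → Decidable λ y → S i y × S j (x - y)
  S-pairs? i j x y = S? i y ×-dec S? j (x - y)

  s∗s-count : ∀ i j x → ∃ λ m → (s i ∗ s j) x ≡ fromℕ m
  s∗s-count i j x = proj₁ natural , ≡.trans (sumAll-cong λ y → ≡.sym (𝟙-× (S? i y) (S? j (x - y)))) (proj₂ natural)
    where
    natural : ∃ λ m → ℂ.sum (λ k → 𝟙 (S-pairs? i j x (Inverse.from enum k))) ≡ fromℕ m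
    natural = sum-𝟙-natural (λ k → S-pairs? i j x (Inverse.from enum k))

  classCount : ∀ i j k → Dec (Satisfiable (S k)) → ℕ
  classCount i j k (yes (x , _)) = proj₁ (s∗s-count i j x)
  classCount i j k (no _)        = 0

  intersectionNumber : (i j k : Fin 6) → ℕ
  intersectionNumber i j k = classCount i j k (Satisfiable? k)

  s∗s-constant : ∀ i j {k x y} → S k x → S k y → (s i ∗ s j) x ≡ (s i ∗ s j) y
  s∗s-constant i j {k} {x} {y} skx sky = ≡.trans (s∗s-expansion i j x) (≡.trans
    (sum-cong-≗ λ m → cong ((Pₑ m i ℂ.* Pₑ m j) ℂ.*_) (≡.trans (e-class m skx) (≡.sym (e-class m sky))))
    (≡.sym (s∗s-expansion i j y)))

  s∗s-class : ∀ i j {k x} → S k x → (s i ∗ s j) x ≡ fromℕ (intersectionNumber i j k)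
  s∗s-class i j {k} {x} skx = cases (Satisfiable? k)
    where
    cases : (d : Dec (Satisfiable (S k))) → (s i ∗ s j) x ≡ fromℕ (classCount i j k d)
    cases (yes (y , sky)) = ≡.trans (s∗s-constant i j skx sky) (proj₂ (s∗s-count i j y))
    cases (no empty)      = contradiction (x , skx) empty

  module Subfamily {d : ℕ} (ι : Fin (suc d) → Fin 6) (ι-injective : ∀ {k l} → ι k ≡ ι l → k ≡ l)
    (ι-zero : ι zero ≡ 0F) (ι-satisfiable : ∀ l → Satisfiable (S (ι l)))
    (ι-image : ∀ i → Satisfiable (S i) → ∃ λ l → ι l ≡ i) where

    private
      Sι : Fin (suc d) → Pred Carrier 0ℓ
      Sι l = S (ι l)

      find : ∀ {i x} → S i x → ∃ λ l → Sι l x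
      find {i} {x} six with l , ≡.refl ← ι-image i (x , six) = l , six

      cover : ∀ x → ∃ λ l → Sι l x
      cover x = find (proj₂ (S-covering x))

      Sι? : ∀ l → Decidable (Sι l)
      Sι? l = S? (ι l)

    adjacency-product : ∀ i j x y →
      sumAll (λ z → adjacency enum (difference? G enum Sι?) i x z ℂ.* adjacency enum (difference? G enum Sι?) j z y) ≡
      (s (ι i) ∗ s (ι j)) (x - y)
    adjacency-product i j x y = sumAll-product (s (ι i)) (s (ι j)) x y (s-resp (ι i)) (s-resp (ι j))

    isSchurRing : IsSchurRing G enum Sι?
    isSchurRing = record
      { nonempty = λ l → proj₁ (ι-satisfiable l) , ε , S-resp (ι l) (sym (x-ε≈x _)) (proj₂ (ι-satisfiable l))
      ; covering = λ x y → cover (x - y)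
      ; disjoint = λ p p′ → ι-injective (S-disjoint p p′)
      ; diagonal = λ {x} {y} → mk⇔
          (λ p → x∙y⁻¹≈ε⇒x≈y x y (S⇒Class (subst (λ i → S i (x - y)) ι-zero p)))
          (λ x≈y → subst (λ i → S i (x - y)) (≡.sym ι-zero) (Class⇒S (x≈y⇒x∙y⁻¹≈ε x≈y)))
      ; transpose = transpose
      ; p = λ i j k → intersectionNumber (ι i) (ι j) (ι k)
      ; product = λ i j x y → ≡.trans (adjacency-product i j x y) (≡.sym (product i j (x - y) (proj₂ (cover (x - y)))))
      ; commutative = λ i j x y → ≡.trans (adjacency-product i j x y)
          (≡.trans (s∗s-comm (ι i) (ι j) (x - y)) (≡.sym (adjacency-product j i x y)))
      }
      where
      transpose : ∀ i → ∃ λ i′ → ∀ {x y} → Sι i′ (x - y) ⇔ Sι i (y - x)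
      transpose i = l , λ {x} {y} → mk⇔
        (λ p → S-resp (ι i) ([x-y]⁻¹≈y-x x y) (Equivalence.to (S-opposite (ι i) (x - y)) (subst (λ k → S k (x - y)) ιl≡ p)))
        (λ p → subst (λ k → S k (x - y)) (≡.sym ιl≡) (Equivalence.from (S-opposite (ι i) (x - y)) (S-resp (ι i) (sym ([x-y]⁻¹≈y-x x y)) p)))
        where
        x₀ : Carrier
        x₀ = proj₁ (ι-satisfiable i)
        found : ∃ λ l → ι l ≡ opposite (ι i)
        found = ι-image (opposite (ι i)) (x₀ ⁻¹ , Equivalence.from (S-opposite (ι i) (x₀ ⁻¹))
          (S-resp (ι i) (sym (⁻¹-involutive x₀)) (proj₂ (ι-satisfiable i))))
        l : Fin (suc d)
        l = proj₁ found
        ιl≡ : ι l ≡ opposite (ι i)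
        ιl≡ = proj₂ found

      product : ∀ i j x {k} → Sι k x →
        (ℂ.sum λ l → fromℕ (intersectionNumber (ι i) (ι j) (ι l)) ℂ.* s (ι l) x) ≡ (s (ι i) ∗ s (ι j)) x
      product i j x {k} skx = ≡.trans
        (sum-single (λ l → c l ℂ.* s (ι l) x) k λ l l≢k → ≡.trans
          (cong (c l ℂ.*_) (𝟙-false (Sι? l x) λ slx → l≢k (ι-injective (S-disjoint slx skx))))
          (z*0 (c l)))
        (≡.trans (cong (c k ℂ.*_) (𝟙-true (Sι? k x) skx))
        (≡.trans (z*1 (c k)) (≡.sym (s∗s-class (ι i) (ι j) skx))))
        where
        c : Fin (suc d) → ℚ[i]
        c l = fromℕ (intersectionNumber (ι i) (ι j) (ι l))

  w-class : ∀ a → hat φ a ≡ w (class a)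
  w-class a = HasClass.hat-φ (class-hasClass a)

  class-w : ∀ {a j} → hat φ a ≡ w j → class a ≡ j
  class-w {a} eq = w-injective (≡.trans (≡.sym (w-class a)) eq)

  class-ε : class ε ≡ 0F
  class-ε = class-w (≡.trans (hat-ε φ refl) count-D)

  class-resp : ∀ {a b} → a ≈ b → class a ≡ class b
  class-resp {a} {b} a≈b = class-w (≡.trans hat-resp (w-class b))
    where
    hat-resp : hat φ a ≡ hat φ b
    hat-resp = sumAll-cong λ x → cong (φ x ℂ.*_) (χ-cong {x = x} a≈b refl)

  s-empty⇒P₀≡0 : ∀ i → ¬ Satisfiable (S i) → Pₑ 0F i ≡ ℂ.0#
  s-empty⇒P₀≡0 i empty = ≡.trans (cong (λ j → Pₑ j i) (≡.sym class-ε)) (≡.trans (≡.sym (s-hat≡P i ε))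
    (sumAll-zero _ λ x → ≡.trans (cong (ℂ._* χ ε x) (𝟙-false (S? i x) λ six → empty (x , six))) (0*z (χ ε x))))

  S-satisfiable : ∀ i → Pₑ 0F i ≢ ℂ.0# → Satisfiable (S i)
  S-satisfiable i ≢0 with Satisfiable? i
  ... | yes found = found
  ... | no empty  = contradiction (s-empty⇒P₀≡0 i empty) ≢0

  S₀-satisfiable : Satisfiable (S 0F)
  S₀-satisfiable = ε , Class⇒S refl

  S₁-satisfiable : n ≢ 0 → Satisfiable (S 1F)
  S₁-satisfiable n≢0 = S-satisfiable 1F λ eq → contradiction
    (ℕ.m^n≡1⇒n≡0∨m≡1 2 n (fromℕ-injective (z-w≡0⇒z≡w q ℂ.1# (≡.trans (≡.sym (row₁ 0F)) eq))))
    λ { (inj₁ n≡0) → n≢0 n≡0 ; (inj₂ ()) }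

  module Eigenmatrices (satisfiable : ∀ k → Satisfiable (S k)) where

    private
      R? : ∀ i x y → Dec (difference G enum S i x y)
      R? = difference? G enum S?

    E : Fin 6 → Matrix enum
    E j x y = ν ℂ.* combination enum (λ k → Qₑ k j) (adjacency enum R?) x y

    E⊗E : ∀ i j x y → sumAll (λ z → E i x z ℂ.* E j z y) ≡ (e i ∗ e j) (x - y)
    E⊗E i j x y = sumAll-product (e i) (e j) x y (e-resp i) (e-resp j)

    independent : ∀ (c : Fin 6 → ℚ[i]) → (∀ x → (ℂ.sum λ j → c j ℂ.* e j x) ≡ ℂ.0#) → ∀ m → c m ≡ ℂ.0#
    independent c zero-sum m = begin
      c m
        ≡⟨ sum-δ c m ⟨
      ℂ.sum (λ j → c j ℂ.* 𝟙 (m Fin.≟ j))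
        ≡⟨ sum-cong-≗ (λ j → cong (c j ℂ.*_) (≡.sym (PνQ j))) ⟩
      ℂ.sum (λ j → c j ℂ.* ℂ.sum λ k → Pₑ m k ℂ.* (ν ℂ.* Qₑ k j))
        ≡⟨ sum-cong-≗ (λ j → ≡.trans (*-distribˡ-sum (c j) (λ k → Pₑ m k ℂ.* (ν ℂ.* Qₑ k j)))
             (sum-cong-≗ λ k → rearrange (c j) (Pₑ m k) (ν ℂ.* Qₑ k j))) ⟩
      ℂ.sum (λ j → ℂ.sum λ k → Pₑ m k ℂ.* (c j ℂ.* (ν ℂ.* Qₑ k j)))
        ≡⟨ ∑-comm (λ j k → Pₑ m k ℂ.* (c j ℂ.* (ν ℂ.* Qₑ k j))) ⟩
      ℂ.sum (λ k → ℂ.sum λ j → Pₑ m k ℂ.* (c j ℂ.* (ν ℂ.* Qₑ k j)))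
        ≡⟨ sum-zero _ (λ k → ≡.trans (≡.sym (*-distribˡ-sum (Pₑ m k) (λ j → c j ℂ.* (ν ℂ.* Qₑ k j))))
             (≡.trans (cong (Pₑ m k ℂ.*_) (at-class k)) (z*0 (Pₑ m k)))) ⟩
      ℂ.0# ∎
      where
      open ≡-Reasoning
      open Solver using (solve; _:=_; _:*_)
      rearrange : ∀ u v w → u ℂ.* (v ℂ.* w) ≡ v ℂ.* (u ℂ.* w)
      rearrange = solve 3 (λ u v w → u :* (v :* w) := v :* (u :* w)) ≡.refl
      at-class : ∀ k → (ℂ.sum λ j → c j ℂ.* (ν ℂ.* Qₑ k j)) ≡ ℂ.0#
      at-class k = ≡.trans (sum-cong-≗ λ j → cong (c j ℂ.*_) (≡.sym (e-class j (proj₂ (satisfiable k)))))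
        (zero-sum (proj₁ (satisfiable k)))
      PνQ : ∀ j → (ℂ.sum λ k → Pₑ m k ℂ.* (ν ℂ.* Qₑ k j)) ≡ 𝟙 (m Fin.≟ j)
      PνQ j = ≡.trans (sum-cong-≗ λ k → rearrange (Pₑ m k) ν (Qₑ k j))
        (≡.trans (≡.sym (*-distribˡ-sum ν (λ k → Pₑ m k ℂ.* Qₑ k j)))
        (≡.trans (cong (ν ℂ.*_) (P*Q m j)) (≡.trans (rearrange ν (𝟙 (m Fin.≟ j)) (q ℂ.* q))
        (≡.trans (cong (𝟙 (m Fin.≟ j) ℂ.*_) ν*N≡1) (z*1 (𝟙 (m Fin.≟ j)))))))

    isIdempotentBasis : IsIdempotentBasis enum R? E
    isIdempotentBasis = record
      { idempotent  = λ i x y → ≡.trans (E⊗E i i x y) (e∗e-idempotent i (x - y))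
      ; orthogonal  = λ i j i≢j x y → ≡.trans (E⊗E i j x y) (e∗e-orthogonal i j i≢j (x - y))
      ; inSpan      = λ i → (λ k → ν ℂ.* Qₑ k i) , λ x y →
          ≡.trans (*-distribˡ-sum ν (λ k → Qₑ k i ℂ.* s k (x - y)))
            (sum-cong-≗ λ k → ≡.sym (*-assoc ν (Qₑ k i) (s k (x - y))))
      ; spanning    = λ i → (λ j → Pₑ j i) , λ x y → s-expansion i (x - y)
      ; independent = λ c eq → independent c λ x → ≡.trans
          (combination-e-resp c (sym (x-ε≈x x))) (eq x ε)
      }

    isFirstEigenmatrix : IsFirstEigenmatrix enum R? E Pₑ
    isFirstEigenmatrix i x y = s-expansion i (x - y)

    isSecondEigenmatrix : IsSecondEigenmatrix enum R? E Qₑ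
    isSecondEigenmatrix i x y = ≡.refl

  R̂ : Pred (Carrier → ℚ[i]) 0ℓ
  R̂ f = ∃ λ a → f ≗ χ a

  DualClass : Fin 6 → Pred (Carrier → ℚ[i]) 0ℓ
  DualClass 0F            f = f ≗ χ ε
  DualClass 1F            f = R̂ f × sumOver (S? 1F) f ≡ ℂ.- ℂ.1#
  DualClass (suc (suc k)) f = R̂ f × sumOver (S? 1F) f ≡ ℂ.- ℂ.1# ℂ.+ Values.v n k

  sumOver-≗ : ∀ {f a} → f ≗ χ a → ∀ i → sumOver (S? i) f ≡ Pₑ (class a) i
  sumOver-≗ {f} {a} f≗ i = ≡.trans (sumOver-sumAll (S? i) f)
    (≡.trans (sumAll-cong λ x → cong (s i x ℂ.*_) (f≗ x)) (s-hat≡P i a))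

  DualClass⇒R̂ : ∀ j {f} → DualClass j f → R̂ f
  DualClass⇒R̂ 0F            f≗      = ε , f≗
  DualClass⇒R̂ 1F            (r , _) = r
  DualClass⇒R̂ (suc (suc k)) (r , _) = r

  -1+w : ∀ {f a t} → f ≗ χ a → sumOver (S? 1F) f ≡ ℂ.- ℂ.1# ℂ.+ t → hat φ a ≡ t
  -1+w {f} {a} {t} f≗ eq = begin
    hat φ a                                     ≡⟨ w-class a ⟩
    w (class a)                                 ≡⟨ solve 1 (λ w → w := con ℂ.1# :+ (w :- con ℂ.1#)) ≡.refl (w (class a)) ⟩
    ℂ.1# ℂ.+ (w (class a) ℂ.- ℂ.1#)             ≡⟨ cong (ℂ.1# ℂ.+_) (≡.trans (≡.sym (row₁ (class a))) (≡.trans (≡.sym (sumOver-≗ f≗ 1F)) eq)) ⟩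
    ℂ.1# ℂ.+ (ℂ.- ℂ.1# ℂ.+ t)                   ≡⟨ solve 1 (λ t → con ℂ.1# :+ (con (ℂ.- ℂ.1#) :+ t) := t) ≡.refl t ⟩
    t                                           ∎
    where
    open ≡-Reasoning
    open Solver

  DualClass⇒class : ∀ j {f a} → f ≗ χ a → DualClass j f → class a ≡ j
  DualClass⇒class 0F {f} {a} f≗ f≗ε = class-w (≡.trans
    (sumAll-cong λ x → cong (φ x ℂ.*_) (≡.trans (≡.sym (f≗ x)) (f≗ε x))) (≡.trans (hat-ε φ refl) count-D))
  DualClass⇒class 1F f≗ (_ , eq) = class-w (-1+w f≗ eq)
  DualClass⇒class (suc (suc k)) f≗ (_ , eq) = class-w (-1+w f≗ eq)

  class⇒DualClass : ∀ j {f a} → f ≗ χ a → class a ≡ j → DualClass j f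
  class⇒DualClass 0F {f} {a} f≗ eq x = ≡.trans (f≗ x)
    (χ-cong (HasClass.trivial (class-hasClass a) eq) refl)
  class⇒DualClass 1F {f} {a} f≗ eq = (a , f≗) ,
    ≡.trans (sumOver-≗ f≗ 1F) (≡.trans (cong (λ j → Pₑ j 1F) eq) (row₁ 1F))
  class⇒DualClass (suc (suc k)) {f} {a} f≗ eq = (a , f≗) ,
    ≡.trans (sumOver-≗ f≗ 1F) (≡.trans (cong (λ j → Pₑ j 1F) eq)
      (≡.trans (row₁ (suc (suc k))) (+-comm (Values.v n k) (ℂ.- ℂ.1#))))

  DualClass-row : ∀ j {f} → DualClass j f → ∀ i → Pₑ j i ≡ sumOver (S? i) f
  DualClass-row j {f} c i = row-at (DualClass⇒R̂ j c)
    where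
    row-at : R̂ f → Pₑ j i ≡ sumOver (S? i) f
    row-at (a , f≗) = ≡.trans (cong (λ k → Pₑ k i) (≡.sym (DualClass⇒class j f≗ c))) (≡.sym (sumOver-≗ f≗ i))

  DualClass-satisfiable? : ∀ j → Dec (Satisfiable (DualClass j))
  DualClass-satisfiable? j with search {P = λ a → class a ≡ j} (λ a≈b eq → ≡.trans (≡.sym (class-resp a≈b)) eq) (λ a → class a Fin.≟ j)
  ... | yes (a , eq) = yes (χ a , class⇒DualClass j (λ _ → ≡.refl) eq)
  ... | no ¬found    = no λ (f , c) → ¬found (proj₁ (DualClass⇒R̂ j c) , DualClass⇒class j (proj₂ (DualClass⇒R̂ j c)) c)

  module _ {d d′ : ℕ} (ι : Fin (suc d) → Fin 6) (ι₁ : ∃ λ l → ι l ≡ 1F)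
           {R̂′ : Pred (Carrier → ℚ[i]) 0ℓ} (R̂⇔ : ∀ f → R̂′ f ⇔ R̂ f)
           {𝓔 : Fin 6 → Pred (Carrier → ℚ[i]) 0ℓ} (𝓔⇔ : ∀ j f → 𝓔 j f ⇔ DualClass j f)
           (ι′ : Fin (suc d′) → Fin 6) (discards : DiscardsEmpty 𝓔 ι′) where
    open DiscardsEmptyProperties discards renaming
      (ι-injective to ι′-injective; ι-satisfiable to ι′-satisfiable; ι-image to ι′-image; ι-zero to ι′-zero)

    private
      to : ∀ {j f} → 𝓔 j f → DualClass j f
      to {j} {f} = Equivalence.to (𝓔⇔ j f)

      from : ∀ {j f} → DualClass j f → 𝓔 j f
      from {j} {f} = Equivalence.from (𝓔⇔ j f)

      ι′0≡0 : ι′ zero ≡ 0F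
      ι′0≡0 = ι′-zero (χ ε , from (λ _ → ≡.refl))

    isDual : IsDual G enum (λ l → S? (ι l)) R̂′ (λ l → 𝓔 (ι′ l))
    isDual = record
      { subset    = λ {j} {f} c → Equivalence.from (R̂⇔ f) (DualClass⇒R̂ (ι′ j) (to c))
      ; nonempty  = ι′-satisfiable
      ; covering  = λ {f} r → cover f (proj₁ (Equivalence.to (R̂⇔ f) r)) (proj₂ (Equivalence.to (R̂⇔ f) r))
      ; classes   = λ {j} {k} {f} {g} cf cg → mk⇔ (λ { ≡.refl l → ≡.trans (≡.sym (DualClass-row (ι′ j) (to cf) (ι l))) (DualClass-row (ι′ j) (to cg) (ι l)) })
          λ eq → ι′-injective (w-injective (separate {ι′ j} {ι′ k} (to cf) (to cg) eq))
      ; principal = λ {f} → mk⇔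
          (λ c x → ≡.trans (to (subst (λ j → 𝓔 j f) ι′0≡0 c) x) (χε x refl))
          (λ f≡1 → subst (λ j → 𝓔 j f) (≡.sym ι′0≡0) (from λ x → ≡.trans (f≡1 x) (≡.sym (χε x refl))))
      }
      where
      cover : ∀ f a → f ≗ χ a → ∃ λ l → 𝓔 (ι′ l) f
      cover f a f≗ = proj₁ found , subst (λ j → 𝓔 j f) (≡.sym (proj₂ found)) c
        where
        c : 𝓔 (class a) f
        c = from (class⇒DualClass (class a) f≗ ≡.refl)
        found : ∃ λ l → ι′ l ≡ class a
        found = ι′-image (class a) (f , c)

      separate : ∀ {j k f g} → DualClass j f → DualClass k g →
                 (∀ l → sumOver (S? (ι l)) f ≡ sumOver (S? (ι l)) g) → w j ≡ w k
      separate {j} {k} {f} {g} cf cg eq = z-1-injective (≡.trans (≡.sym (row₁ j)) (≡.trans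
        (≡.trans (DualClass-row j cf 1F) (≡.trans eq₁ (≡.sym (DualClass-row k cg 1F)))) (row₁ k)))
        where
        open Solver
        eq₁ : sumOver (S? 1F) f ≡ sumOver (S? 1F) g
        eq₁ = subst (λ i → sumOver (S? i) f ≡ sumOver (S? i) g) (proj₂ ι₁) (eq (proj₁ ι₁))
        z-1-injective : ∀ {u v} → u ℂ.- ℂ.1# ≡ v ℂ.- ℂ.1# → u ≡ v
        z-1-injective {u} {v} p = ≡.trans (solve 1 (λ u → u := (u :- con ℂ.1#) :+ con ℂ.1#) ≡.refl u)
          (≡.trans (cong (ℂ._+ ℂ.1#) p) (solve 1 (λ v → (v :- con ℂ.1#) :+ con ℂ.1# := v) ≡.refl v))

-- Pseudo-planar functions

module PseudoPlanar {m : ℕ} (G : GR4 (suc m)) (ξ : GR4.Carrier G)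
  (order : Teichmüller.HasTeichmüllerOrder G ξ) (func : Func (GR4.setoid G) (GR4.setoid G))
  (planar : Teichmüller.IsPseudoPlanar G ξ func)
  (f-0 : GR4._≈_ G (Func.to func (GR4.0# G)) (GR4.0# G)) where
  open GR4 G hiding (zero)
  open Teichmüller G ξ
  open Func func using () renaming (to to f; cong to f-cong)
  open IsPseudoPlanar planar using () renaming (closed to f-T; permutes to f-permutes)
  open RingOfCharacteristic4 G
  open TeichmüllerProperties G ξ order
  open Solver using (solve; _:=_; _:+_; _:*_; _:×_; _:-_; :-_)
  open SetoidReasoning setoid
  open RingProperties ring using (+-cancelˡ)

  lift : Carrier → Carrier
  lift x = x + 2 · √ (f x)

  lift-cong : ∀ {x y} → x ≈ y → lift x ≈ lift y
  lift-cong x≈y = +-cong x≈y (×-congʳ 2 (√-cong (f-cong x≈y)))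

  lift∼ : ∀ x → lift x ∼₂ x
  lift∼ x = +2·-∼ {lift x} {x} {√ (f x)} refl

  lift-0 : lift 0# ≈ 0#
  lift-0 = trans (+-identityˡ _) (trans (×-congʳ 2 (trans (√-cong f-0) √0≈0)) 2·0≈0)
    where
    √0≈0 : √ 0# ≈ 0#
    √0≈0 = T-∼⇒≈ (T-√ T-0) T-0 (²∼0⇒∼0 (≈⇒∼ (√-T T-0)))

  lift-injective : ∀ {x y} → T x → T y → lift x ∼₂ lift y → x ≈ y
  lift-injective {x} {y} tx ty eq = T-∼⇒≈ tx ty (trans (sym (lift∼ x)) (trans eq (lift∼ y)))

  2x-lift≈lift : ∀ x → 2 · x - lift x ≈ lift x
  2x-lift≈lift x = solve 2 (λ x s → 2 :× x :- (x :+ 2 :× s) := x :+ 2 :× s) refl x (√ (f x))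

  Z-lift : ∀ x → Z x → ∃ λ t → T t × x - lift t ≈ lift t
  Z-lift x (b , x≈2b) = τ b , T-τ b ,
    trans (+-congʳ (trans x≈2b (sym (τ∼ b)))) (2x-lift≈lift (τ b))

  -- Modulo 2, lift t = (ε + 2w) + lift s means t = s ⊕ ε and
  -- √(sε) + √f(t) + √f(s) = w; the square of the latter is the equation g(s) = w²
  -- for the permutation g belonging to ε.
  module Difference {ε : Carrier} (tε : T ε) (w : Carrier) where

    g : Carrier → Carrier
    g s = f (s ⊕ ε) ⊕ f s ⊕ ε * s

    module _ {s : Carrier} (ts : T s) where
      private
        r a b : Carrier
        r = √ (s * ε)
        a = √ (f (s ⊕ ε))
        b = √ (f s)

        t⊕ : T (s ⊕ ε)
        t⊕ = T-⊕ ts tε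

      T-g : T (g s)
      T-g = T-⊕ (T-⊕ (f-T t⊕) (f-T ts)) (T-* tε ts)

      [r+a+b]²∼g : (r + a + b) * (r + a + b) ∼₂ g s
      [r+a+b]²∼g = begin
        2 · ((r + a + b) * (r + a + b))
          ≈⟨ solve 3 (λ r a b → 2 :× ((r :+ a :+ b) :* (r :+ a :+ b)) := 2 :× (a :* a :+ b :* b :+ r :* r)) refl r a b ⟩
        2 · (a * a + b * b + r * r)
          ≈⟨ ×-congʳ 2 (+-cong (+-cong (√-T (f-T t⊕)) (√-T (f-T ts))) (trans (√-T (T-* ts tε)) (*-comm s ε))) ⟩
        2 · (f (s ⊕ ε) + f s + ε * s)
          ≈⟨ +-∼ {f (s ⊕ ε) + f s} {f (s ⊕ ε) ⊕ f s} {ε * s} {ε * s} (sym (⊕∼+ (f (s ⊕ ε)) (f s))) refl ⟩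
        2 · ((f (s ⊕ ε) ⊕ f s) + ε * s)
          ≈⟨ ⊕∼+ (f (s ⊕ ε) ⊕ f s) (ε * s) ⟨
        2 · g s ∎

      lift⇒g : lift (s ⊕ ε) ≈ (ε + 2 · w) + lift s → g s ≈ w * w
      lift⇒g eq = T-∼⇒≈ T-g (T-² w) (trans (sym [r+a+b]²∼g) (≈⇒∼ (∼⇒²≈ r+a+b∼w)))
        where
        r+a+b∼w : r + a + b ∼₂ w
        r+a+b∼w = +-cancelˡ (s + ε) _ _ (begin
          s + ε + 2 · (r + a + b)
            ≈⟨ solve 5 (λ s e r a b → s :+ e :+ 2 :× (r :+ a :+ b) := (s :+ e :+ 2 :× r :+ 2 :× a) :+ 2 :× b) refl s ε r a b ⟩
          lift (s ⊕ ε) + 2 · b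
            ≈⟨ +-congʳ eq ⟩
          (ε + 2 · w) + lift s + 2 · b
            ≈⟨ solve 4 (λ s e w b → (e :+ 2 :× w) :+ (s :+ 2 :× b) :+ 2 :× b := s :+ e :+ 2 :× w) refl s ε w b ⟩
          s + ε + 2 · w ∎)

      g⇒lift : g s ≈ w * w → lift (s ⊕ ε) ≈ (ε + 2 · w) + lift s
      g⇒lift eq = begin
        lift (s ⊕ ε)
          ≈⟨ solve 5 (λ s e r a b → (s :+ e :+ 2 :× r :+ 2 :× a) := s :+ e :+ 2 :× (r :+ a :+ b) :+ 2 :× b) refl s ε r a b ⟩
        s + ε + 2 · (r + a + b) + 2 · b
          ≈⟨ +-congʳ (+-congˡ (²-∼-injective (trans [r+a+b]²∼g (≈⇒∼ eq)))) ⟩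
        s + ε + 2 · w + 2 · b
          ≈⟨ solve 4 (λ s e w b → s :+ e :+ 2 :× w :+ 2 :× b := (e :+ 2 :× w) :+ (s :+ 2 :× b)) refl s ε w b ⟩
        (ε + 2 · w) + lift s ∎

  UniqueDifference : Carrier → Set
  UniqueDifference x = ∃₂ λ s t → T s × T t × lift t ≈ x + lift s ×
    (∀ s′ t′ → T s′ → T t′ → lift t′ ≈ x + lift s′ → t′ ≈ t)

  difference-unique : ∀ x → ¬ Z x → UniqueDifference x
  difference-unique x ¬zx = solution (PermutesT.surjective g-permutes (T-² w))
    where
    ε : Carrier
    ε = τ x

    ε≉0 : ¬ ε ≈ 0#
    ε≉0 ε≈0 = ¬zx (∼0⇒Z (trans (sym (τ∼ x)) (≈⇒∼ ε≈0)))

    expanded : ∃ λ w → x ≈ ε + 2 · w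
    expanded = ∼⇒≈+2· (sym (τ∼ x))

    w : Carrier
    w = proj₁ expanded

    x≈ : x ≈ ε + 2 · w
    x≈ = proj₂ expanded

    open Difference (T-τ x) w

    g-permutes : PermutesT g
    g-permutes = f-permutes (T-τ x) ε≉0

    solution : (∃ λ s → T s × g s ≈ w * w) → UniqueDifference x
    solution (s , ts , gs≈) = s , s ⊕ ε , ts , T-⊕ ts (T-τ x) ,
      trans (g⇒lift ts gs≈) (+-congʳ (sym x≈)) , unique
      where
      unique : ∀ s′ t′ → T s′ → T t′ → lift t′ ≈ x + lift s′ → t′ ≈ s ⊕ ε
      unique s′ t′ ts′ tt′ eq = trans t′≈ (⊕-congʳ s′≈s)
        where
        t′≈ : t′ ≈ s′ ⊕ ε
        t′≈ = T-∼⇒≈ tt′ (T-⊕ ts′ (T-τ x)) (begin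
          2 · t′              ≈⟨ lift∼ t′ ⟨
          2 · lift t′         ≈⟨ ≈⇒∼ eq ⟩
          2 · (x + lift s′)   ≈⟨ +-∼ {x} {ε} {lift s′} {s′} (sym (τ∼ x)) (lift∼ s′) ⟩
          2 · (ε + s′)        ≈⟨ ≈⇒∼ (+-comm ε s′) ⟩
          2 · (s′ + ε)        ≈⟨ ⊕∼+ s′ ε ⟨
          2 · (s′ ⊕ ε)        ∎)
        s′≈s : s′ ≈ s
        s′≈s = PermutesT.injective g-permutes ts′ ts (trans
          (lift⇒g ts′ (trans (lift-cong (sym t′≈)) (trans eq (+-congʳ x≈)))) (sym gs≈))
        ⊕-congʳ : ∀ {u v} → u ≈ v → u ⊕ ε ≈ v ⊕ ε
        ⊕-congʳ u≈v = +-cong (+-congʳ u≈v) (×-congʳ 2 (√-cong (*-congʳ u≈v)))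

-- The parameter b is kept abstract so that the matrices need not be unfolded.
data ParityData (n : ℕ) : Set where
  odd  : n % 2 ≡ 1 → ∀ b → b ≡ fromℕ (2 ℕ.^ ((n ∸ 1) / 2)) →
         Eigendata n (Values.Odd.P b) (Values.Odd.Q b) → ParityData n
  even : n % 2 ≡ 0 → ∀ b → b ≡ fromℕ (2 ℕ.^ ((n ∸ 2) / 2)) →
         Eigendata n (Values.Even.P b) (Values.Even.Q b) → ParityData n

parityData : ∀ m → ParityData (suc m)
parityData m = cases (even⊎odd m)
  where
  open EigendataConstruction
  open SumsOfTwoSquares using (even⊎odd)
  exponent : ∀ l → fromℕ (2 ℕ.^ l) ≡ fromℕ (2 ℕ.^ (l ℕ.* 2 / 2))
  exponent l = cong (λ k → fromℕ (2 ℕ.^ k)) (≡.sym (m*n/n≡m l 2))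

  odd-data : ∀ l → ParityData (1 ℕ.+ l ℕ.* 2)
  odd-data l = odd ([m+kn]%n≡m%n 1 l 2) (fromℕ (2 ℕ.^ l)) (exponent l) (eigendata-odd l)

  even-data : ∀ l → ParityData (2 ℕ.+ l ℕ.* 2)
  even-data l = even (m*n%n≡0 (suc l) 2) (fromℕ (2 ℕ.^ l)) (exponent l) (eigendata-even l)

  cases : (∃ λ k → m ≡ 2 ℕ.* k ⊎ m ≡ 1 ℕ.+ 2 ℕ.* k) → ParityData (suc m)
  cases (l , inj₁ eq) = ≡.subst (λ k → ParityData (suc k)) (≡.sym (≡.trans eq (ℕ.*-comm 2 l))) (odd-data l)
  cases (l , inj₂ eq) = ≡.subst (λ k → ParityData (suc k)) (≡.sym (≡.trans eq (cong suc (ℕ.*-comm 2 l)))) (even-data l)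

module Scheme {m : ℕ} (G : GR4 (suc m)) (ξ : GR4.Carrier G)
  (order : Teichmüller.HasTeichmüllerOrder G ξ) (f : Func (GR4.setoid G) (GR4.setoid G))
  (planar : Teichmüller.IsPseudoPlanar G ξ f) (f-0 : GR4._≈_ G (Func.to f (GR4.0# G)) (GR4.0# G))
  (traceCharacter : TraceCharacter G)
  (χ≡χ[] : ∀ a x → TraceCharacter.χ traceCharacter a x ≡ Teichmüller.χ[_] G ξ a x) where
  open GR4 G hiding (zero)
  open Teichmüller G ξ
  open Classes G ξ f
  open RingOfCharacteristic4 G
  open TeichmüllerProperties G ξ order
  open TraceCharacter traceCharacter using (χ)
  open TraceCharacterProperties G ξ order traceCharacter
  open PseudoPlanar G ξ order f planar f-0
  open Solver using (solve; _:=_; _:+_; _:*_; _:×_; _:-_; :-_; con)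
  open RingProperties ring using (-‿involutive)

  2^n : ℕ
  2^n = 2 ℕ.^ suc m

  Z-resp : ∀ {x y} → x ≈ y → Z x → Z y
  Z-resp x≈y (b , x≈2b) = b , trans (sym x≈y) x≈2b

  Z[x-y]⇒x∼₂y : ∀ {x y} → Z (x - y) → x ∼₂ y
  Z[x-y]⇒x∼₂y {x} {y} z = trans
    (solve 2 (λ x y → 2 :× x := 2 :× (x :- y) :+ 2 :× y) refl x y)
    (trans (+-congʳ (trans (Z⇒∼0 z) 2·0≈0)) (+-identityˡ _))

  D-lift : ∀ {x} → T x → D (lift x)
  D-lift {x} tx = x , tx , refl

  D-injective : ∀ {x y} → D x → D y → Z (x - y) → x ≈ y
  D-injective (t , tt , x≈) (u , tu , y≈) z = trans x≈ (trans (lift-cong (lift-injective tt tu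
    (trans (sym (≈⇒∼ x≈)) (trans (Z[x-y]⇒x∼₂y z) (≈⇒∼ y≈))))) (sym y≈))

  x-y≈z⇒x≈y+z : ∀ {x y z} → x - y ≈ z → x ≈ y + z
  x-y≈z⇒x≈y+z {x} {y} eq = trans (solve 2 (λ x y → x := y :+ (x :- y)) refl x y) (+-congˡ eq)

  x≈y+z⇒x-y≈z : ∀ {x y z} → x ≈ y + z → x - y ≈ z
  x≈y+z⇒x-y≈z {x} {y} {z} eq = trans (+-congʳ eq) (solve 2 (λ y z → y :+ z :- y := z) refl y z)

  D-difference : ∀ x → ¬ Z x → ∃ λ y → (D y × D (y - x)) × (∀ y′ → D y′ → D (y′ - x) → y′ ≈ y)
  D-difference x ¬zx = from-unique (difference-unique x ¬zx)
    where
    from-unique : UniqueDifference x → ∃ λ y → (D y × D (y - x)) × (∀ y′ → D y′ → D (y′ - x) → y′ ≈ y)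
    from-unique (s , t , ts , tt , eq , unique) =
      lift t , (D-lift tt , s , ts , x≈y+z⇒x-y≈z eq) ,
      λ { y′ (t′ , tt′ , y′≈) (s′ , ts′ , y′-x≈) → trans y′≈ (lift-cong (unique s′ t′ ts′ tt′
            (trans (sym y′≈) (x-y≈z⇒x≈y+z y′-x≈)))) }

  D-half : ∀ x → Z x → ∃ λ y → D y × D (x - y)
  D-half x zx = lift (proj₁ half) , D-lift (proj₁ (proj₂ half)) , proj₁ half , proj₁ (proj₂ half) , proj₂ (proj₂ half)
    where
    half : ∃ λ t → T t × x - lift t ≈ lift t
    half = Z-lift x zx

  count-Z : FiniteSums.count enum Z? ≡ fromℕ 2^n
  count-Z = ≡.trans
    (FiniteSums.count-enumerated enum Z? Z-resp (λ i → 2 · t i)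
      (λ {i} {j} eq → t-injective {i} {j} (T-∼⇒≈ (T-t i) (T-t j) eq))
      (λ i → t i , refl)
      (λ x (b , x≈2b) → proj₁ (T⇒t (T-τ b)) ,
        trans x≈2b (trans (sym (τ∼ b)) (≈⇒∼ (proj₂ (T⇒t (T-τ b)))))))
    (cong fromℕ 1+M≡2^n)

  count-D : FiniteSums.count enum D? ≡ fromℕ 2^n
  count-D = ≡.trans
    (FiniteSums.count-enumerated enum D? D-resp (λ i → lift (t i))
      (λ {i} {j} eq → t-injective {i} {j} (lift-injective (T-t i) (T-t j) (≈⇒∼ eq)))
      (λ i → D-lift (T-t i))
      (λ x (u , tu , x≈) → proj₁ (T⇒t tu) , trans x≈ (lift-cong (proj₂ (T⇒t tu)))))
    (cong fromℕ 1+M≡2^n)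

  open PlanarClasses +-abelianGroup Z D using (Class) renaming (S₀₋₃ to S₀₋₃′)

  S₂⇔ : ∀ x → S₂ x ⇔ (D (- x) × ¬ x ≈ 0#)
  S₂⇔ x = mk⇔
    (λ (y , (dy , y≉0) , x≈-y) → D-resp (trans (sym (-‿involutive y)) (-‿cong (sym x≈-y))) dy ,
      λ x≈0 → y≉0 (trans (sym (-‿involutive y)) (trans (-‿cong (trans (sym x≈-y) x≈0)) -0≈0)))
    (λ (d , x≉0) → - x , (d , λ -x≈0 → x≉0 (trans (sym (-‿involutive x)) (trans (-‿cong -x≈0) -0≈0))) , sym (-‿involutive x))
    where
    -0≈0 : - 0# ≈ 0#
    -0≈0 = solve 0 (:- con 0 := con 0) refl

  S₀₋₃⇔ : ∀ x → S₀₋₃ x ⇔ S₀₋₃′ x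
  S₀₋₃⇔ x = mk⇔
    (λ { (inj₁ s) → inj₁ s ; (inj₂ (inj₁ s)) → inj₂ (inj₁ s)
       ; (inj₂ (inj₂ (inj₁ s))) → inj₂ (inj₂ (inj₁ (Equivalence.to (S₂⇔ x) s)))
       ; (inj₂ (inj₂ (inj₂ s))) → inj₂ (inj₂ (inj₂ s)) })
    (λ { (inj₁ s) → inj₁ s ; (inj₂ (inj₁ s)) → inj₂ (inj₁ s)
       ; (inj₂ (inj₂ (inj₁ s))) → inj₂ (inj₂ (inj₁ (Equivalence.from (S₂⇔ x) s)))
       ; (inj₂ (inj₂ (inj₂ s))) → inj₂ (inj₂ (inj₂ s)) })

  S⇔Class : ∀ i x → S i x ⇔ Class i x
  S⇔Class 0F x = mk⇔ id id
  S⇔Class 1F x = mk⇔ id id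
  S⇔Class 2F x = S₂⇔ x
  S⇔Class 3F x = mk⇔ id id
  S⇔Class 4F x = mk⇔
    (λ (¬s , sum) → ¬s ∘ Equivalence.from (S₀₋₃⇔ x) , sum)
    (λ (¬s , sum) → ¬s ∘ Equivalence.to (S₀₋₃⇔ x) , sum)
  S⇔Class 5F x = mk⇔
    (λ (¬s , ¬s₄) → ¬s ∘ Equivalence.from (S₀₋₃⇔ x) , λ sum → ¬s₄ (¬s , sum))
    (λ (¬s , ¬sum) → ¬s ∘ Equivalence.to (S₀₋₃⇔ x) , ¬sum ∘ proj₂)

  setting : PlanarSetting +-abelianGroup enum (suc m)
  setting = record
    { order = ≡.sym (2^k*2^k≡4^k (suc m))
    ; bicharacter = record
      { χ = χ ; χ-cong = χ-cong ; χ-∙ = χ-+ ; χ-ε = χ-0 ; χ-sym = χ-sym ; χ-⁻¹ = χ-neg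
      ; χ-nondegenerate = χ-nondegenerate Z?
      }
    ; χ-values = χ-values
    ; Z = Z
    ; D = D
    ; Z? = Z?
    ; D? = D?
    ; Z-resp = Z-resp
    ; D-resp = D-resp
    ; Z-ε = 0# , sym 2·0≈0
    ; Z-∙ = λ (a , x≈) (b , y≈) → a + b , trans (+-cong x≈ y≈) (solve 2 (λ a b → 2 :× a :+ 2 :× b := 2 :× (a :+ b)) refl a b)
    ; Z-⁻¹ = λ (a , x≈) → - a , trans (-‿cong x≈) (solve 1 (λ a → :- (2 :× a) := 2 :× (:- a)) refl a)
    ; Z-double = λ x → x , +-congˡ (sym (+-identityʳ x))
    ; Z-torsion = λ {x} x+x≈0 → ∼0⇒Z (trans (+-congˡ (+-identityʳ x)) (trans x+x≈0 (sym 2·0≈0)))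
    ; χ-nondegenerate-Z = χ-nondegenerate-Z
    ; χ-trivial-Z = λ (a , x≈) (b , y≈) → χ-annihilated (trans (*-cong x≈ y≈) (solve 2 (λ a b → (2 :× a) :* (2 :× b) := con 0) refl a b))
    ; D-ε = 0# , T-0 , sym lift-0
    ; D-injective = D-injective
    ; D-difference = D-difference
    ; D-half = D-half
    ; count-Z = count-Z
    ; count-D = count-D
    ; S = S
    ; S? = S?
    ; S⇔Class = S⇔Class
    }

  module _ {P Q : Values.SquareMatrix} (eigendata : Eigendata (suc m) P Q) where
    open PlanarScheme setting eigendata using
      (Satisfiable?; module Subfamily; DualClass; DualClass-satisfiable?; DualClass-row; S-satisfiable; S₀-satisfiable; S₁-satisfiable; isDual; module Eigenmatrices) renaming (R̂ to R̂′)

    R̂⇔ : ∀ φ → R̂ φ ⇔ R̂′ φ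
    R̂⇔ φ = mk⇔ (λ (a , φ≗) → a , λ x → ≡.trans (φ≗ x) (≡.sym (χ≡χ[] a x)))
               (λ (a , φ≗) → a , λ x → ≡.trans (φ≗ x) (χ≡χ[] a x))

    𝓔⇔ : ∀ j φ → 𝓔 j φ ⇔ DualClass j φ
    𝓔⇔ 0F            φ = mk⇔ (λ φ≗ x → ≡.trans (φ≗ x) (≡.sym (χ≡χ[] 0# x))) (λ φ≗ x → ≡.trans (φ≗ x) (χ≡χ[] 0# x))
    𝓔⇔ 1F            φ = mk⇔ (λ (r , eq) → Equivalence.to (R̂⇔ φ) r , eq) (λ (r , eq) → Equivalence.from (R̂⇔ φ) r , eq)
    𝓔⇔ (suc (suc k)) φ = mk⇔ (λ (r , eq) → Equivalence.to (R̂⇔ φ) r , eq) (λ (r , eq) → Equivalence.from (R̂⇔ φ) r , eq)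

    𝓔-satisfiable? : ∀ j → Dec (Satisfiable (𝓔 j))
    𝓔-satisfiable? j = map′ (λ (φ , c) → φ , Equivalence.from (𝓔⇔ j φ) c) (λ (φ , c) → φ , Equivalence.to (𝓔⇔ j φ) c)
      (DualClass-satisfiable? j)

    schurRing : ∃₂ λ d (ι : Fin (suc d) → Fin 6) →
      DiscardsEmpty S ι ×
      IsSchurRing +-abelianGroup enum (S? ∘ ι) ×
      (∃₂ λ d′ (ι′ : Fin (suc d′) → Fin 6) →
        DiscardsEmpty 𝓔 ι′ ×
        IsDual +-abelianGroup enum (S? ∘ ι) R̂ (𝓔 ∘ ι′))
    schurRing = assemble (discardsEmpty S Satisfiable? S₀-satisfiable)
      (discardsEmpty 𝓔 𝓔-satisfiable? (χ[ 0# ] , λ _ → ≡.refl))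
      where
      assemble : (∃₂ λ d (ι : Fin (suc d) → Fin 6) → DiscardsEmpty S ι) →
                 (∃₂ λ d (ι : Fin (suc d) → Fin 6) → DiscardsEmpty 𝓔 ι) → _
      assemble (d , ι , discards) (d′ , ι′ , discards′) = d , ι , discards ,
        Subfamily.isSchurRing ι ι-injective (ι-zero S₀-satisfiable) ι-satisfiable ι-image ,
        d′ , ι′ , discards′ , isDual ι (ι-image 1F (S₁-satisfiable λ ())) R̂⇔ 𝓔⇔ ι′ discards′
        where open DiscardsEmptyProperties discards

    module _ (3≤n : 3 ℕ.≤ suc m) where
      satisfiable : ∀ i → Satisfiable (S i)
      satisfiable i = S-satisfiable i (Eigendata.P₀≢0 eigendata 3≤n i)

      isAssociationScheme : IsAssociationScheme enum 𝓡?
      isAssociationScheme = Subfamily.isSchurRing id id ≡.refl satisfiable (λ i _ → i , ≡.refl)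

      hasEigenmatrices : HasEigenmatrices P Q
      hasEigenmatrices = E , isIdempotentBasis , isFirstEigenmatrix , isSecondEigenmatrix ,
        λ j φ c → DualClass-row j (Equivalence.to (𝓔⇔ j φ) c)
        where open Eigenmatrices satisfiable

  Conclusion : Set
  Conclusion =
    (∃₂ λ d (ι : Fin (suc d) → Fin 6) →
      DiscardsEmpty S ι ×
      IsSchurRing +-abelianGroup enum (S? ∘ ι) ×
      (∃₂ λ d′ (ι′ : Fin (suc d′) → Fin 6) →
        DiscardsEmpty 𝓔 ι′ ×
        IsDual +-abelianGroup enum (S? ∘ ι) R̂ (𝓔 ∘ ι′)))
    ×
    (3 ℕ.≤ suc m →
      IsAssociationScheme enum 𝓡? ×
      (suc m % 2 ≡ 1 → let b = fromℕ (2 ℕ.^ ((suc m ∸ 1) / 2)) in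
        HasEigenmatrices (Values.Odd.P b) (Values.Odd.Q b)) ×
      (suc m % 2 ≡ 0 → let b = fromℕ (2 ℕ.^ ((suc m ∸ 2) / 2)) in
        HasEigenmatrices (Values.Even.P b) (Values.Even.Q b)))

  conclusion : ParityData (suc m) → Conclusion
  conclusion (odd n-odd _ ≡.refl data′) = schurRing data′ , λ 3≤n → isAssociationScheme data′ 3≤n ,
    (λ _ → hasEigenmatrices data′ 3≤n) , λ n-even → contradiction (≡.trans (≡.sym n-odd) n-even) λ ()
  conclusion (even n-even _ ≡.refl data′) = schurRing data′ , λ 3≤n → isAssociationScheme data′ 3≤n ,
    (λ n-odd → contradiction (≡.trans (≡.sym n-even) n-odd) λ ()) , λ _ → hasEigenmatrices data′ 3≤n

theorem4p4 : (n : ℕ) (G : GR4 n) (ξ : GR4.Carrier G) →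
    let open GR4 G
        open Teichmüller G ξ in
    HasTeichmüllerOrder →
    (f : Func setoid setoid) → IsPseudoPlanar f → Func.to f 0# ≈ 0# →
    let open Classes G ξ f in
    (∃₂ λ d (ι : Fin (suc d) → Fin 6) →
      DiscardsEmpty S ι ×
      IsSchurRing +-abelianGroup enum (S? ∘ ι) ×
      (∃₂ λ d′ (ι′ : Fin (suc d′) → Fin 6) →
        DiscardsEmpty 𝓔 ι′ ×
        IsDual +-abelianGroup enum (S? ∘ ι) R̂ (𝓔 ∘ ι′)))
    ×
    (3 ℕ.≤ n →
      IsAssociationScheme enum 𝓡? ×
      (n % 2 ≡ 1 → let b = fromℕ (2 ℕ.^ ((n ∸ 1) / 2)) in
        HasEigenmatrices (Values.Odd.P b) (Values.Odd.Q b)) ×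
      (n % 2 ≡ 0 → let b = fromℕ (2 ℕ.^ ((n ∸ 2) / 2)) in
        HasEigenmatrices (Values.Even.P b) (Values.Even.Q b)))
theorem4p4 zero G ξ = contradiction (trans (sym (strictlyInverseʳ 1#)) (trans (from-cong (Fin-1 (to 1#) (to 0#))) (strictlyInverseʳ 0#)))
  (RingOfCharacteristic4.1≉0 G)
  where
  open GR4 G using (trans; sym; enum; 1#; 0#)
  open Inverse enum using (to; from-cong; strictlyInverseʳ)
  Fin-1 : (i j : Fin 1) → i ≡ j
  Fin-1 0F 0F = ≡.refl
theorem4p4 (suc m) G ξ order f planar f-0 =
  Scheme.conclusion G ξ order f planar f-0 traceCharacter (λ a x → ≡.refl) (parityData m)
  where
  open TeichmüllerProperties G ξ order using (trace-cong; trace-+; trace-nondegenerate; χ-spec)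
  traceCharacter : TraceCharacter G
  traceCharacter = record
    { trace = Teichmüller.trace G ξ ; trace-cong = trace-cong ; trace-+ = trace-+
    ; trace-nondegenerate = trace-nondegenerate
    ; χ = Teichmüller.χ[_] G ξ ; χ-spec = χ-spec
    }
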